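{- For every fixed $\varepsilon>0$ and every fixed prime $p$, the following holds for all positive integers $n$. For any subset $A\subseteq \mathbb{F}_p^n$ not containing distinct vectors $x_1,\dots,x_p\in A$ with $x_1+\dots+x_p=0$, we have $|A|\le D_{\varepsilon,p}\cdot (C_\varepsilon p^{\varepsilon})^n$. Here, $C_\varepsilon$ is a constant only depending on $\varepsilon$, and $D_{\varepsilon,p}$ is a constant only depending on $\varepsilon$ and $p$. -}

module Defs where

open import Data.Nat using (ℕ; zero; suc; _+_)
open import Data.Nat.Divisibility using (_∣_)
open import Data.Fin using (Fin; toℕ) renaming (zero to fzero; suc to fsuc)
open import Data.Vec using (Vec; lookup)
open import Data.List using (List)
open import Data.List.Membership.Propositional using (_∈_)
open import Data.Product using (Σ; _×_)
open import Function.Definitions using (Injective)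
open import Relation.Binary.PropositionalEquality using (_≡_)
open import Relation.Nullary using (¬_)

Σ< : (k : ℕ) → (Fin k → ℕ) → ℕ
Σ< zero    f = 0
Σ< (suc k) f = f fzero + Σ< k (λ j → f (fsuc j))

-- Vectors of F_p^n are represented as Vec (Fin p) n (entries = residues 0..p-1).
-- A family x : Fin k → F_p^n sums to zero in F_p^n iff in every coordinate
-- the sum of the entries (as naturals) is divisible by p.
SumsToZero : (p n k : ℕ) → (Fin k → Vec (Fin p) n) → Set
SumsToZero p n k x = (i : Fin n) → p ∣ Σ< k (λ j → toℕ (lookup (x j) i))

-- A (a finite subset of F_p^n, given as a duplicate-free list) contains
-- p distinct vectors x_1, ..., x_p with x_1 + ... + x_p = 0.
HasZeroSumPTuple : (p n : ℕ) → List (Vec (Fin p) n) → Set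
HasZeroSumPTuple p n A =
  Σ (Fin p → Vec (Fin p) n) λ x →
    Injective _≡_ _≡_ x × ((j : Fin p) → x j ∈ A) × SumsToZero p n p x

{-# OPTIONS --safe #-}
module Submission where

-- Two facts are combined. First, by the polynomial method, any more than C ^ n points of 𝔽_p ^ n contain a nontrivial relation
-- T x = w₁ + … + w_T, with T a small constant fraction of p: a function h on the points that kills all monomials of degree at
-- most (p − 1) n / T also kills, in h(w₁) ⋯ h(w_T), the polynomial detecting such relations. Starting from p x = 0 and
-- repeatedly replacing T-fold multiples in this way, one gets a zero-sum multiset of p elements in which no element takes
-- more than a 1 / K share; it splits into blocks of K distinct elements (and a few spare ones).
--
-- Second, if A has at least p ^ (ε n) elements (times constants ^ n), then for some K bounded in terms of ε there is a subset of
-- size still exponential in n such that the sum of any K of its elements has so many representations as a K-fold sum from A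
-- that each block can be exchanged for fresh elements of A. This needs a dense B ⊆ A whose K-fold sums are evenly spread.
-- Let m k be the largest number of representations as a k-fold sum. The densities m k / |B| ^ k decrease in k but not below
-- p ^ (- n), so they are almost stationary at some scale; there a Balog–Szemerédi–Gowers argument between B and its k-fold
-- sums gives B′ ⊆ B all of whose iterated sumsets have size about |B| ^ k / m k. If the sums of B′ are not evenly spread, then its
-- maximal density is much larger than that of B, and one iterates, boundedly often, with B′ at a much smaller scale.

open import Defs
import Algebra.Properties.CommutativeSemigroup as CommutativeSemigroup
open import Data.Bool using (Bool; true; false; _∧_; _∨_; not)
import Data.Bool as Bool
open import Data.Fin using (Fin; toℕ; funToFin; finToFun; combine) renaming (zero to fzero; suc to fsuc)
import Data.Fin.Properties as Fin
open import Data.List using (List; []; _∷_; length; map; _++_; filter; take; drop; replicate; allFin; cartesianProductWith; upTo)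
import Data.List as List
import Data.List.Membership.DecPropositional as DecMembership
open import Data.List.Membership.Propositional using (_∈_; _∉_; lose)
open import Data.List.Membership.Propositional.Properties using (∈-++⁻; ∈-++⁺ˡ; ∈-++⁺ʳ; ∈-map⁺; ∈-map⁻; ∈-filter⁻; ∈-lookup; ∈-allFin; ∈-upTo⁺; ∈-upTo⁻; ∈-cartesianProductWith⁺; ∈-cartesianProductWith⁻)
open import Data.List.Properties using (length-map; length-++; length-take; length-replicate; length-tabulate; length-upTo; filter-all; take++drop≡id; map-++; ++-assoc; ++-identityʳ)
open import Data.List.Relation.Unary.All using (All; []; _∷_)
import Data.List.Relation.Unary.All as All
import Data.List.Relation.Unary.All.Properties as All
open import Data.List.Relation.Unary.AllPairs using ([]; _∷_)
open import Data.List.Relation.Unary.Any using (Any; here; there; any?; index; satisfied)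
open import Data.List.Relation.Unary.Any.Properties using (lookup-index)
open import Data.List.Relation.Unary.Unique.Propositional using (Unique)
import Data.List.Relation.Unary.Unique.Propositional.Properties as Unique
open import Data.Nat
open import Data.Nat.DivMod using (_/_; _%_; _mod_; %-distribˡ-+; %-distribˡ-*; m*n%n≡0; m%n%n≡m%n; n%n≡0; m<n⇒m%n≡m; m%n<n; [m+kn]%n≡m%n; m≡m%n+[m/n]*n; m*n/n≡m; m/n*n≤m; m/n≤m; /-monoˡ-≤; m≥n⇒m/n>0)
open import Data.Nat.Divisibility using (_∣_; _∣0; ∣1⇒≡1; ∣⇒≤; n∣m*n; ∣m⇒∣m*n; ∣n⇒∣m*n; ∣m∣n⇒∣m+n; ∣m+n∣m⇒∣n; m%n≡0⇒n∣m; n∣m⇒m%n≡0)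
open import Data.Nat.Primality using (Prime; euclidsLemma; prime⇒nonZero; prime⇒nonTrivial)
open import Data.Nat.Properties
open import Data.Nat.Tactic.RingSolver using (solve-∀)
open import Data.Product using (Σ; ∃; ∃₂; _×_; _,_; proj₁; proj₂)
open import Data.Sum using (_⊎_; inj₁; inj₂; [_,_]′)
open import Data.Vec using (Vec; []; _∷_; updateAt; zipWith)
import Data.Vec as Vec
open import Data.Vec.Properties using (≡-dec; zipWith-assoc; zipWith-comm; zipWith-identityˡ; zipWith-inverseˡ; lookup-zipWith; lookup-replicate)
open import Function.Definitions using (Injective)
open import Relation.Binary.Definitions using (DecidableEquality; tri<; tri≈; tri>)
open import Relation.Binary.PropositionalEquality
open import Relation.Nullary using (¬_; Dec; yes; no; ⌊_⌋; contradiction; ¬?)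
open import Relation.Nullary.Decidable using (toWitness; _×-dec_)

-- Finite sums

open CommutativeSemigroup +-commutativeSemigroup using () renaming (interchange to +-interchange; x∙yz≈y∙xz to +-swap)
open CommutativeSemigroup *-commutativeSemigroup using () renaming (interchange to *-interchange; x∙yz≈y∙xz to *-swap; xy∙z≈xz∙y to *-swapʳ)

-- The base of the exponential is independent of `p` because the polynomial method only has to kill
-- monomials of degree at most 4 k n in n variables, of which there are at most 2 ^ ((4 k + 1) n);
-- here k bounds the block length. So k must be bounded in terms of ε alone. It is, because each
-- failure to be even costs a fixed factor X: with X about p ^ (n / I), densities lie between X ^ (-
-- I) and 1, so at most I failures fit. For I = 5 b the resulting bound X ^ 5 is about p ^ (n / b).
-- The obstacle is that shrinking B loses powers of ρ whose exponents grow with the number of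
-- summands. Therefore X stays fixed, while ρ is replaced by a power of itself at each failure. The
-- scales are fixed in advance by the mutual recursion of `reach` and `power`: a failure leads to a
-- smaller scale, and the exponent of ρ in X is large compared with all scales still to come. Plain
-- additive relations would not do for the last step, since p x = 0 is one already; distinctness is
-- what the fresh representations provide.

∑ : {A : Set} → List A → (A → ℕ) → ℕ
∑ []       f = 0
∑ (x ∷ xs) f = f x + ∑ xs f

# : Bool → ℕ
# true  = 1
# false = 0

#≤1 : ∀ b → # b ≤ 1
#≤1 true  = s≤s z≤n
#≤1 false = z≤n

module _ {A : Set} where

  ∑-cong : ∀ (xs : List A) {f g : A → ℕ} → (∀ x → f x ≡ g x) → ∑ xs f ≡ ∑ xs g
  ∑-cong []       e = refl
  ∑-cong (x ∷ xs) e = cong₂ _+_ (e x) (∑-cong xs e)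

  ∑-mono-∈ : ∀ (xs : List A) {f g : A → ℕ} → (∀ {x} → x ∈ xs → f x ≤ g x) → ∑ xs f ≤ ∑ xs g
  ∑-mono-∈ []       e = z≤n
  ∑-mono-∈ (x ∷ xs) e = +-mono-≤ (e (here refl)) (∑-mono-∈ xs (λ i → e (there i)))

  ∑-mono : ∀ (xs : List A) {f g : A → ℕ} → (∀ x → f x ≤ g x) → ∑ xs f ≤ ∑ xs g
  ∑-mono xs e = ∑-mono-∈ xs (λ {x} _ → e x)

  ∑-+ : ∀ (xs : List A) (f g : A → ℕ) → ∑ xs (λ x → f x + g x) ≡ ∑ xs f + ∑ xs g
  ∑-+ []       f g = refl
  ∑-+ (x ∷ xs) f g = trans (cong (f x + g x +_) (∑-+ xs f g)) (+-interchange (f x) (g x) (∑ xs f) (∑ xs g))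

  ∑-*ˡ : ∀ c (xs : List A) (f : A → ℕ) → ∑ xs (λ x → c * f x) ≡ c * ∑ xs f
  ∑-*ˡ c []       f = sym (*-zeroʳ c)
  ∑-*ˡ c (x ∷ xs) f = trans (cong (c * f x +_) (∑-*ˡ c xs f)) (sym (*-distribˡ-+ c (f x) (∑ xs f)))

  ∑-*ʳ : ∀ c (xs : List A) (f : A → ℕ) → ∑ xs (λ x → f x * c) ≡ ∑ xs f * c
  ∑-*ʳ c xs f = trans (∑-cong xs (λ x → *-comm (f x) c)) (trans (∑-*ˡ c xs f) (*-comm c (∑ xs f)))

  ∑-0 : ∀ (xs : List A) → ∑ xs (λ _ → 0) ≡ 0
  ∑-0 []       = refl
  ∑-0 (x ∷ xs) = ∑-0 xs

  ∑-const : ∀ (xs : List A) c → ∑ xs (λ _ → c) ≡ length xs * c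
  ∑-const []       c = refl
  ∑-const (x ∷ xs) c = cong (c +_) (∑-const xs c)

  ∑-term : ∀ {xs : List A} (f : A → ℕ) {x} → x ∈ xs → f x ≤ ∑ xs f
  ∑-term f (here refl) = m≤m+n _ _
  ∑-term f (there i)   = ≤-trans (∑-term f i) (m≤n+m _ _)

  -- The form in which all averaging arguments below are run; strictness is what excludes the empty
  -- list.
  ∑-<⇒∃ : ∀ (xs : List A) {f g : A → ℕ} → ∑ xs f < ∑ xs g → ∃ λ x → x ∈ xs × f x < g x
  ∑-<⇒∃ [] ()
  ∑-<⇒∃ (x ∷ xs) {f} {g} lt with f x <? g x
  ... | yes p = x , here refl , p
  ... | no ¬p with ∑-<⇒∃ xs (+-cancelˡ-< (f x) _ _ (<-≤-trans lt (+-monoˡ-≤ (∑ xs g) (≮⇒≥ ¬p))))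
  ...   | y , i , q = y , there i , q

  ∑->0⇒∃ : ∀ (xs : List A) {f : A → ℕ} → 0 < ∑ xs f → ∃ λ x → x ∈ xs × 0 < f x
  ∑->0⇒∃ xs {f} lt = ∑-<⇒∃ xs {λ _ → 0} (subst (_< ∑ xs f) (sym (∑-0 xs)) lt)

  max : List A → (A → ℕ) → ℕ
  max []       f = 0
  max (x ∷ xs) f = f x ⊔ max xs f

  max-upper : ∀ {xs : List A} (f : A → ℕ) {x} → x ∈ xs → f x ≤ max xs f
  max-upper f (here refl) = m≤m⊔n _ _
  max-upper f (there i)   = ≤-trans (max-upper f i) (m≤n⊔m _ _)

  max-lub : ∀ (xs : List A) {f : A → ℕ} {c} → (∀ x → f x ≤ c) → max xs f ≤ c
  max-lub []       h = z≤n
  max-lub (x ∷ xs) h = ⊔-lub (h x) (max-lub xs h)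

∑-swap : ∀ {A B : Set} (xs : List A) (ys : List B) (f : A → B → ℕ) →
         ∑ xs (λ x → ∑ ys (f x)) ≡ ∑ ys (λ y → ∑ xs (λ x → f x y))
∑-swap []       ys f = sym (∑-0 ys)
∑-swap (x ∷ xs) ys f = trans (cong (∑ ys (f x) +_) (∑-swap xs ys f))
                             (sym (∑-+ ys (f x) (λ y → ∑ xs (λ x → f x y))))

module Delta {A : Set} (_≟_ : DecidableEquality A) where

  δ : A → A → ℕ
  δ x a = # ⌊ x ≟ a ⌋

  δ-refl : ∀ a → δ a a ≡ 1
  δ-refl a with a ≟ a
  ... | yes _ = refl
  ... | no ¬p = contradiction refl ¬p

  δ-≢ : ∀ {x a} → x ≢ a → δ x a ≡ 0
  δ-≢ {x} {a} x≢a with x ≟ a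
  ... | yes p = contradiction p x≢a
  ... | no _  = refl

  δ-⇔ : ∀ {x a y b} → (x ≡ a → y ≡ b) → (y ≡ b → x ≡ a) → δ x a ≡ δ y b
  δ-⇔ {x} {a} {y} {b} to from with x ≟ a | y ≟ b
  ... | yes _ | yes _ = refl
  ... | yes p | no ¬q = contradiction (to p) ¬q
  ... | no ¬p | yes q = contradiction (from q) ¬p
  ... | no _  | no _  = refl

  ∑-δ∉ : ∀ {xs a} (f : A → ℕ) → a ∉ xs → ∑ xs (λ x → δ x a * f x) ≡ 0
  ∑-δ∉ {[]} f _ = refl
  ∑-δ∉ {x ∷ xs} {a} f ∉ =
    cong₂ _+_ (cong (_* f x) (δ-≢ (λ { refl → ∉ (here refl) }))) (∑-δ∉ f (λ i → ∉ (there i)))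

  ∑-δ : ∀ {xs a} (f : A → ℕ) → Unique xs → a ∈ xs → ∑ xs (λ x → δ x a * f x) ≡ f a
  ∑-δ {x ∷ xs} {a} f (x∉ ∷ u) (here refl) =
    trans (cong₂ _+_ (trans (cong (_* f a) (δ-refl a)) (+-identityʳ (f a)))
                     (∑-δ∉ f (λ i → All.lookup x∉ i refl)))
          (+-identityʳ (f a))
  ∑-δ {x ∷ xs} {a} f (x∉ ∷ u) (there i) =
    cong₂ _+_ (cong (_* f x) (δ-≢ (All.lookup x∉ i))) (∑-δ f u i)

-- Sums over a finite abelian group

record FinGroup : Set₁ where
  infixl 6 _⊕_
  field
    G        : Set
    _≟G_     : DecidableEquality G
    _⊕_      : G → G → G
    𝟘        : G
    ⊖_       : G → G
    ⊕-assoc  : ∀ x y z → (x ⊕ y) ⊕ z ≡ x ⊕ (y ⊕ z)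
    ⊕-comm   : ∀ x y → x ⊕ y ≡ y ⊕ x
    ⊕-idˡ    : ∀ x → 𝟘 ⊕ x ≡ x
    ⊕-invˡ   : ∀ x → (⊖ x) ⊕ x ≡ 𝟘
    univ     : List G
    univ-all : ∀ x → x ∈ univ
    univ-unq : Unique univ

module GroupSums (𝔾 : FinGroup) where
  open FinGroup 𝔾 public
  open Delta _≟G_ public

  infixl 6 _∸G_
  _∸G_ : G → G → G
  z ∸G x = z ⊕ (⊖ x)

  S : (G → ℕ) → ℕ
  S = ∑ univ

  ⊕-idʳ : ∀ x → x ⊕ 𝟘 ≡ x
  ⊕-idʳ x = trans (⊕-comm x 𝟘) (⊕-idˡ x)

  -⊕ : ∀ z x → (z ∸G x) ⊕ x ≡ z
  -⊕ z x = trans (⊕-assoc z (⊖ x) x) (trans (cong (z ⊕_) (⊕-invˡ x)) (⊕-idʳ z))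

  ⊕- : ∀ z x → (z ⊕ x) ∸G x ≡ z
  ⊕- z x = trans (⊕-assoc z x (⊖ x)) (trans (cong (z ⊕_) (trans (⊕-comm x (⊖ x)) (⊕-invˡ x))) (⊕-idʳ z))

  ⊕-cancelʳ : ∀ {x y} z → x ⊕ z ≡ y ⊕ z → x ≡ y
  ⊕-cancelʳ {x} {y} z e = trans (sym (⊕- x z)) (trans (cong (_∸G z) e) (⊕- y z))

  ⊕-swapʳ : ∀ x y z → (x ⊕ y) ⊕ z ≡ (x ⊕ z) ⊕ y
  ⊕-swapʳ x y z = trans (⊕-assoc x y z) (trans (cong (x ⊕_) (⊕-comm y z)) (sym (⊕-assoc x z y)))

  -swap : ∀ z x y → (z ∸G x) ∸G y ≡ (z ∸G y) ∸G x
  -swap z x y = ⊕-swapʳ z (⊖ x) (⊖ y)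

  sub-sub : ∀ z x → z ∸G (z ∸G x) ≡ x
  sub-sub z x = ⊕-cancelʳ (z ∸G x) (trans (-⊕ z (z ∸G x)) (trans (sym (-⊕ z x)) (⊕-comm (z ∸G x) x)))

  -assoc : ∀ z x y → z ∸G (x ⊕ y) ≡ (z ∸G x) ∸G y
  -assoc z x y = ⊕-cancelʳ (x ⊕ y) (trans (-⊕ z (x ⊕ y))
    (sym (trans (cong (((z ∸G x) ∸G y) ⊕_) (⊕-comm x y))
      (trans (sym (⊕-assoc ((z ∸G x) ∸G y) y x)) (trans (cong (_⊕ x) (-⊕ (z ∸G x) y)) (-⊕ z x))))))

  S-δ : ∀ a (f : G → ℕ) → S (λ x → δ x a * f x) ≡ f a
  S-δ a f = ∑-δ f univ-unq (univ-all a)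

  -- Both sides equal the double sum of `δ y (φ x) * f y`, because y ≡ φ x holds exactly when x ≡ ψ
  -- y; this way the list `univ` itself is never permuted.
  S-bij : (φ ψ : G → G) → (∀ x → φ (ψ x) ≡ x) → (∀ x → ψ (φ x) ≡ x) → ∀ f → S (λ x → f (φ x)) ≡ S f
  S-bij φ ψ φψ ψφ f = begin
    S (λ x → f (φ x))                        ≡⟨ ∑-cong univ (λ x → sym (S-δ (φ x) f)) ⟩
    S (λ x → S (λ y → δ y (φ x) * f y))      ≡⟨ ∑-swap univ univ _ ⟩
    S (λ y → S (λ x → δ y (φ x) * f y))      ≡⟨ ∑-cong univ (λ y → ∑-cong univ (λ x →
        cong (_* f y) (δ-⇔ {y} {φ x} {x} {ψ y} (λ e → trans (sym (ψφ x)) (cong ψ (sym e)))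
                                             (λ e → trans (sym (φψ y)) (cong φ (sym e)))))) ⟩
    S (λ y → S (λ x → δ x (ψ y) * f y))      ≡⟨ ∑-cong univ (λ y → S-δ (ψ y) (λ _ → f y)) ⟩
    S f                                      ∎
    where open ≡-Reasoning

  S-shift : ∀ a f → S (λ x → f (x ⊕ a)) ≡ S f
  S-shift a = S-bij (_⊕ a) (_∸G a) (λ x → -⊕ x a) (λ x → ⊕- x a)

  S-shiftˡ : ∀ a f → S (λ x → f (a ⊕ x)) ≡ S f
  S-shiftˡ a f = trans (∑-cong univ (λ x → cong f (⊕-comm a x))) (S-shift a f)

  S-sub : ∀ a f → S (λ x → f (x ∸G a)) ≡ S f
  S-sub a = S-bij (_∸G a) (_⊕ a) (λ x → ⊕- x a) (λ x → -⊕ x a)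

  S-refl : ∀ z f → S (λ x → f (z ∸G x)) ≡ S f
  S-refl z = S-bij (z ∸G_) (z ∸G_) (sub-sub z) (sub-sub z)

  ∣_∣ : (G → Bool) → ℕ
  ∣ P ∣ = S (λ x → # (P x))

-- Representation counts

module Counts (𝔾 : FinGroup) where
  open GroupSums 𝔾

  conv : (G → ℕ) → (G → ℕ) → G → ℕ
  conv f g z = S (λ y → f y * g (z ∸G y))

  -- Substituting z = a ⊕ c. It collapses the triple sums of the stationarity argument to sums over
  -- a single representation count.
  S-conv : ∀ (f g φ : G → ℕ) → S (λ a → S (λ c → f a * g c * φ (a ⊕ c))) ≡ S (λ z → conv f g z * φ z)
  S-conv f g φ = begin
    S (λ a → S (λ c → f a * g c * φ (a ⊕ c)))
      ≡⟨ ∑-cong univ (λ a → ∑-cong univ (λ c → cong₂ (λ u v → f a * g u * φ v) (sym (⊕- c a)) (⊕-comm a c))) ⟩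
    S (λ a → S (λ c → f a * g ((c ⊕ a) ∸G a) * φ (c ⊕ a)))
      ≡⟨ ∑-cong univ (λ a → S-shift a (λ z → f a * g (z ∸G a) * φ z)) ⟩
    S (λ a → S (λ z → f a * g (z ∸G a) * φ z))
      ≡⟨ ∑-swap univ univ _ ⟩
    S (λ z → S (λ a → f a * g (z ∸G a) * φ z))
      ≡⟨ ∑-cong univ (λ z → ∑-*ʳ (φ z) univ _) ⟩
    S (λ z → conv f g z * φ z) ∎
    where open ≡-Reasoning

  S-conv-1 : ∀ (f g : G → ℕ) → S (conv f g) ≡ S f * S g
  S-conv-1 f g = begin
    S (conv f g)                         ≡⟨ ∑-cong univ (λ z → sym (*-identityʳ _)) ⟩
    S (λ z → conv f g z * 1)             ≡⟨ sym (S-conv f g (λ _ → 1)) ⟩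
    S (λ a → S (λ c → f a * g c * 1))    ≡⟨ ∑-cong univ (λ a → trans (∑-cong univ (λ c → *-identityʳ _)) (∑-*ˡ (f a) univ g)) ⟩
    S (λ a → f a * S g)                  ≡⟨ ∑-*ʳ (S g) univ f ⟩
    S f * S g                            ∎
    where open ≡-Reasoning

  module Reps (B : G → Bool) where

    b : ℕ
    b = ∣ B ∣

    -- Tuples are ordered and may repeat elements, which makes convolution identities exact;
    -- distinctness is recovered later by `fresh`.
    r : ℕ → G → ℕ
    r zero    z = δ z 𝟘
    r (suc k) z = conv (λ x → # (B x)) (r k) z

    m : ℕ → ℕ
    m k = max univ (r k)

    r≤m : ∀ k z → r k z ≤ m k
    r≤m k z = max-upper (r k) (univ-all z)

    supp : ℕ → G → Bool
    supp k z = 0 <ᵇ r k z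

    r-total : ∀ k → S (r k) ≡ b ^ k
    r-total zero    = trans (∑-cong univ (λ z → sym (*-identityʳ (δ z 𝟘)))) (S-δ 𝟘 (λ _ → 1))
    r-total (suc k) = trans (S-conv-1 (λ x → # (B x)) (r k)) (cong (b *_) (r-total k))

    r-conv : ∀ j k z → conv (r j) (r k) z ≡ r (j + k) z
    r-conv zero    k z = trans (S-δ 𝟘 (λ y → r k (z ∸G y))) (cong (r k) (trans (sym (⊕-idʳ (z ∸G 𝟘))) (-⊕ z 𝟘)))
    r-conv (suc j) k z = begin
      S (λ y → S (λ x → # (B x) * r j (y ∸G x)) * r k (z ∸G y))
        ≡⟨ ∑-cong univ (λ y → sym (∑-*ʳ (r k (z ∸G y)) univ _)) ⟩
      S (λ y → S (λ x → # (B x) * r j (y ∸G x) * r k (z ∸G y)))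
        ≡⟨ ∑-swap univ univ _ ⟩
      S (λ x → S (λ y → # (B x) * r j (y ∸G x) * r k (z ∸G y)))
        ≡⟨ ∑-cong univ (λ x → sym (S-shift x (λ y → # (B x) * r j (y ∸G x) * r k (z ∸G y)))) ⟩
      S (λ x → S (λ y → # (B x) * r j ((y ⊕ x) ∸G x) * r k (z ∸G (y ⊕ x))))
        ≡⟨ ∑-cong univ (λ x → trans (∑-cong univ (λ y →
             trans (cong₂ (λ u v → # (B x) * r j u * r k v) (⊕- y x) (trans (cong (z ∸G_) (⊕-comm y x)) (-assoc z x y)))
                   (*-assoc (# (B x)) _ _)))
             (∑-*ˡ (# (B x)) univ _)) ⟩
      S (λ x → # (B x) * conv (r j) (r k) (z ∸G x))
        ≡⟨ ∑-cong univ (λ x → cong (# (B x) *_) (r-conv j k (z ∸G x))) ⟩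
      r (suc j + k) z ∎
      where open ≡-Reasoning

    m-suc : ∀ k → m (suc k) ≤ b * m k
    m-suc k = max-lub univ λ z → begin
      S (λ x → # (B x) * r k (z ∸G x))  ≤⟨ ∑-mono univ (λ x → *-monoʳ-≤ (# (B x)) (r≤m k (z ∸G x))) ⟩
      S (λ x → # (B x) * m k)           ≡⟨ ∑-*ʳ (m k) univ _ ⟩
      b * m k                           ∎
      where open ≤-Reasoning

    -- Once the first j summands are fixed, a k-fold representation remains.
    m-+ : ∀ j k → m (j + k) ≤ b ^ j * m k
    m-+ zero    k = ≤-reflexive (sym (*-identityˡ (m k)))
    m-+ (suc j) k = ≤-trans (m-suc (j + k)) (≤-trans (*-monoʳ-≤ b (m-+ j k)) (≤-reflexive (sym (*-assoc b (b ^ j) (m k)))))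

    b^≤ : ∀ k → b ^ k ≤ length univ * m k
    b^≤ k = begin
      b ^ k              ≡⟨ sym (r-total k) ⟩
      S (r k)            ≤⟨ ∑-mono univ (r≤m k) ⟩
      S (λ _ → m k)      ≡⟨ ∑-const univ (m k) ⟩
      length univ * m k  ∎
      where open ≤-Reasoning

    m-pos : 0 < b → ∀ k → 0 < m k
    m-pos b>0 k with m k | b^≤ k
    ... | suc _ | _ = s≤s z≤n
    ... | zero  | h = contradiction (<-≤-trans (m^n>0 b {{>-nonZero b>0}} k)
                        (≤-trans h (≤-reflexive (*-zeroʳ (length univ))))) (n≮n 0)

    m0≤1 : m 0 ≤ 1
    m0≤1 = max-lub univ (λ z → #≤1 ⌊ z ≟G 𝟘 ⌋)

    -- r (k + k) z pairs r k with its own reflection in z. Cauchy-Schwarz, here as AM-GM in each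
    -- term, bounds this by the energy, and the reflection does not change the sum of squares.
    sum-squares : ∀ k → m (k + k) ≤ S (λ u → r k u * r k u)
    sum-squares k = max-lub univ λ z → *-cancelˡ-≤ 2 (begin
      2 * r (k + k) z
        ≡⟨ cong (2 *_) (sym (r-conv k k z)) ⟩
      2 * S (λ y → r k y * r k (z ∸G y))
        ≡⟨ sym (∑-*ˡ 2 univ _) ⟩
      S (λ y → 2 * (r k y * r k (z ∸G y)))
        ≤⟨ ∑-mono univ (λ y → amgm (r k y) (r k (z ∸G y))) ⟩
      S (λ y → r k y * r k y + r k (z ∸G y) * r k (z ∸G y))
        ≡⟨ ∑-+ univ _ _ ⟩
      S (λ y → r k y * r k y) + S (λ y → r k (z ∸G y) * r k (z ∸G y))
        ≡⟨ cong (S (λ y → r k y * r k y) +_) (S-refl z (λ y → r k y * r k y)) ⟩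
      S (λ y → r k y * r k y) + S (λ y → r k y * r k y)
        ≡⟨ cong (S (λ y → r k y * r k y) +_) (sym (+-identityʳ _)) ⟩
      2 * S (λ u → r k u * r k u) ∎)
      where
      open ≤-Reasoning
      amgm-ordered : ∀ x d → 2 * (x * (x + d)) + d * d ≡ x * x + (x + d) * (x + d)
      amgm-ordered = solve-∀
      amgm≤ : ∀ {x y} → x ≤ y → 2 * (x * y) ≤ x * x + y * y
      amgm≤ {x} {y} x≤y = subst (λ y → 2 * (x * y) ≤ x * x + y * y) (m+[n∸m]≡n x≤y)
        (≤-trans (m≤m+n _ _) (≤-reflexive (amgm-ordered x (y ∸ x))))
      amgm : ∀ x y → 2 * (x * y) ≤ x * x + y * y
      amgm x y with ≤-total x y
      ... | inj₁ p = amgm≤ p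
      ... | inj₂ p = ≤-trans (≤-reflexive (cong (2 *_) (*-comm x y))) (≤-trans (amgm≤ p) (≤-reflexive (+-comm (y * y) (x * x))))

-- A Balog–Szemerédi–Gowers step

#-∧ : ∀ x y → # (x ∧ y) ≡ # x * # y
#-∧ true  y = sym (*-identityˡ (# y))
#-∧ false y = refl

#>0 : ∀ {x} → 0 < # x → x ≡ true
#>0 {true} _ = refl

when : ∀ a {u v} → (a ≡ true → u ≤ v) → # a * u ≤ v
when true  f = ≤-trans (≤-reflexive (*-identityˡ _)) (f refl)
when false f = z≤n

⌊⌋-true : ∀ {P : Set} {d : Dec P} → ⌊ d ⌋ ≡ true → P
⌊⌋-true {d = yes p} _ = p

∧-true : ∀ {x y} → x ∧ y ≡ true → x ≡ true × y ≡ true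
∧-true {true} {true} _ = refl , refl

0<*⇒ : ∀ m n → 0 < m * n → 0 < m × 0 < n
0<*⇒ (suc m) (suc n) _ = s≤s z≤n , s≤s z≤n
0<*⇒ (suc m) zero    h = contradiction (subst (0 <_) (*-zeroʳ m) h) (n≮n 0)

_⊆ᵇ_ : {A : Set} → (A → Bool) → (A → Bool) → Set
P ⊆ᵇ Q = ∀ x → P x ≡ true → Q x ≡ true

module BSG (𝔾 : FinGroup) where
  open GroupSums 𝔾
  open Counts 𝔾

  -- Join s and y in P when s ⊕ y lies in V. This counts the paths s, y, x ⊕ s of length two whose
  -- ends differ by an element x of B.
  Triples : (B P V : G → Bool) → ℕ
  Triples B P V = S λ x → S λ s → S λ y →
    # (B x) * (# (P s) * # (P (x ⊕ s)) * # (P y) * # (V (s ⊕ y)) * # (V ((x ⊕ s) ⊕ y)))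

  -- The multiples of h by 2, 4, 8 and 16 are separate parameters tied by equations, so that they
  -- remain atoms in the inequalities.
  module Core (B P V : G → Bool) (Λ h h₂ h₄ h₈ h₁₆ : ℕ)
              (h₂≡ : h₂ ≡ h + h) (h₄≡ : h₄ ≡ h₂ + h₂) (h₈≡ : h₈ ≡ h₄ + h₄) (h₁₆≡ : h₁₆ ≡ h₈ + h₈)
              (Λ>0 : 0 < Λ) (h>0 : 0 < h) (b>0 : 0 < ∣ B ∣)
              (P≤Λ : ∣ P ∣ ≤ Λ) (V≤Λ : ∣ V ∣ ≤ Λ)
              (many : ∣ B ∣ * (Λ * Λ) ≤ h * Triples B P V) where

    -- Chosen for `rem≤`: the pivot has at most h₂ Λ ^ 2 / q bad pairs, so at most h₁₆ h₂ Λ / q = Λ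
    -- / h₈ points have more than Λ / h₁₆ bad partners.
    q : ℕ
    q = h₁₆ * (h₂ * h₈)

    E : G → G → ℕ
    E s y = # (V (s ⊕ y))

    b : ℕ
    b = ∣ B ∣

    codeg : G → G → ℕ
    codeg s w = S λ y → # (P y) * (E s y * E w y)

    bad : G → G → Bool
    bad s w = ⌊ q * codeg s w <? Λ ⌋

    n : G → ℕ
    n y = S λ x → S λ s → # (B x) * (# (P s) * # (P (x ⊕ s)) * (E s y * E (x ⊕ s) y))

    β : G → ℕ
    β y = S λ s → S λ w → # (P s) * # (P w) * # (bad s w) * (E s y * E w y)

    S-P-n : S (λ y → # (P y) * n y) ≡ Triples B P V
    S-P-n = begin
      S (λ y → # (P y) * n y)
        ≡⟨ ∑-cong univ (λ y → trans (sym (∑-*ˡ (# (P y)) univ _)) (∑-cong univ (λ x → sym (∑-*ˡ (# (P y)) univ _)))) ⟩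
      S (λ y → S λ x → S λ s → F y x s)
        ≡⟨ ∑-swap univ univ _ ⟩
      S (λ x → S λ y → S λ s → F y x s)
        ≡⟨ ∑-cong univ (λ x → ∑-swap univ univ _) ⟩
      S (λ x → S λ s → S λ y → F y x s)
        ≡⟨ ∑-cong univ (λ x → ∑-cong univ (λ s → ∑-cong univ (λ y → shuffle (# (P y)) (# (B x)) (# (P s)) (# (P (x ⊕ s))) (E s y) (E (x ⊕ s) y)))) ⟩
      Triples B P V ∎
      where
      open ≡-Reasoning
      F : G → G → G → ℕ
      F y x s = # (P y) * (# (B x) * (# (P s) * # (P (x ⊕ s)) * (E s y * E (x ⊕ s) y)))
      shuffle : ∀ a b c d e f → a * (b * (c * d * (e * f))) ≡ b * (c * d * a * e * f)
      shuffle = solve-∀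

    q*bad : ∀ s w → # (bad s w) * (q * codeg s w) ≤ Λ
    q*bad s w with q * codeg s w <? Λ
    ... | yes p = ≤-trans (≤-reflexive (*-identityˡ _)) (<⇒≤ p)
    ... | no _  = z≤n

    -- Summing over y first turns each bad pair into its codegree, which is below Λ / q, and there
    -- are at most Λ ^ 2 pairs.
    S-P-β : q * S (λ y → # (P y) * β y) ≤ Λ * (Λ * Λ)
    S-P-β = begin
      q * S (λ y → # (P y) * β y)
        ≡⟨ cong (q *_) (∑-cong univ (λ y → trans (sym (∑-*ˡ (# (P y)) univ _)) (∑-cong univ (λ s → sym (∑-*ˡ (# (P y)) univ _))))) ⟩
      q * S (λ y → S λ s → S λ w → F y s w)
        ≡⟨ cong (q *_) (trans (∑-swap univ univ _) (∑-cong univ (λ s → ∑-swap univ univ _))) ⟩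
      q * S (λ s → S λ w → S λ y → F y s w)
        ≡⟨ trans (sym (∑-*ˡ q univ _)) (∑-cong univ (λ s → sym (∑-*ˡ q univ _))) ⟩
      S (λ s → S λ w → q * S λ y → F y s w)
        ≡⟨ ∑-cong univ (λ s → ∑-cong univ (λ w →
             trans (cong (q *_) (trans (∑-cong univ (λ y → *-swap (# (P y)) (# (P s) * # (P w) * # (bad s w)) (E s y * E w y))) (∑-*ˡ (# (P s) * # (P w) * # (bad s w)) univ _)))
                   (regroup q (# (P s)) (# (P w)) (# (bad s w)) (codeg s w)))) ⟩
      S (λ s → S λ w → # (P s) * (# (P w) * (# (bad s w) * (q * codeg s w))))
        ≤⟨ ∑-mono univ (λ s → ∑-mono univ (λ w → *-monoʳ-≤ (# (P s)) (*-monoʳ-≤ (# (P w)) (q*bad s w)))) ⟩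
      S (λ s → S λ w → # (P s) * (# (P w) * Λ))
        ≡⟨ ∑-cong univ (λ s → trans (∑-*ˡ (# (P s)) univ _) (cong (# (P s) *_) (∑-*ʳ Λ univ _))) ⟩
      S (λ s → # (P s) * (∣ P ∣ * Λ))
        ≡⟨ ∑-*ʳ (∣ P ∣ * Λ) univ _ ⟩
      ∣ P ∣ * (∣ P ∣ * Λ)
        ≤⟨ *-mono-≤ P≤Λ (*-monoˡ-≤ Λ P≤Λ) ⟩
      Λ * (Λ * Λ) ∎
      where
      open ≤-Reasoning
      F : G → G → G → ℕ
      F y s w = # (P y) * (# (P s) * # (P w) * # (bad s w) * (E s y * E w y))
      regroup : ∀ a b c d e → a * (b * c * d * e) ≡ b * (c * (d * (a * e)))
      regroup = solve-∀

    T>0 : 0 < Triples B P V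
    T>0 = proj₂ (0<*⇒ h _ (<-≤-trans (m*n>0 b>0 (m*n>0 Λ>0 Λ>0)) many))
      where
      m*n>0 : ∀ {m n} → 0 < m → 0 < n → 0 < m * n
      m*n>0 (s≤s _) (s≤s _) = s≤s z≤n

    P>0 : 0 < ∣ P ∣
    P>0 with ∑->0⇒∃ univ (subst (0 <_) (sym S-P-n) T>0)
    ... | y , i , lt = <-≤-trans (proj₁ (0<*⇒ (# (P y)) _ lt)) (∑-term (λ y → # (P y)) i)

    -- Averaged over y in P, each of the two terms on the left totals at most b Λ ^ 3, and `many`
    -- bounds the right-hand side from below by twice that. One y thus has few bad pairs and many
    -- paths at once.
    pivot : ∃ λ y → P y ≡ true × b * (q * β y) + b * (Λ * Λ) ≤ h₂ * Λ * n y
    -- The summand 1 makes the comparison of the totals strict, as P is nonempty; at a single y it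
    -- disappears again by integrality.
    pivot = from (∑-<⇒∃ univ {λ y → # (P y) * (b * (q * β y) + b * (Λ * Λ))} {λ y → # (P y) * (h₂ * Λ * n y + 1)} key)
      where
      open ≤-Reasoning
      split : ∀ a b c d e → a * (b * (c * d) + b * e) ≡ b * (c * (a * d)) + a * (b * e)
      split = solve-∀
      split′ : ∀ a b c → a * (b * c + 1) ≡ b * (a * c) + a
      split′ = solve-∀
      final : ∀ b Λ → b * (Λ * (Λ * Λ)) + Λ * (b * (Λ * Λ)) ≡ (Λ + Λ) * (b * (Λ * Λ))
      final = solve-∀
      regroup : ∀ h Λ t → (Λ + Λ) * (h * t) ≡ (h + h) * Λ * t
      regroup = solve-∀
      key : S (λ y → # (P y) * (b * (q * β y) + b * (Λ * Λ))) < S (λ y → # (P y) * (h₂ * Λ * n y + 1))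
      key = begin-strict
        S (λ y → # (P y) * (b * (q * β y) + b * (Λ * Λ)))
          ≡⟨ ∑-cong univ (λ y → split (# (P y)) b q (β y) (Λ * Λ)) ⟩
        S (λ y → b * (q * (# (P y) * β y)) + # (P y) * (b * (Λ * Λ)))
          ≡⟨ trans (∑-+ univ _ _) (cong₂ _+_ (trans (∑-*ˡ b univ _) (cong (b *_) (∑-*ˡ q univ _))) (∑-*ʳ (b * (Λ * Λ)) univ _)) ⟩
        b * (q * S (λ y → # (P y) * β y)) + ∣ P ∣ * (b * (Λ * Λ))
          ≤⟨ +-mono-≤ (*-monoʳ-≤ b S-P-β) (*-monoˡ-≤ (b * (Λ * Λ)) P≤Λ) ⟩
        b * (Λ * (Λ * Λ)) + Λ * (b * (Λ * Λ))
          ≡⟨ final b Λ ⟩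
        (Λ + Λ) * (b * (Λ * Λ))
          ≤⟨ *-monoʳ-≤ (Λ + Λ) many ⟩
        (Λ + Λ) * (h * Triples B P V)
          ≡⟨ trans (regroup h Λ (Triples B P V)) (cong (λ k → k * Λ * Triples B P V) (sym h₂≡)) ⟩
        h₂ * Λ * Triples B P V
          <⟨ m<m+n _ P>0 ⟩
        h₂ * Λ * Triples B P V + ∣ P ∣
          ≡⟨ cong (λ t → h₂ * Λ * t + ∣ P ∣) (sym S-P-n) ⟩
        h₂ * Λ * S (λ y → # (P y) * n y) + ∣ P ∣
          ≡⟨ cong (_+ ∣ P ∣) (sym (∑-*ˡ (h₂ * Λ) univ _)) ⟩
        S (λ y → h₂ * Λ * (# (P y) * n y)) + ∣ P ∣
          ≡⟨ sym (∑-+ univ _ _) ⟩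
        S (λ y → h₂ * Λ * (# (P y) * n y) + # (P y))
          ≡⟨ ∑-cong univ (λ y → sym (split′ (# (P y)) (h₂ * Λ) (n y))) ⟩
        S (λ y → # (P y) * (h₂ * Λ * n y + 1)) ∎
      unwrap : ∀ a {u v} → # a * u < # a * (v + 1) → a ≡ true × u ≤ v
      unwrap true  lt = refl , s≤s⁻¹ (subst₂ _<_ (*-identityˡ _) (trans (*-identityˡ _) (+-comm _ 1)) lt)
      unwrap false lt = contradiction lt (n≮n 0)
      from : (∃ λ y → y ∈ univ × # (P y) * (b * (q * β y) + b * (Λ * Λ)) < # (P y) * (h₂ * Λ * n y + 1)) →
             ∃ λ y → P y ≡ true × b * (q * β y) + b * (Λ * Λ) ≤ h₂ * Λ * n y
      from (y , _ , lt) = y , unwrap (P y) lt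

    module Pivoted (y₀ : G) (pivotal : b * (q * β y₀) + b * (Λ * Λ) ≤ h₂ * Λ * n y₀) where

      -- Dependent random choice: few pairs of points of S₀ have few common neighbours.
      S₀ : G → Bool
      S₀ s = P s ∧ V (s ⊕ y₀)

      d : G → ℕ
      d w = S λ s → # (S₀ s) * # (bad s w)

      S₁ rem : G → Bool
      S₁ w = S₀ w ∧ ⌊ h₁₆ * d w ≤? Λ ⌋
      rem w = S₀ w ∧ not ⌊ h₁₆ * d w ≤? Λ ⌋

      -- Representations of x as a difference in S₀. On B′ the bounds for ν, ν₁ and ν₂ are Λ / h₄, Λ
      -- / h₈ and Λ / h₁₆: each passage loses at most half, first to `rem`, then to the bad partners
      -- of w.
      ν ν₁ : G → ℕ
      ν x  = S λ s → # (S₀ s) * # (S₀ (x ⊕ s))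
      ν₁ x = S λ s → # (S₀ s) * # (S₁ (x ⊕ s))

      B′ : G → Bool
      B′ x = B x ∧ ⌊ Λ ≤? h₄ * ν x ⌋

      B′⊆B : B′ ⊆ᵇ B
      B′⊆B x e = proj₁ (∧-true e)

      S₀≤Λ : ∣ S₀ ∣ ≤ Λ
      S₀≤Λ = ≤-trans (∑-mono univ (λ s → ≤-trans (≤-reflexive (#-∧ (P s) _))
               (≤-trans (*-monoʳ-≤ (# (P s)) (#≤1 (V (s ⊕ y₀)))) (≤-reflexive (*-identityʳ _))))) P≤Λ

      ν≤Λ : ∀ x → ν x ≤ Λ
      ν≤Λ x = ≤-trans (∑-mono univ (λ s → ≤-trans (*-monoʳ-≤ (# (S₀ s)) (#≤1 (S₀ (x ⊕ s)))) (≤-reflexive (*-identityʳ _)))) S₀≤Λ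

      n≡ : n y₀ ≡ S (λ x → # (B x) * ν x)
      n≡ = ∑-cong univ λ x → trans (∑-*ˡ (# (B x)) univ _) (cong (# (B x) *_) (∑-cong univ λ s →
        trans (*-interchange (# (P s)) (# (P (x ⊕ s))) (E s y₀) (E (x ⊕ s) y₀))
              (cong₂ _*_ (sym (#-∧ (P s) _)) (sym (#-∧ (P (x ⊕ s)) _)))))

      β≡ : β y₀ ≡ S (λ w → # (S₀ w) * d w)
      β≡ = trans (∑-swap univ univ _) (∑-cong univ λ w → trans
        (∑-cong univ λ s → trans (shuffle (# (P s)) (# (P w)) (# (bad s w)) (E s y₀) (E w y₀))
           (cong₂ (λ u v → u * (v * # (bad s w))) (sym (#-∧ (P w) _)) (sym (#-∧ (P s) _))))
        (∑-*ˡ (# (S₀ w)) univ _))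
        where
        shuffle : ∀ a b c d e → a * b * c * (d * e) ≡ b * e * (a * d * c)
        shuffle = solve-∀

      n≤ : n y₀ ≤ b * Λ
      n≤ = ≤-trans (≤-reflexive n≡) (≤-trans (∑-mono univ (λ x → *-monoʳ-≤ (# (B x)) (ν≤Λ x))) (≤-reflexive (∑-*ʳ Λ univ _)))

      instance
        _ = >-nonZero Λ>0
        _ = >-nonZero b>0
        _ = >-nonZero h>0

      n≥ : b * Λ ≤ h₂ * n y₀
      n≥ = *-cancelʳ-≤ _ _ Λ (≤-trans (≤-reflexive (*-assoc b Λ Λ))
        (≤-trans (≤-trans (m≤n+m _ (b * (q * β y₀))) (pivotal)) (≤-reflexive (*-swapʳ h₂ Λ (n y₀)))))

      β≤ : q * β y₀ ≤ h₂ * (Λ * Λ)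
      β≤ = *-cancelˡ-≤ b (begin
        b * (q * β y₀)                    ≤⟨ m≤m+n _ _ ⟩
        b * (q * β y₀) + b * (Λ * Λ)      ≤⟨ pivotal ⟩
        h₂ * Λ * n y₀                  ≤⟨ *-monoʳ-≤ (h₂ * Λ) n≤ ⟩
        h₂ * Λ * (b * Λ)               ≡⟨ reorder h₂ Λ b ⟩
        b * (h₂ * (Λ * Λ))                ∎)
        where
        open ≤-Reasoning
        reorder : ∀ h Λ b → h * Λ * (b * Λ) ≡ b * (h * (Λ * Λ))
        reorder = solve-∀

      rem-point : ∀ w → # (rem w) * Λ ≤ h₁₆ * (# (S₀ w) * d w)
      rem-point w with S₀ w | h₁₆ * d w ≤? Λ
      ... | false | _     = z≤n
      ... | true  | yes _ = z≤n
      ... | true  | no ¬p = ≤-trans (≤-reflexive (*-identityˡ Λ)) (≤-trans (<⇒≤ (≰⇒> ¬p)) (≤-reflexive (cong (h₁₆ *_) (sym (*-identityˡ (d w))))))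

      instance
        h₂≢0 : NonZero h₂
        h₂≢0 = >-nonZero (<-≤-trans h>0 (≤-trans (m≤m+n h h) (≤-reflexive (sym h₂≡))))
        h₄≢0 : NonZero h₄
        h₄≢0 = >-nonZero (<-≤-trans (>-nonZero⁻¹ h₂) (≤-trans (m≤m+n h₂ h₂) (≤-reflexive (sym h₄≡))))
        h₈≢0 : NonZero h₈
        h₈≢0 = >-nonZero (<-≤-trans (>-nonZero⁻¹ h₄) (≤-trans (m≤m+n h₄ h₄) (≤-reflexive (sym h₈≡))))
        h₁₆≢0 : NonZero h₁₆
        h₁₆≢0 = >-nonZero (<-≤-trans (>-nonZero⁻¹ h₈) (≤-trans (m≤m+n h₈ h₈) (≤-reflexive (sym h₁₆≡))))

      rem≤ : h₈ * ∣ rem ∣ ≤ Λ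
      rem≤ = *-cancelˡ-≤ (h₁₆ * h₂) {{m*n≢0 h₁₆ h₂}} (*-cancelʳ-≤ _ _ Λ (begin
        h₁₆ * h₂ * (h₈ * ∣ rem ∣) * Λ         ≡⟨ reorder h₁₆ h₂ h₈ ∣ rem ∣ Λ ⟩
        q * (∣ rem ∣ * Λ)                     ≡⟨ cong (q *_) (sym (∑-*ʳ Λ univ _)) ⟩
        q * S (λ w → # (rem w) * Λ)           ≤⟨ *-monoʳ-≤ q (∑-mono univ rem-point) ⟩
        q * S (λ w → h₁₆ * (# (S₀ w) * d w))  ≡⟨ cong (q *_) (trans (∑-*ˡ h₁₆ univ _) (cong (h₁₆ *_) (sym β≡))) ⟩
        q * (h₁₆ * β y₀)                      ≡⟨ *-swap q h₁₆ (β y₀) ⟩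
        h₁₆ * (q * β y₀)                      ≤⟨ *-monoʳ-≤ h₁₆ β≤ ⟩
        h₁₆ * (h₂ * (Λ * Λ))                  ≡⟨ reorder″ h₁₆ h₂ Λ ⟩
        h₁₆ * h₂ * Λ * Λ                      ∎))
        where
        open ≤-Reasoning
        reorder : ∀ a c e r Λ → a * c * (e * r) * Λ ≡ a * (c * e) * (r * Λ)
        reorder = solve-∀
        reorder″ : ∀ a c Λ → a * (c * (Λ * Λ)) ≡ a * c * Λ * Λ
        reorder″ = solve-∀

      B′-point : ∀ x → # (B x) * (h₄ * ν x) ≤ # (B′ x) * (h₄ * Λ) + # (B x) * Λ
      B′-point x with B x | Λ ≤? h₄ * ν x
      ... | false | _     = z≤n
      ... | true  | yes _ = ≤-trans (*-monoʳ-≤ 1 (*-monoʳ-≤ h₄ (ν≤Λ x))) (m≤m+n _ _)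
      ... | true  | no ¬p = *-monoʳ-≤ 1 (<⇒≤ (≰⇒> ¬p))

      -- Elements outside B′ contribute at most b Λ / h₄ to n y₀, which is half of its lower bound b
      -- Λ / h₂. The other half comes from B′, with at most Λ from each element.
      B′-large : b ≤ h₄ * ∣ B′ ∣
      B′-large = *-cancelʳ-≤ _ _ Λ (+-cancelʳ-≤ (b * Λ) _ _ (begin
        b * Λ + b * Λ                      ≤⟨ +-mono-≤ n≥ n≥ ⟩
        h₂ * n y₀ + h₂ * n y₀              ≡⟨ sym (*-distribʳ-+ (n y₀) h₂ h₂) ⟩
        (h₂ + h₂) * n y₀                   ≡⟨ cong₂ _*_ (sym h₄≡) n≡ ⟩
        h₄ * S (λ x → # (B x) * ν x)       ≡⟨ sym (∑-*ˡ h₄ univ _) ⟩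
        S (λ x → h₄ * (# (B x) * ν x))     ≡⟨ ∑-cong univ (λ x → *-swap h₄ (# (B x)) (ν x)) ⟩
        S (λ x → # (B x) * (h₄ * ν x))     ≤⟨ ∑-mono univ B′-point ⟩
        S (λ x → # (B′ x) * (h₄ * Λ) + # (B x) * Λ) ≡⟨ trans (∑-+ univ _ _) (cong₂ _+_ (∑-*ʳ (h₄ * Λ) univ _) (∑-*ʳ Λ univ _)) ⟩
        ∣ B′ ∣ * (h₄ * Λ) + b * Λ          ≡⟨ cong (_+ b * Λ) (reorder″ ∣ B′ ∣ h₄ Λ) ⟩
        h₄ * ∣ B′ ∣ * Λ + b * Λ            ∎))
        where
        open ≤-Reasoning
        reorder″ : ∀ c h Λ → c * (h * Λ) ≡ h * c * Λ
        reorder″ = solve-∀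

      S₀-split : ∀ w → # (S₀ w) ≡ # (S₁ w) + # (rem w)
      S₀-split w with S₀ w | h₁₆ * d w ≤? Λ
      ... | false | _     = refl
      ... | true  | yes _ = refl
      ... | true  | no _  = refl

      ν≤ν₁ : ∀ x → ν x ≤ ν₁ x + ∣ rem ∣
      ν≤ν₁ x = begin
        S (λ s → # (S₀ s) * # (S₀ (x ⊕ s)))
          ≤⟨ ∑-mono univ (λ s → ≤-trans (≤-reflexive (trans (cong (# (S₀ s) *_) (S₀-split (x ⊕ s))) (*-distribˡ-+ (# (S₀ s)) _ _)))
               (+-monoʳ-≤ (# (S₀ s) * # (S₁ (x ⊕ s))) (≤-trans (*-monoˡ-≤ (# (rem (x ⊕ s))) (#≤1 (S₀ s))) (≤-reflexive (*-identityˡ _))))) ⟩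
        S (λ s → # (S₀ s) * # (S₁ (x ⊕ s)) + # (rem (x ⊕ s)))
          ≡⟨ ∑-+ univ _ _ ⟩
        ν₁ x + S (λ s → # (rem (x ⊕ s)))
          ≡⟨ cong (ν₁ x +_) (S-shiftˡ x (λ w → # (rem w))) ⟩
        ν₁ x + ∣ rem ∣ ∎
        where open ≤-Reasoning

      ν₁≥ : ∀ x → B′ x ≡ true → Λ ≤ h₈ * ν₁ x
      ν₁≥ x e = +-cancelʳ-≤ Λ _ _ (begin
        Λ + Λ                        ≤⟨ +-mono-≤ Λ≤ Λ≤ ⟩
        h₄ * ν x + h₄ * ν x          ≡⟨ sym (*-distribʳ-+ (ν x) h₄ h₄) ⟩
        (h₄ + h₄) * ν x              ≡⟨ cong (_* ν x) (sym h₈≡) ⟩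
        h₈ * ν x                     ≤⟨ *-monoʳ-≤ h₈ (ν≤ν₁ x) ⟩
        h₈ * (ν₁ x + ∣ rem ∣)        ≡⟨ *-distribˡ-+ h₈ (ν₁ x) ∣ rem ∣ ⟩
        h₈ * ν₁ x + h₈ * ∣ rem ∣     ≤⟨ +-monoʳ-≤ (h₈ * ν₁ x) rem≤ ⟩
        h₈ * ν₁ x + Λ                ∎)
        where
        open ≤-Reasoning
        Λ≤ : Λ ≤ h₄ * ν x
        Λ≤ = ⌊⌋-true {d = Λ ≤? h₄ * ν x} (proj₂ (∧-true {B x} e))

      ν₂ : G → G → ℕ
      ν₂ x w = S λ s → # (S₀ s) * # (S₁ (x ⊕ s)) * # (not (bad s w))

      ν₂≥ : ∀ x w → B′ x ≡ true → S₁ w ≡ true → Λ ≤ h₁₆ * ν₂ x w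
      ν₂≥ x w x∈ w∈ = +-cancelʳ-≤ Λ _ _ (begin
        Λ + Λ                              ≤⟨ +-mono-≤ (ν₁≥ x x∈) (ν₁≥ x x∈) ⟩
        h₈ * ν₁ x + h₈ * ν₁ x              ≡⟨ trans (sym (*-distribʳ-+ (ν₁ x) h₈ h₈)) (cong (_* ν₁ x) (sym h₁₆≡)) ⟩
        h₁₆ * ν₁ x                         ≤⟨ *-monoʳ-≤ h₁₆ ν₁≤ ⟩
        h₁₆ * (ν₂ x w + d w)            ≡⟨ *-distribˡ-+ h₁₆ (ν₂ x w) (d w) ⟩
        h₁₆ * ν₂ x w + h₁₆ * d w     ≤⟨ +-monoʳ-≤ (h₁₆ * ν₂ x w) (⌊⌋-true {d = h₁₆ * d w ≤? Λ} (proj₂ (∧-true {S₀ w} w∈))) ⟩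
        h₁₆ * ν₂ x w + Λ                ∎)
        where
        open ≤-Reasoning
        point : ∀ s → # (S₀ s) * # (S₁ (x ⊕ s)) ≤ # (S₀ s) * # (S₁ (x ⊕ s)) * # (not (bad s w)) + # (S₀ s) * # (bad s w)
        point s with S₀ s | S₁ (x ⊕ s) | bad s w
        ... | false | _     | _     = z≤n
        ... | true  | false | _     = z≤n
        ... | true  | true  | true  = s≤s z≤n
        ... | true  | true  | false = s≤s z≤n
        ν₁≤ : ν₁ x ≤ ν₂ x w + d w
        ν₁≤ = ≤-trans (∑-mono univ point) (≤-reflexive (∑-+ univ _ _))

      open Reps B′ using (r; supp)

      -- The sumset of S₁ and the l-fold sums of B′. Carrying S₁ along makes the growth bound an
      -- induction on l: a summand x of B′ is absorbed by those s for which x ⊕ s is again in S₁.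
      D : ℕ → G → Bool
      D l c = ⌊ 0 <? S (λ w → # (S₁ w) * # (supp l (c ∸G w))) ⌋

      supp-true : ∀ {l v} → supp l v ≡ true → 0 < r l v
      supp-true {l} {v} e = <ᵇ⇒< 0 (r l v) (subst Bool.T (sym e) _)

      true-supp : ∀ {l v} → 0 < r l v → supp l v ≡ true
      true-supp {l} {v} lt with r l v
      ... | suc _ = refl

      D-elim : ∀ l c → D l c ≡ true → ∃ λ w → S₁ w ≡ true × supp l (c ∸G w) ≡ true
      D-elim l c e with ∑->0⇒∃ univ (⌊⌋-true {d = 0 <? S (λ w → # (S₁ w) * # (supp l (c ∸G w)))} e)
      ... | w , _ , lt = w , #>0 (proj₁ (0<*⇒ (# (S₁ w)) _ lt)) , #>0 (proj₂ (0<*⇒ (# (S₁ w)) _ lt))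

      D-intro : ∀ l v w → S₁ w ≡ true → supp l v ≡ true → D l (v ⊕ w) ≡ true
      D-intro l v w w∈ v∈ with 0 <? S (λ u → # (S₁ u) * # (supp l ((v ⊕ w) ∸G u)))
      ... | yes _ = refl
      ... | no ¬p = contradiction (<-≤-trans (s≤s z≤n) (≤-trans (≤-reflexive (sym term≡1)) (∑-term (λ u → # (S₁ u) * # (supp l ((v ⊕ w) ∸G u))) (univ-all w)))) ¬p
        where
        term≡1 : # (S₁ w) * # (supp l ((v ⊕ w) ∸G w)) ≡ 1
        term≡1 rewrite ⊕- v w | w∈ | v∈ = refl

      D0≤Λ : ∣ D 0 ∣ ≤ Λ
      D0≤Λ = ≤-trans (∑-mono univ point) S₀≤Λ
        where
        at-𝟘 : ∀ c w → S₁ w ≡ true → Dec (c ∸G w ≡ 𝟘) → supp 0 (c ∸G w) ≡ true → S₀ c ≡ true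
        at-𝟘 c w w∈ (yes eq) _ = trans (cong S₀ (trans (sym (-⊕ c w)) (trans (cong (_⊕ w) eq) (⊕-idˡ w)))) (proj₁ (∧-true w∈))
        at-𝟘 c w w∈ (no ≢)   e = contradiction (subst (0 <_) (δ-≢ ≢) (supp-true {0} e)) (n≮n 0)
        from : ∀ c → (∃ λ w → S₁ w ≡ true × supp 0 (c ∸G w) ≡ true) → 1 ≤ # (S₀ c)
        from c (w , w∈ , e) = ≤-reflexive (cong # (sym (at-𝟘 c w w∈ ((c ∸G w) ≟G 𝟘) e)))
        point : ∀ c → # (D 0 c) ≤ # (S₀ c)
        point c = ≤-trans (≤-reflexive (sym (*-identityʳ _))) (when (D 0 c) (λ e → from c (D-elim 0 c e)))

      N : ℕ → G → ℕ
      N l c = S λ u → S λ t → # (D l u) * (# (V t) * # (V ((c ⊕ t) ∸G u)))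

      N-total : ∀ l → S (N l) ≤ ∣ D l ∣ * (Λ * Λ)
      N-total l = begin
        S (λ c → S λ u → S λ t → # (D l u) * (# (V t) * # (V ((c ⊕ t) ∸G u))))
          ≡⟨ trans (∑-swap univ univ _) (∑-cong univ (λ u → ∑-swap univ univ _)) ⟩
        S (λ u → S λ t → S λ c → # (D l u) * (# (V t) * # (V ((c ⊕ t) ∸G u))))
          ≡⟨ ∑-cong univ (λ u → ∑-cong univ (λ t → trans (∑-*ˡ (# (D l u)) univ _) (cong (# (D l u) *_) (trans (∑-*ˡ (# (V t)) univ _)
               (cong (# (V t) *_) (trans (S-shift t (λ c → # (V (c ∸G u)))) (S-sub u (λ c → # (V c))))))))) ⟩
        S (λ u → S λ t → # (D l u) * (# (V t) * ∣ V ∣))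
          ≡⟨ ∑-cong univ (λ u → trans (∑-*ˡ (# (D l u)) univ _) (cong (# (D l u) *_) (∑-*ʳ ∣ V ∣ univ _))) ⟩
        S (λ u → # (D l u) * (∣ V ∣ * ∣ V ∣))
          ≡⟨ ∑-*ʳ (∣ V ∣ * ∣ V ∣) univ _ ⟩
        ∣ D l ∣ * (∣ V ∣ * ∣ V ∣)
          ≤⟨ *-monoʳ-≤ ∣ D l ∣ (*-mono-≤ V≤Λ V≤Λ) ⟩
        ∣ D l ∣ * (Λ * Λ) ∎
        where open ≤-Reasoning

      -- For c = (v ⊕ x) ⊕ w, each s with s and x ⊕ s on both sides and each common neighbour y of s and w
      -- gives c = (v ⊕ (x ⊕ s)) + (w ⊕ y) − (s ⊕ y).
      N-large : ∀ l v x w → supp l v ≡ true → B′ x ≡ true → S₁ w ≡ true →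
                Λ * Λ ≤ h₁₆ * q * N l ((v ⊕ x) ⊕ w)
      N-large l v x w v∈ x∈ w∈ = begin
        Λ * Λ
          ≤⟨ *-monoˡ-≤ Λ (ν₂≥ x w x∈ w∈) ⟩
        h₁₆ * ν₂ x w * Λ
          ≡⟨ trans (*-assoc h₁₆ _ Λ) (cong (h₁₆ *_) (sym (∑-*ʳ Λ univ _))) ⟩
        h₁₆ * S (λ s → # (S₀ s) * # (S₁ (x ⊕ s)) * # (not (bad s w)) * Λ)
          ≤⟨ *-monoʳ-≤ h₁₆ (∑-mono univ point) ⟩
        h₁₆ * S (λ s → q * (# (D l ((v ⊕ x) ⊕ s)) * codeg s w))
          ≡⟨ trans (cong (h₁₆ *_) (∑-*ˡ q univ _)) (sym (*-assoc h₁₆ q _)) ⟩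
        h₁₆ * q * S (λ s → # (D l ((v ⊕ x) ⊕ s)) * codeg s w)
          ≤⟨ *-monoʳ-≤ (h₁₆ * q) (∑-mono univ λ s → *-monoʳ-≤ (# (D l ((v ⊕ x) ⊕ s))) (∑-mono univ (λ y →
               ≤-trans (*-monoˡ-≤ (E s y * E w y) (#≤1 (P y))) (≤-reflexive (*-identityˡ _))))) ⟩
        h₁₆ * q * S (λ s → # (D l ((v ⊕ x) ⊕ s)) * S (λ y → # (V (s ⊕ y)) * # (V (w ⊕ y))))
          ≡⟨ cong (h₁₆ * q *_) (sym N≡) ⟩
        h₁₆ * q * N l ((v ⊕ x) ⊕ w) ∎
        where
        open ≤-Reasoning
        point′ : ∀ a c {P : Set} (e : Dec P) {u v} → (c ≡ true → # u ≡ 1) → (¬ P → Λ ≤ q * v) →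
                 # a * # c * # (not ⌊ e ⌋) * Λ ≤ q * (# u * v)
        point′ false _     _       _ _ = z≤n
        point′ true  false _       _ _ = z≤n
        point′ true  true  (yes _) _ _ = z≤n
        point′ true  true  (no ¬p) {v = v} f g = ≤-trans (≤-reflexive (*-identityˡ Λ))
          (≤-trans (g ¬p) (≤-reflexive (cong (q *_) (sym (trans (cong (_* v) (f refl)) (*-identityˡ v))))))
        point : ∀ s → # (S₀ s) * # (S₁ (x ⊕ s)) * # (not (bad s w)) * Λ ≤ q * (# (D l ((v ⊕ x) ⊕ s)) * codeg s w)
        point s = point′ (S₀ s) (S₁ (x ⊕ s)) (q * codeg s w <? Λ)
          (λ e → cong # (trans (cong (D l) (⊕-assoc v x s)) (D-intro l v (x ⊕ s) e v∈))) ≮⇒≥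
        regroup : ∀ s y → ((((v ⊕ x) ⊕ w) ⊕ (s ⊕ y)) ∸G ((v ⊕ x) ⊕ s)) ≡ w ⊕ y
        regroup s y = ⊕-cancelʳ ((v ⊕ x) ⊕ s) (trans (-⊕ _ _)
          (trans (⊕-assoc (v ⊕ x) w (s ⊕ y))
          (trans (cong ((v ⊕ x) ⊕_) (trans (cong (w ⊕_) (⊕-comm s y)) (trans (sym (⊕-assoc w y s)) (⊕-comm (w ⊕ y) s))))
          (trans (sym (⊕-assoc (v ⊕ x) s (w ⊕ y))) (⊕-comm ((v ⊕ x) ⊕ s) (w ⊕ y))))))
        N≡ : N l ((v ⊕ x) ⊕ w) ≡ S (λ s → # (D l ((v ⊕ x) ⊕ s)) * S (λ y → # (V (s ⊕ y)) * # (V (w ⊕ y))))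
        c : G
        c = (v ⊕ x) ⊕ w
        N≡ = trans (sym (S-shiftˡ (v ⊕ x) (λ u → S λ t → # (D l u) * (# (V t) * # (V ((c ⊕ t) ∸G u))))))
          (∑-cong univ λ s → trans (sym (S-shiftˡ s (λ t → # (D l ((v ⊕ x) ⊕ s)) * (# (V t) * # (V ((c ⊕ t) ∸G ((v ⊕ x) ⊕ s)))))))
             (trans (∑-*ˡ (# (D l ((v ⊕ x) ⊕ s))) univ (λ y → # (V (s ⊕ y)) * # (V ((c ⊕ (s ⊕ y)) ∸G ((v ⊕ x) ⊕ s)))))
               (cong (# (D l ((v ⊕ x) ⊕ s)) *_)
                 (∑-cong univ λ y → cong (λ z → # (V (s ⊕ y)) * # (V z)) (regroup s y)))))

      -- Double counting: each c in D (suc l) is counted at least Λ ^ 2 / (h₁₆ q) times by N l,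
      -- whose total over all c is at most ∣ D l ∣ Λ ^ 2.
      D-step : ∀ l → ∣ D (suc l) ∣ ≤ h₁₆ * q * ∣ D l ∣
      D-step l = *-cancelʳ-≤ _ _ (Λ * Λ) {{m*n≢0 Λ Λ}} (begin
        ∣ D (suc l) ∣ * (Λ * Λ)                  ≡⟨ sym (∑-*ʳ (Λ * Λ) univ (λ c → # (D (suc l) c))) ⟩
        S (λ c → # (D (suc l) c) * (Λ * Λ))      ≤⟨ ∑-mono univ point ⟩
        S (λ c → h₁₆ * q * N l c)             ≡⟨ ∑-*ˡ (h₁₆ * q) univ (N l) ⟩
        h₁₆ * q * S (N l)                     ≤⟨ *-monoʳ-≤ (h₁₆ * q) (N-total l) ⟩
        h₁₆ * q * (∣ D l ∣ * (Λ * Λ))         ≡⟨ sym (*-assoc (h₁₆ * q) ∣ D l ∣ (Λ * Λ)) ⟩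
        h₁₆ * q * ∣ D l ∣ * (Λ * Λ)           ∎)
        where
        open ≤-Reasoning
        point : ∀ c → # (D (suc l) c) * (Λ * Λ) ≤ h₁₆ * q * N l c
        point c = when (D (suc l) c) (λ e → from (D-elim (suc l) c e))
          where
          at : ∀ w → S₁ w ≡ true → (∃ λ x → x ∈ univ × 0 < # (B′ x) * r l ((c ∸G w) ∸G x)) → Λ * Λ ≤ h₁₆ * q * N l c
          at w w∈ (x , _ , lt) = subst (λ z → Λ * Λ ≤ h₁₆ * q * N l z) c≡ (N-large l v x w v∈ x∈ w∈)
            where
            v : G
            v = (c ∸G w) ∸G x
            both : 0 < # (B′ x) × 0 < r l v
            both = 0<*⇒ (# (B′ x)) (r l v) lt
            x∈ : B′ x ≡ true
            x∈ = #>0 (proj₁ both)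
            v∈ : supp l v ≡ true
            v∈ = true-supp {l} {v} (proj₂ both)
            c≡ : (v ⊕ x) ⊕ w ≡ c
            c≡ = trans (cong (_⊕ w) (-⊕ (c ∸G w) x)) (-⊕ c w)
          from : (∃ λ w → S₁ w ≡ true × supp (suc l) (c ∸G w) ≡ true) → Λ * Λ ≤ h₁₆ * q * N l c
          from (w , w∈ , v∈) = at w w∈ (∑->0⇒∃ univ {λ x → # (B′ x) * r l ((c ∸G w) ∸G x)} (supp-true {suc l} {c ∸G w} v∈))

      D≤ : ∀ l → ∣ D l ∣ ≤ (h₁₆ * q) ^ l * Λ
      D≤ zero    = ≤-trans D0≤Λ (≤-reflexive (sym (*-identityˡ Λ)))
      D≤ (suc l) = ≤-trans (D-step l) (≤-trans (*-monoʳ-≤ (h₁₆ * q) (D≤ l)) (≤-reflexive (sym (*-assoc (h₁₆ * q) _ Λ))))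

      B′>0 : 0 < ∣ B′ ∣
      B′>0 = proj₂ (0<*⇒ h₄ _ (<-≤-trans b>0 B′-large))

      S₁-inhabited : ∃ λ w → S₁ w ≡ true
      S₁-inhabited = from-x (∑->0⇒∃ univ {λ x → # (B′ x)} B′>0)
        where
        from-s : ∀ x → (∃ λ s → s ∈ univ × 0 < # (S₀ s) * # (S₁ (x ⊕ s))) → ∃ λ w → S₁ w ≡ true
        from-s x (s , _ , lt) = x ⊕ s , #>0 (proj₂ (0<*⇒ (# (S₀ s)) (# (S₁ (x ⊕ s))) lt))
        from-x : (∃ λ x → x ∈ univ × 0 < # (B′ x)) → ∃ λ w → S₁ w ≡ true
        from-x (x , _ , x∈) = from-s x (∑->0⇒∃ univ {λ s → # (S₀ s) * # (S₁ (x ⊕ s))}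
          (proj₂ (0<*⇒ h₈ (ν₁ x) (<-≤-trans Λ>0 (ν₁≥ x (#>0 x∈))))))

      supp≤ : ∀ l → ∣ supp l ∣ ≤ (h₁₆ * q) ^ l * Λ
      supp≤ l = from S₁-inhabited
        where
        from : (∃ λ w → S₁ w ≡ true) → ∣ supp l ∣ ≤ (h₁₆ * q) ^ l * Λ
        from (w , w∈) = ≤-trans (∑-mono univ {λ v → # (supp l v)} {λ v → # (D l (v ⊕ w))} point)
          (≤-trans (≤-reflexive (S-shift w (λ c → # (D l c)))) (D≤ l))
          where
          point : ∀ v → # (supp l v) ≤ # (D l (v ⊕ w))
          point v = ≤-trans (≤-reflexive (sym (*-identityʳ (# (supp l v)))))
            (when (supp l v) (λ e → ≤-reflexive (sym (cong # (D-intro l v w w∈ e)))))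

-- Almost stationary representation counts

#-∨ : ∀ x y → # (x ∨ y) ≤ # x + # y
#-∨ true  y = m≤m+n 1 (# y)
#-∨ false y = ≤-refl

union-bound : ∀ a b c d e → 1 ≤ # a * (# b * (# c * (# d * # e))) +
                               (# (not a) + (# (not b) + (# (not c) + (# (not d) + # (not e)))))
union-bound false _     _     _     _     = s≤s z≤n
union-bound true  false _     _     _     = s≤s z≤n
union-bound true  true  false _     _     = s≤s z≤n
union-bound true  true  true  false _     = s≤s z≤n
union-bound true  true  true  true  false = s≤s z≤n
union-bound true  true  true  true  true  = s≤s z≤n

module Levels (𝔾 : FinGroup) where
  open GroupSums 𝔾
  open Counts 𝔾
  open BSG 𝔾

  -- Five marginals are discarded, each at a cost of at most M / c, and half of M has to survive;
  -- hence c is 10. It stays a variable so that the numeral is not unfolded.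
  module Stationary (B : G → Bool) (k c : ℕ) (c≡10 : c ≡ 10) (b>0 : 0 < ∣ B ∣) where
    open Reps B

    k₁ k₂ : ℕ
    k₁ = suc k
    k₂ = suc (k + k)

    M Q : ℕ
    M = m (k₂ + k₂)
    Q = b ^ (k₂ + k₂)

    -- The popular j-fold sums: their density r j z / b ^ j is at least a c-th part of the maximal
    -- density M / Q.
    lev : ℕ → G → Bool
    lev j z = ⌊ M * b ^ j ≤? c * Q * r j z ⌋

    -- In `Triples` one set has to contain s, y and x ⊕ s, of which s and y arise as sums of k
    -- elements and x ⊕ s as a sum of k₁. The same happens for V with k + k and k₂; hence the
    -- unions.
    P V : G → Bool
    P z = lev k z ∨ lev k₁ z
    V z = lev (k + k) z ∨ lev k₂ z

    instance
      b≢0 : NonZero b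
      b≢0 = >-nonZero b>0

    lev-size : ∀ j → ∣ lev j ∣ * M ≤ c * Q
    lev-size j = *-cancelʳ-≤ _ _ (b ^ j) {{m^n≢0 b j}} (begin
      ∣ lev j ∣ * M * b ^ j                ≡⟨ *-assoc ∣ lev j ∣ M _ ⟩
      ∣ lev j ∣ * (M * b ^ j)              ≡⟨ sym (∑-*ʳ (M * b ^ j) univ _) ⟩
      S (λ z → # (lev j z) * (M * b ^ j))  ≤⟨ ∑-mono univ (λ z → when (lev j z) (λ e → ⌊⌋-true {d = M * b ^ j ≤? c * Q * r j z} e)) ⟩
      S (λ z → c * Q * r j z)              ≡⟨ trans (∑-*ˡ (c * Q) univ _) (cong (c * Q *_) (r-total j)) ⟩
      c * Q * b ^ j                        ∎)
      where open ≤-Reasoning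

    ∪-size : ∀ i j → ∣ (λ z → lev i z ∨ lev j z) ∣ * M ≤ c * Q + c * Q
    ∪-size i j = begin
      ∣ (λ z → lev i z ∨ lev j z) ∣ * M  ≤⟨ *-monoˡ-≤ M (≤-trans (∑-mono univ (λ z → #-∨ (lev i z) (lev j z))) (≤-reflexive (∑-+ univ _ _))) ⟩
      (∣ lev i ∣ + ∣ lev j ∣) * M        ≡⟨ *-distribʳ-+ M ∣ lev i ∣ ∣ lev j ∣ ⟩
      ∣ lev i ∣ * M + ∣ lev j ∣ * M      ≤⟨ +-mono-≤ (lev-size i) (lev-size j) ⟩
      c * Q + c * Q                      ∎
      where open ≤-Reasoning

    Λ : ℕ
    Λ = ∣ P ∣ + ∣ V ∣

    Λ-size : Λ * M ≤ (c * Q + c * Q) + (c * Q + c * Q)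
    Λ-size = ≤-trans (≤-reflexive (*-distribʳ-+ M ∣ P ∣ ∣ V ∣)) (+-mono-≤ (∪-size k k₁) (∪-size (k + k) k₂))

    low : ℕ → G → ℕ
    low j z = r j z * # (not (lev j z))

    low≤ : ∀ j z → c * Q * low j z ≤ M * b ^ j
    low≤ j z with M * b ^ j ≤? c * Q * r j z
    ... | yes _ = ≤-trans (≤-reflexive (trans (cong (c * Q *_) (*-zeroʳ (r j z))) (*-zeroʳ (c * Q)))) z≤n
    ... | no ¬p = ≤-trans (≤-reflexive (cong (c * Q *_) (*-identityʳ (r j z)))) (<⇒≤ (≰⇒> ¬p))

    bᵏ : ℕ
    bᵏ = b ^ k

    r₂ : G → ℕ
    r₂ = r k₂

    r₂-total : S r₂ ≡ b * (bᵏ * bᵏ)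
    r₂-total = trans (r-total k₂) (cong (b *_) (^-distribˡ-+-* b k k))

    Q≡ : Q ≡ b * (bᵏ * bᵏ) * (b * (bᵏ * bᵏ))
    Q≡ = trans (^-distribˡ-+-* b k₂ k₂) (cong (λ t → b * t * (b * t)) (^-distribˡ-+-* b k k))

    reduce : ∀ (Φ : G → G → ℕ) →
      S (λ x → S λ s → S λ y → # (B x) * r k s * (r k y * Φ (x ⊕ s) y)) ≡ S (λ w → r k₁ w * S (λ y → r k y * Φ w y))
    reduce Φ = trans (∑-cong univ λ x → ∑-cong univ λ s → ∑-*ˡ (# (B x) * r k s) univ _)
                     (S-conv (λ x → # (B x)) (r k) (λ w → S λ y → r k y * Φ w y))

    conv-2k+1 : ∀ z → conv (r k₁) (r k) z ≡ r₂ z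
    conv-2k+1 = r-conv k₁ k

    -- Counts pairs of representations of x ⊕ s ⊕ y by k₂ elements, the first of them cut into
    -- pieces x, s, y of 1, k and k elements. The total weight is therefore the sum of the squares
    -- of r₂.
    ω : G → G → G → ℕ
    ω x s y = # (B x) * r k s * (r k y * r₂ ((x ⊕ s) ⊕ y))

    Ω : (G → G → G → ℕ) → ℕ
    Ω φ = S λ x → S λ s → S λ y → ω x s y * φ x s y

    -- Triples with a low marginal contribute little, because M * b ^ j * S F comes out as M * Q for each of the five marginals.
    marginal : ∀ j φ (F : G → ℕ) {t} → Ω φ ≡ S (λ z → low j z * F z) → S F ≡ t → M * b ^ j * t ≡ M * (b * (bᵏ * bᵏ) * (b * (bᵏ * bᵏ))) →
               c * Q * Ω φ ≤ M * Q
    marginal j φ F {t} eq total shape = begin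
      c * Q * Ω φ                           ≡⟨ cong (c * Q *_) eq ⟩
      c * Q * S (λ z → low j z * F z)       ≡⟨ sym (∑-*ˡ (c * Q) univ _) ⟩
      S (λ z → c * Q * (low j z * F z))     ≡⟨ ∑-cong univ (λ z → sym (*-assoc (c * Q) _ _)) ⟩
      S (λ z → c * Q * low j z * F z)       ≤⟨ ∑-mono univ (λ z → *-monoˡ-≤ (F z) (low≤ j z)) ⟩
      S (λ z → M * b ^ j * F z)             ≡⟨ trans (∑-*ˡ (M * b ^ j) univ _) (cong (M * b ^ j *_) total) ⟩
      M * b ^ j * t                         ≡⟨ trans shape (cong (M *_) (sym Q≡)) ⟩
      M * Q                                 ∎
      where open ≤-Reasoning

    shift-r₂ : ∀ w → S (λ y → r₂ (w ⊕ y)) ≡ b * (bᵏ * bᵏ)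
    shift-r₂ w = trans (S-shiftˡ w r₂) r₂-total

    e-s : c * Q * Ω (λ x s y → # (not (lev k s))) ≤ M * Q
    e-s = marginal k _ F eq total (shape M bᵏ b)
      where
      open ≡-Reasoning
      F : G → ℕ
      F s = S λ x → # (B x) * S λ y → r k y * r₂ ((x ⊕ s) ⊕ y)
      reorder : ∀ a u v w → a * u * v * w ≡ u * w * (a * v)
      reorder = solve-∀
      eq : Ω (λ x s y → # (not (lev k s))) ≡ S (λ s → low k s * F s)
      eq = trans (∑-swap univ univ _) (∑-cong univ λ s → trans
             (∑-cong univ λ x → trans (∑-cong univ λ y → reorder (# (B x)) (r k s) _ _)
               (trans (∑-*ˡ (low k s) univ _) (cong (low k s *_) (∑-*ˡ (# (B x)) univ _))))
             (∑-*ˡ (low k s) univ _))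
      total : S F ≡ b * (bᵏ * (b * (bᵏ * bᵏ)))
      total = begin
        S (λ s → S λ x → # (B x) * S λ y → r k y * r₂ ((x ⊕ s) ⊕ y))
          ≡⟨ ∑-swap univ univ _ ⟩
        S (λ x → S λ s → # (B x) * S λ y → r k y * r₂ ((x ⊕ s) ⊕ y))
          ≡⟨ ∑-cong univ (λ x → trans (∑-*ˡ (# (B x)) univ _) (cong (# (B x) *_) (trans (∑-swap univ univ _)
               (∑-cong univ λ y → trans (∑-*ˡ (r k y) univ _) (cong (r k y *_) (trans (S-shiftˡ x (λ w → r₂ (w ⊕ y))) (trans (S-shift y r₂) r₂-total))))))) ⟩
        S (λ x → # (B x) * S λ y → r k y * (b * (bᵏ * bᵏ)))
          ≡⟨ trans (∑-*ʳ _ univ (λ x → # (B x))) (cong (b *_) (trans (∑-*ʳ _ univ (r k)) (cong (_* (b * (bᵏ * bᵏ))) (r-total k)))) ⟩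
        b * (bᵏ * (b * (bᵏ * bᵏ))) ∎
      shape : ∀ M u b → M * u * (b * (u * (b * (u * u)))) ≡ M * (b * (u * u) * (b * (u * u)))
      shape = solve-∀

    e-y : c * Q * Ω (λ x s y → # (not (lev k y))) ≤ M * Q
    e-y = marginal k _ F eq total (shape M bᵏ b)
      where
      open ≡-Reasoning
      F : G → ℕ
      F y = S λ w → r k₁ w * r₂ (w ⊕ y)
      reorder : ∀ a u v w → a * (u * v) * w ≡ a * (u * w * v)
      reorder = solve-∀
      eq : Ω (λ x s y → # (not (lev k y))) ≡ S (λ y → low k y * F y)
      eq = begin
        Ω (λ x s y → # (not (lev k y)))
          ≡⟨ (∑-cong univ λ x → ∑-cong univ λ s → ∑-cong univ λ y → trans (reorder (# (B x) * r k s) (r k y) _ _)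
               (cong (# (B x) * r k s *_) (*-assoc (r k y) _ _))) ⟩
        S (λ x → S λ s → S λ y → # (B x) * r k s * (r k y * (# (not (lev k y)) * r₂ ((x ⊕ s) ⊕ y))))
          ≡⟨ reduce (λ w y → # (not (lev k y)) * r₂ (w ⊕ y)) ⟩
        S (λ w → r k₁ w * S (λ y → r k y * (# (not (lev k y)) * r₂ (w ⊕ y))))
          ≡⟨ ∑-cong univ (λ w → trans (sym (∑-*ˡ (r k₁ w) univ _)) (∑-cong univ (λ y → trans (cong (r k₁ w *_) (sym (*-assoc (r k y) _ _))) (*-swap (r k₁ w) (low k y) _)))) ⟩
        S (λ w → S (λ y → low k y * (r k₁ w * r₂ (w ⊕ y))))
          ≡⟨ trans (∑-swap univ univ _) (∑-cong univ λ y → ∑-*ˡ (low k y) univ _) ⟩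
        S (λ y → low k y * F y) ∎
      total : S F ≡ b * bᵏ * (b * (bᵏ * bᵏ))
      total = trans (∑-swap univ univ _) (trans (∑-cong univ λ w → trans (∑-*ˡ (r k₁ w) univ _) (cong (r k₁ w *_) (shift-r₂ w)))
                (trans (∑-*ʳ _ univ (r k₁)) (cong (_* (b * (bᵏ * bᵏ))) (r-total k₁))))
      shape : ∀ M u b → M * u * (b * u * (b * (u * u))) ≡ M * (b * (u * u) * (b * (u * u)))
      shape = solve-∀

    e-xs : c * Q * Ω (λ x s y → # (not (lev k₁ (x ⊕ s)))) ≤ M * Q
    e-xs = marginal k₁ _ F eq total (shape M bᵏ b)
      where
      open ≡-Reasoning
      F : G → ℕ
      F w = S λ y → r k y * r₂ (w ⊕ y)
      reorder : ∀ a u v w → a * (u * v) * w ≡ a * (u * (w * v))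
      reorder = solve-∀
      eq : Ω (λ x s y → # (not (lev k₁ (x ⊕ s)))) ≡ S (λ w → low k₁ w * F w)
      eq = begin
        Ω (λ x s y → # (not (lev k₁ (x ⊕ s))))
          ≡⟨ (∑-cong univ λ x → ∑-cong univ λ s → ∑-cong univ λ y → reorder (# (B x) * r k s) (r k y) _ _) ⟩
        S (λ x → S λ s → S λ y → # (B x) * r k s * (r k y * (# (not (lev k₁ (x ⊕ s))) * r₂ ((x ⊕ s) ⊕ y))))
          ≡⟨ reduce (λ w y → # (not (lev k₁ w)) * r₂ (w ⊕ y)) ⟩
        S (λ w → r k₁ w * S (λ y → r k y * (# (not (lev k₁ w)) * r₂ (w ⊕ y))))
          ≡⟨ ∑-cong univ (λ w → trans (cong (r k₁ w *_) (trans (∑-cong univ λ y → *-swap (r k y) (# (not (lev k₁ w))) _) (∑-*ˡ (# (not (lev k₁ w))) univ _)))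
               (sym (*-assoc (r k₁ w) _ _))) ⟩
        S (λ w → low k₁ w * F w) ∎
      total : S F ≡ bᵏ * (b * (bᵏ * bᵏ))
      total = trans (∑-swap univ univ _) (trans (∑-cong univ λ y → trans (∑-*ˡ (r k y) univ _) (cong (r k y *_) (trans (S-shift y r₂) r₂-total)))
                (trans (∑-*ʳ _ univ (r k)) (cong (_* (b * (bᵏ * bᵏ))) (r-total k))))
      shape : ∀ M u b → M * (b * u) * (u * (b * (u * u))) ≡ M * (b * (u * u) * (b * (u * u)))
      shape = solve-∀

    e-sy : c * Q * Ω (λ x s y → # (not (lev (k + k) (s ⊕ y)))) ≤ M * Q
    e-sy = marginal (k + k) _ F eq total (trans (cong (λ t → M * t * (b * (b * (bᵏ * bᵏ)))) (^-distribˡ-+-* b k k)) (shape M bᵏ b))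
      where
      open ≡-Reasoning
      F : G → ℕ
      F v = S λ x → # (B x) * r₂ (x ⊕ v)
      reorder : ∀ a u v w t → a * u * (v * w) * t ≡ u * v * (t * (a * w))
      reorder = solve-∀
      eq : Ω (λ x s y → # (not (lev (k + k) (s ⊕ y)))) ≡ S (λ v → low (k + k) v * F v)
      eq = begin
        Ω (λ x s y → # (not (lev (k + k) (s ⊕ y))))
          ≡⟨ (∑-cong univ λ x → ∑-cong univ λ s → ∑-cong univ λ y → trans (reorder (# (B x)) (r k s) (r k y) _ _)
               (cong (λ z → r k s * r k y * (# (not (lev (k + k) (s ⊕ y))) * (# (B x) * r₂ z))) (⊕-assoc x s y))) ⟩
        S (λ x → S λ s → S λ y → r k s * r k y * (# (not (lev (k + k) (s ⊕ y))) * (# (B x) * r₂ (x ⊕ (s ⊕ y)))))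
          ≡⟨ trans (∑-swap univ univ _) (∑-cong univ λ s → ∑-swap univ univ _) ⟩
        S (λ s → S λ y → S λ x → r k s * r k y * (# (not (lev (k + k) (s ⊕ y))) * (# (B x) * r₂ (x ⊕ (s ⊕ y)))))
          ≡⟨ (∑-cong univ λ s → ∑-cong univ λ y → trans (∑-*ˡ (r k s * r k y) univ _) (cong (r k s * r k y *_) (∑-*ˡ (# (not (lev (k + k) (s ⊕ y)))) univ _))) ⟩
        S (λ s → S λ y → r k s * r k y * (# (not (lev (k + k) (s ⊕ y))) * F (s ⊕ y)))
          ≡⟨ S-conv (r k) (r k) (λ v → # (not (lev (k + k) v)) * F v) ⟩
        S (λ v → conv (r k) (r k) v * (# (not (lev (k + k) v)) * F v))
          ≡⟨ ∑-cong univ (λ v → trans (cong (_* (# (not (lev (k + k) v)) * F v)) (r-conv k k v)) (sym (*-assoc (r (k + k) v) _ _))) ⟩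
        S (λ v → low (k + k) v * F v) ∎
      total : S F ≡ b * (b * (bᵏ * bᵏ))
      total = trans (∑-swap univ univ _) (trans (∑-cong univ λ x → trans (∑-*ˡ (# (B x)) univ _) (cong (# (B x) *_) (shift-r₂ x)))
                (∑-*ʳ _ univ (λ x → # (B x))))
      shape : ∀ M u b → M * (u * u) * (b * (b * (u * u))) ≡ M * (b * (u * u) * (b * (u * u)))
      shape = solve-∀

    Ω-xsy : ∀ (f : G → ℕ) → Ω (λ x s y → f ((x ⊕ s) ⊕ y)) ≡ S (λ u → r₂ u * (r₂ u * f u))
    Ω-xsy f = begin
      Ω (λ x s y → f ((x ⊕ s) ⊕ y))
        ≡⟨ (∑-cong univ λ x → ∑-cong univ λ s → ∑-cong univ λ y → reorder (# (B x) * r k s) (r k y) _ _) ⟩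
      S (λ x → S λ s → S λ y → # (B x) * r k s * (r k y * (r₂ ((x ⊕ s) ⊕ y) * f ((x ⊕ s) ⊕ y))))
        ≡⟨ reduce (λ w y → r₂ (w ⊕ y) * f (w ⊕ y)) ⟩
      S (λ w → r k₁ w * S (λ y → r k y * (r₂ (w ⊕ y) * f (w ⊕ y))))
        ≡⟨ ∑-cong univ (λ w → trans (sym (∑-*ˡ (r k₁ w) univ _)) (∑-cong univ λ y → sym (*-assoc (r k₁ w) (r k y) _))) ⟩
      S (λ w → S λ y → r k₁ w * r k y * (r₂ (w ⊕ y) * f (w ⊕ y)))
        ≡⟨ S-conv (r k₁) (r k) (λ u → r₂ u * f u) ⟩
      S (λ u → conv (r k₁) (r k) u * (r₂ u * f u))
        ≡⟨ ∑-cong univ (λ u → cong (_* (r₂ u * f u)) (conv-2k+1 u)) ⟩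
      S (λ u → r₂ u * (r₂ u * f u)) ∎
      where
      open ≡-Reasoning
      reorder : ∀ a u v w → a * (u * v) * w ≡ a * (u * (v * w))
      reorder = solve-∀

    e-xsy : c * Q * Ω (λ x s y → # (not (lev k₂ ((x ⊕ s) ⊕ y)))) ≤ M * Q
    e-xsy = marginal k₂ _ r₂ (trans (Ω-xsy (λ u → # (not (lev k₂ u)))) (∑-cong univ (λ u → *-comm (r₂ u) _))) r₂-total
      (trans (*-assoc M _ _) (cong (M *_) (cong (λ t → b * t * (b * (bᵏ * bᵏ))) (^-distribˡ-+-* b k k))))

    Θ≥ : M ≤ Ω (λ _ _ _ → 1)
    Θ≥ = ≤-trans (sum-squares k₂) (≤-reflexive (sym (trans (Ω-xsy (λ _ → 1)) (∑-cong univ λ u → cong (r₂ u *_) (*-identityʳ (r₂ u))))))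

    good : G → G → G → ℕ
    good x s y = # (lev k s) * (# (lev k y) * (# (lev k₁ (x ⊕ s)) * (# (lev (k + k) (s ⊕ y)) * # (lev k₂ ((x ⊕ s) ⊕ y)))))

    Ω-mono : ∀ {f g} → (∀ x s y → f x s y ≤ g x s y) → Ω f ≤ Ω g
    Ω-mono h = ∑-mono univ λ x → ∑-mono univ λ s → ∑-mono univ λ y → *-monoʳ-≤ (ω x s y) (h x s y)

    Ω-+ : ∀ f g → Ω (λ x s y → f x s y + g x s y) ≡ Ω f + Ω g
    Ω-+ f g = trans (∑-cong univ λ x → trans (∑-cong univ λ s → trans (∑-cong univ λ y → *-distribˡ-+ (ω x s y) _ _) (∑-+ univ _ _)) (∑-+ univ _ _)) (∑-+ univ _ _)

    Ω-split : Ω (λ _ _ _ → 1) ≤ Ω good + (Ω (λ x s y → # (not (lev k s))) + (Ω (λ x s y → # (not (lev k y))) +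
               (Ω (λ x s y → # (not (lev k₁ (x ⊕ s)))) + (Ω (λ x s y → # (not (lev (k + k) (s ⊕ y)))) + Ω (λ x s y → # (not (lev k₂ ((x ⊕ s) ⊕ y))))))))
    Ω-split = ≤-trans (Ω-mono λ x s y → union-bound (lev k s) (lev k y) (lev k₁ (x ⊕ s)) (lev (k + k) (s ⊕ y)) (lev k₂ ((x ⊕ s) ⊕ y)))
      (≤-reflexive (trans (Ω-+ good _) (cong (Ω good +_) (trans (Ω-+ _ _) (cong (Ω (λ x s y → # (not (lev k s))) +_)
        (trans (Ω-+ _ _) (cong (Ω (λ x s y → # (not (lev k y))) +_)
          (trans (Ω-+ _ _) (cong (Ω (λ x s y → # (not (lev k₁ (x ⊕ s)))) +_) (Ω-+ _ _))))))))))

    M>0 : 0 < M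
    M>0 = m-pos b>0 (k₂ + k₂)

    Q>0 : 0 < Q
    Q>0 = m^n>0 b (k₂ + k₂)

    Ωgood≥ : M ≤ 2 * Ω good
    Ωgood≥ = *-cancelˡ-≤ 5 (*-cancelˡ-≤ Q {{>-nonZero Q>0}} (+-cancelʳ-≤ (5 * (M * Q)) _ _ (begin
      Q * (5 * M) + 5 * (M * Q)          ≡⟨ shape Q M ⟩
      10 * Q * M                         ≡⟨ cong (λ t → t * Q * M) (sym c≡10) ⟩
      c * Q * M                          ≤⟨ *-monoʳ-≤ (c * Q) (≤-trans Θ≥ Ω-split) ⟩
      c * Q * (Ω good + (Ω₁ + (Ω₂ + (Ω₃ + (Ω₄ + Ω₅)))))
                                         ≡⟨ distrib (c * Q) (Ω good) Ω₁ Ω₂ Ω₃ Ω₄ Ω₅ ⟩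
      c * Q * Ω good + (c * Q * Ω₁ + (c * Q * Ω₂ + (c * Q * Ω₃ + (c * Q * Ω₄ + c * Q * Ω₅))))
                                         ≤⟨ +-monoʳ-≤ (c * Q * Ω good) (+-mono-≤ e-s (+-mono-≤ e-y (+-mono-≤ e-xs (+-mono-≤ e-sy e-xsy)))) ⟩
      c * Q * Ω good + (M * Q + (M * Q + (M * Q + (M * Q + M * Q))))
                                         ≡⟨ cong (λ t → t * Q * Ω good + (M * Q + (M * Q + (M * Q + (M * Q + M * Q))))) c≡10 ⟩
      10 * Q * Ω good + (M * Q + (M * Q + (M * Q + (M * Q + M * Q))))
                                         ≡⟨ shape′ Q (Ω good) (M * Q) ⟩
      Q * (5 * (2 * Ω good)) + 5 * (M * Q) ∎)))
      where
      open ≤-Reasoning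
      Ω₁ = Ω (λ x s y → # (not (lev k s)))
      Ω₂ = Ω (λ x s y → # (not (lev k y)))
      Ω₃ = Ω (λ x s y → # (not (lev k₁ (x ⊕ s))))
      Ω₄ = Ω (λ x s y → # (not (lev (k + k) (s ⊕ y))))
      Ω₅ = Ω (λ x s y → # (not (lev k₂ ((x ⊕ s) ⊕ y))))
      shape : ∀ Q M → Q * (5 * M) + 5 * (M * Q) ≡ 10 * Q * M
      shape = solve-∀
      shape′ : ∀ Q w t → 10 * Q * w + (t + (t + (t + (t + t)))) ≡ Q * (5 * (2 * w)) + 5 * t
      shape′ = solve-∀
      distrib : ∀ a g u v w x y → a * (g + (u + (v + (w + (x + y))))) ≡ a * g + (a * u + (a * v + (a * w + (a * x + a * y))))
      distrib = solve-∀

    -- Replacing the three counts in the weight by their maxima turns the weighted count of good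
    -- triples into a plain one.
    good≤ : ∀ x s y → ω x s y * good x s y ≤
      m k * (m k * m k₂) * (# (B x) * (# (P s) * # (P (x ⊕ s)) * # (P y) * # (V (s ⊕ y)) * # (V ((x ⊕ s) ⊕ y))))
    good≤ x s y = begin
      ω x s y * good x s y
        ≡⟨ reorder (# (B x)) (r k s) (r k y) (r₂ ((x ⊕ s) ⊕ y)) (# (lev k s)) (# (lev k y)) (# (lev k₁ (x ⊕ s))) (# (lev (k + k) (s ⊕ y))) (# (lev k₂ ((x ⊕ s) ⊕ y))) ⟩
      r k s * (r k y * r₂ ((x ⊕ s) ⊕ y)) * (# (B x) * (# (lev k s) * # (lev k₁ (x ⊕ s)) * # (lev k y) * # (lev (k + k) (s ⊕ y)) * # (lev k₂ ((x ⊕ s) ⊕ y))))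
        ≤⟨ *-mono-≤ (*-mono-≤ (r≤m k s) (*-mono-≤ (r≤m k y) (r≤m k₂ ((x ⊕ s) ⊕ y)))) (*-monoʳ-≤ (# (B x))
             (*-mono-≤ (*-mono-≤ (*-mono-≤ (*-mono-≤ (left (lev k s) (lev k₁ s)) (right (lev k (x ⊕ s)) (lev k₁ (x ⊕ s)))) (left (lev k y) (lev k₁ y))) (left (lev (k + k) (s ⊕ y)) (lev k₂ (s ⊕ y)))) (right (lev (k + k) ((x ⊕ s) ⊕ y)) (lev k₂ ((x ⊕ s) ⊕ y))))) ⟩
      m k * (m k * m k₂) * (# (B x) * (# (P s) * # (P (x ⊕ s)) * # (P y) * # (V (s ⊕ y)) * # (V ((x ⊕ s) ⊕ y)))) ∎
      where
      open ≤-Reasoning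
      left : ∀ a b → # a ≤ # (a ∨ b)
      left true  b = ≤-refl
      left false b = z≤n
      right : ∀ a b → # b ≤ # (a ∨ b)
      right true  b = #≤1 b
      right false b = ≤-refl
      reorder : ∀ a s y t p q u v w → a * s * (y * t) * (p * (q * (u * (v * w)))) ≡ s * (y * t) * (a * (p * u * q * v * w))
      reorder = solve-∀

    Tr : ℕ
    Tr = Triples B P V

    M≤Triples : M ≤ 2 * (m k * (m k * m k₂) * Tr)
    M≤Triples = ≤-trans Ωgood≥ (*-monoʳ-≤ 2 (≤-trans (∑-mono univ λ x → ∑-mono univ λ s → ∑-mono univ λ y → good≤ x s y)
      (≤-reflexive (trans (∑-cong univ λ x → trans (∑-cong univ λ s → ∑-*ˡ (m k * (m k * m k₂)) univ _) (∑-*ˡ (m k * (m k * m k₂)) univ _)) (∑-*ˡ (m k * (m k * m k₂)) univ _)))))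

    -- After division by b ^ (4 k + 2) the hypothesis says that the maximal density at k is at most
    -- ρ times that at 4 k + 2.
    module Many (ρ : ℕ) (stationary : m k * (b * b * (bᵏ * bᵏ * bᵏ)) ≤ ρ * M) where

      -- 40 ^ 2 comes from Λ M ≤ 40 Q used twice and 2 from `Ωgood≥`. The cube of ρ comes from
      -- applying stationarity to m k twice, and to m k₂ through m k₂ ≤ b ^ k₁ m k.
      h : ℕ
      h = 3200 * (ρ * ρ * ρ)

      instance
        M≢0 : NonZero M
        M≢0 = >-nonZero M>0
        bᵏ≢0 : NonZero bᵏ
        bᵏ≢0 = m^n≢0 b k

      M≤ : M ≤ 2 * (m k * (m k * (b * bᵏ * m k)) * Tr)
      M≤ = ≤-trans M≤Triples (*-monoʳ-≤ 2 (*-monoˡ-≤ Tr (*-monoʳ-≤ (m k) (*-monoʳ-≤ (m k) (m-+ k₁ k)))))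

      bQQ≤ : b * (Q * Q) ≤ 2 * (ρ * ρ * ρ) * (M * M) * Tr
      bQQ≤ = *-cancelˡ-≤ (M * (b * bᵏ)) {{m*n≢0 M (b * bᵏ) {{M≢0}} {{m*n≢0 b bᵏ}}}} (begin
        M * (b * bᵏ) * (b * (Q * Q))
          ≡⟨ trans (cong (λ t → M * (b * bᵏ) * (b * (t * t))) Q≡) (shape M b bᵏ) ⟩
        M * (U * U * U)
          ≤⟨ *-monoˡ-≤ (U * U * U) M≤ ⟩
        2 * (m k * (m k * (b * bᵏ * m k)) * Tr) * (U * U * U)
          ≡⟨ shape′ (m k) (b * bᵏ) Tr U ⟩
        2 * (b * bᵏ) * Tr * (m k * U * (m k * U) * (m k * U))
          ≤⟨ *-monoʳ-≤ (2 * (b * bᵏ) * Tr) (*-mono-≤ (*-mono-≤ stationary stationary) stationary) ⟩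
        2 * (b * bᵏ) * Tr * (ρ * M * (ρ * M) * (ρ * M))
          ≡⟨ shape″ (b * bᵏ) Tr ρ M ⟩
        M * (b * bᵏ) * (2 * (ρ * ρ * ρ) * (M * M) * Tr) ∎)
        where
        open ≤-Reasoning
        U : ℕ
        U = b * b * (bᵏ * bᵏ * bᵏ)
        shape : ∀ M b u → M * (b * u) * (b * (b * (u * u) * (b * (u * u)) * (b * (u * u) * (b * (u * u)))))
                ≡ M * (b * b * (u * u * u) * (b * b * (u * u * u)) * (b * b * (u * u * u)))
        shape = solve-∀
        shape′ : ∀ a e t U → 2 * (a * (a * (e * a)) * t) * (U * U * U) ≡ 2 * e * t * (a * U * (a * U) * (a * U))
        shape′ = solve-∀
        shape″ : ∀ e t ρ M → 2 * e * t * (ρ * M * (ρ * M) * (ρ * M)) ≡ M * e * (2 * (ρ * ρ * ρ) * (M * M) * t)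
        shape″ = solve-∀

      many : b * (Λ * Λ) ≤ h * Tr
      many = *-cancelˡ-≤ (M * M) {{m*n≢0 M M}} (begin
        M * M * (b * (Λ * Λ))              ≡⟨ shape M b Λ ⟩
        b * (Λ * M * (Λ * M))              ≤⟨ *-monoʳ-≤ b (*-mono-≤ Λ-size Λ-size) ⟩
        b * (cccc * cccc)                  ≡⟨ trans (cong (λ t → b * ((t * Q + t * Q + (t * Q + t * Q)) * (t * Q + t * Q + (t * Q + t * Q)))) c≡10) (shape′ b Q) ⟩
        1600 * (b * (Q * Q))               ≤⟨ *-monoʳ-≤ 1600 bQQ≤ ⟩
        1600 * (2 * (ρ * ρ * ρ) * (M * M) * Tr) ≡⟨ shape″ (ρ * ρ * ρ) (M * M) Tr ⟩
        M * M * (h * Tr)                   ∎)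
        where
        open ≤-Reasoning
        cccc : ℕ
        cccc = c * Q + c * Q + (c * Q + c * Q)
        shape : ∀ M b l → M * M * (b * (l * l)) ≡ b * (l * M * (l * M))
        shape = solve-∀
        shape′ : ∀ b Q → b * ((10 * Q + 10 * Q + (10 * Q + 10 * Q)) * (10 * Q + 10 * Q + (10 * Q + 10 * Q))) ≡ 1600 * (b * (Q * Q))
        shape′ = solve-∀
        shape″ : ∀ e a t → 1600 * (2 * e * a * t) ≡ a * (3200 * e * t)
        shape″ = solve-∀

-- Finding a stationary scale and shrinking to a set with small sumsets

ladder : ℕ → ℕ
ladder zero    = 0
-- From k to 4 k + 2: two representations of x ⊕ s ⊕ y, each by 2 k + 1 elements.
ladder (suc j) = suc (ladder j + ladder j) + suc (ladder j + ladder j)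

ladder-mono-suc : ∀ j → ladder j ≤ ladder (suc j)
ladder-mono-suc j = ≤-trans (m≤m+n (ladder j) (ladder j)) (≤-trans (n≤1+n _) (m≤m+n _ _))

ladder-mono : ∀ {i j} → i ≤′ j → ladder i ≤ ladder j
ladder-mono ≤′-refl           = ≤-refl
ladder-mono (≤′-step {n} i≤j) = ≤-trans (ladder-mono i≤j) (ladder-mono-suc n)

-- 16 h q = 4096 h ^ 4 for h = 3200 ρ ^ 3, which C₀ ≤ ρ bounds by ρ ^ 13.
opaque
  C₀ : ℕ
  C₀ = 4096 * (3200 * 3200 * 3200 * 3200)

  C₀≡ : C₀ ≡ 4096 * (3200 * 3200 * 3200 * 3200)
  C₀≡ = refl

  12800≤C₀ : 12800 ≤ C₀
  12800≤C₀ = toWitness {a? = 12800 ≤? C₀} _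

40≤C₀ : 40 ≤ C₀
40≤C₀ = ≤-trans (toWitness {a? = 40 ≤? 12800} _) 12800≤C₀

C₀≥2 : 2 ≤ C₀
C₀≥2 = ≤-trans (s≤s (s≤s z≤n)) 40≤C₀

C₀>0 : 0 < C₀
C₀>0 = ≤-trans (s≤s z≤n) C₀≥2

module Descent (𝔾 : FinGroup) where
  open GroupSums 𝔾
  open Counts 𝔾
  open BSG 𝔾
  open Levels 𝔾

  module Ladder (B : G → Bool) (b>0 : 0 < ∣ B ∣) (ρ : ℕ) where
    open Reps B

    IsStationary : ℕ → Set
    IsStationary k = m k * (b * b * (b ^ k * b ^ k * b ^ k)) ≤ ρ * m (suc (k + k) + suc (k + k))

    step : 0 < ρ → ∀ q → ρ ^ q * m (ladder q) ≤ b ^ ladder q → ¬ IsStationary (ladder q) → ρ ^ suc q * m (ladder (suc q)) < b ^ ladder (suc q)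
    step ρ>0 q h ¬s = begin-strict
      ρ * ρ ^ q * M                                    ≡⟨ trans (*-assoc ρ (ρ ^ q) M) (*-swap ρ (ρ ^ q) M) ⟩
      ρ ^ q * (ρ * M)                                  <⟨ *-monoʳ-< (ρ ^ q) {{m^n≢0 ρ q {{>-nonZero ρ>0}}}} (≰⇒> ¬s) ⟩
      ρ ^ q * (m k * (b * b * (b ^ k * b ^ k * b ^ k))) ≡⟨ sym (*-assoc (ρ ^ q) (m k) _) ⟩
      ρ ^ q * m k * (b * b * (b ^ k * b ^ k * b ^ k))  ≤⟨ *-monoˡ-≤ _ h ⟩
      b ^ k * (b * b * (b ^ k * b ^ k * b ^ k))        ≡⟨ shape b (b ^ k) ⟩
      b * (b ^ k * b ^ k) * (b * (b ^ k * b ^ k))      ≡⟨ cong (λ t → b * t * (b * t)) (sym (^-distribˡ-+-* b k k)) ⟩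
      b ^ suc (k + k) * b ^ suc (k + k)                ≡⟨ sym (^-distribˡ-+-* b (suc (k + k)) (suc (k + k))) ⟩
      b ^ ladder (suc q)                                   ∎
      where
      open ≤-Reasoning
      k M : ℕ
      k = ladder q
      M = m (ladder (suc q))
      shape : ∀ b u → u * (b * b * (u * u * u)) ≡ b * (u * u) * (b * (u * u))
      shape = solve-∀

    -- Each rung that is not stationary lowers the maximal density by a factor ρ, starting from m 0
    -- ≤ 1. The strict version, available from the first rung on, is the one that contradicts a
    -- lower bound on the density.
    search : 0 < ρ → ∀ q → (∃ λ j → j < q × IsStationary (ladder j)) ⊎ ρ ^ q * m (ladder q) ≤ b ^ ladder q × (0 < q → ρ ^ q * m (ladder q) < b ^ ladder q)
    search ρ>0 zero = inj₂ (≤-trans (≤-reflexive (*-identityˡ (m 0))) m0≤1 , λ ())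
    search ρ>0 (suc q) with search ρ>0 q
    ... | inj₁ (j , j<q , s) = inj₁ (j , m<n⇒m<1+n j<q , s)
    ... | inj₂ (h , _) with m (ladder q) * (b * b * (b ^ ladder q * b ^ ladder q * b ^ ladder q)) ≤? ρ * m (ladder (suc q))
    ...   | yes s = inj₁ (q , n<1+n q , s)
    ...   | no ¬s = inj₂ (<⇒≤ (step ρ>0 q h ¬s) , λ _ → step ρ>0 q h ¬s)

    m1≤1 : m 1 ≤ 1
    m1≤1 = max-lub univ λ z → ≤-trans (≤-reflexive (trans
      (∑-cong univ λ x → trans (cong (# (B x) *_) (δ-⇔ {z ∸G x} {𝟘} {x} {z}
          (λ e → trans (sym (⊕-idˡ x)) (trans (cong (_⊕ x) (sym e)) (-⊕ z x)))
          (λ { refl → trans (⊕-comm x (⊖ x)) (⊕-invˡ x) })))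
        (*-comm (# (B x)) (δ x z)))
      (S-δ z (λ x → # (B x))))) (#≤1 (B z))

  -- The l-fold sumset of B′ is compared with the inverse of the maximal density of B at 4 k + 2.
  -- The loss is ρ ^ 13 per summand, from `W≤`, and one more ρ that absorbs the factor 40 in the
  -- size of Λ.
  Shrunk : (B : G → Bool) (ρ k : ℕ) → Set
  Shrunk B ρ k = ∃ λ B′ → B′ ⊆ᵇ B × ∣ B ∣ ≤ ρ ^ 4 * ∣ B′ ∣ ×
    (∀ l → ∣ Reps.supp B′ l ∣ * Reps.m B (suc (k + k) + suc (k + k)) ≤ ρ ^ (13 * l + 1) * ∣ B ∣ ^ (suc (k + k) + suc (k + k)))

  shrink′ : ∀ B (b>0 : 0 < ∣ B ∣) ρ → C₀ ≤ ρ → ∀ k → Reps.m B k * (∣ B ∣ * ∣ B ∣ * (∣ B ∣ ^ k * ∣ B ∣ ^ k * ∣ B ∣ ^ k)) ≤ ρ * Reps.m B (suc (k + k) + suc (k + k)) →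
    ∀ c → c ≡ 10 → ∀ h h₂ h₄ h₈ h₁₆ → h ≡ 3200 * (ρ * ρ * ρ) → h₂ ≡ h + h → h₄ ≡ h₂ + h₂ → h₈ ≡ h₄ + h₄ → h₁₆ ≡ h₈ + h₈ → Shrunk B ρ k
  shrink′ B b>0 ρ C₀≤ρ k stationary c c≡10 h h₂ h₄ h₈ h₁₆ h≡ h₂≡ h₄≡ h₈≡ h₁₆≡ =
    result
    where
    module L = Stationary B k c c≡10 b>0
    module LM = L.Many ρ stationary
    open Reps B using (b; m)
    instance
      ρ≢0 : NonZero ρ
      ρ≢0 = >-nonZero (<-≤-trans C₀>0 C₀≤ρ)
    Tr>0 : 0 < L.Tr
    Tr>0 = proj₂ (0<*⇒ (2 * (ρ * ρ * ρ) * (L.M * L.M)) L.Tr (<-≤-trans (*-mono-< b>0 (*-mono-< L.Q>0 L.Q>0)) LM.bQQ≤))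
    Λ>0 : 0 < L.Λ
    Λ>0 = <-≤-trans (from-x (∑->0⇒∃ univ {λ x → S λ s → S λ y → F x s y} Tr>0)) (m≤m+n ∣ L.P ∣ ∣ L.V ∣)
      where
      F : G → G → G → ℕ
      F x s y = # (B x) * (# (L.P s) * # (L.P (x ⊕ s)) * # (L.P y) * # (L.V (s ⊕ y)) * # (L.V ((x ⊕ s) ⊕ y)))
      from-y : ∀ x s → (∃ λ y → y ∈ univ × 0 < F x s y) → 0 < # (L.P s)
      from-y x s (y , _ , lt) = proj₁ (0<*⇒ _ _ (proj₁ (0<*⇒ _ _ (proj₁ (0<*⇒ _ (# (L.V (s ⊕ y))) (proj₁ (0<*⇒ _ (# (L.V ((x ⊕ s) ⊕ y))) (proj₂ (0<*⇒ (# (B x)) _ lt)))))))))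
      from-s : ∀ x → (∃ λ s → s ∈ univ × 0 < S (F x s)) → 0 < ∣ L.P ∣
      from-s x (s , i , lt) = <-≤-trans (from-y x s (∑->0⇒∃ univ {F x s} lt)) (∑-term (λ s → # (L.P s)) i)
      from-x : (∃ λ x → x ∈ univ × 0 < S (λ s → S (F x s))) → 0 < ∣ L.P ∣
      from-x (x , _ , lt) = from-s x (∑->0⇒∃ univ {λ s → S (F x s)} lt)
    h>0 : 0 < h
    h>0 = subst (0 <_) (sym h≡) (>-nonZero⁻¹ _ {{m*n≢0 3200 (ρ * ρ * ρ) {{_}} {{m*n≢0 (ρ * ρ) ρ {{m*n≢0 ρ ρ}}}}}})
    module K = Core B L.P L.V L.Λ h h₂ h₄ h₈ h₁₆ h₂≡ h₄≡ h₈≡ h₁₆≡ Λ>0 h>0 b>0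
      (m≤m+n ∣ L.P ∣ ∣ L.V ∣) (m≤n+m ∣ L.V ∣ ∣ L.P ∣) (subst (λ t → b * (L.Λ * L.Λ) ≤ t * L.Tr) (sym h≡) LM.many)
    h₂≡′ : h₂ ≡ 2 * h
    h₂≡′ = trans h₂≡ (cong (h +_) (sym (+-identityʳ h)))
    double : ∀ n {x y} → x ≡ y + y → y ≡ n * h → x ≡ (n + n) * h
    double n refl refl = sym (*-distribʳ-+ h n n)
    h₄≡′ : h₄ ≡ 4 * h
    h₄≡′ = double 2 h₄≡ h₂≡′
    h₈≡′ : h₈ ≡ 8 * h
    h₈≡′ = double 4 h₈≡ h₄≡′
    h₁₆≡′ : h₁₆ ≡ 16 * h
    h₁₆≡′ = double 8 h₁₆≡ h₈≡′
    W≤ : h₁₆ * K.q ≤ ρ ^ 13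
    W≤ = begin
      h₁₆ * (h₁₆ * (h₂ * h₈))                  ≡⟨ cong₂ (λ u v → u * (u * v)) h₁₆≡′ (cong₂ _*_ h₂≡′ h₈≡′) ⟩
      16 * h * (16 * h * (2 * h * (8 * h)))    ≡⟨ shape h ⟩
      4096 * (h * h * h * h)                   ≡⟨ cong (λ t → 4096 * (t * t * t * t)) h≡ ⟩
      4096 * (3200 * e * (3200 * e) * (3200 * e) * (3200 * e)) ≡⟨ trans (shape′ 4096 3200 e) (cong (_* (e * e * e * e)) (sym C₀≡)) ⟩
      C₀ * (e * e * e * e)                     ≤⟨ *-monoˡ-≤ (e * e * e * e) C₀≤ρ ⟩
      ρ * (e * e * e * e)                      ≡⟨ shape″ ρ ⟩
      ρ ^ 13                                   ∎
      where
      open ≤-Reasoning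
      e : ℕ
      e = ρ * ρ * ρ
      shape : ∀ h → 16 * h * (16 * h * (2 * h * (8 * h))) ≡ 4096 * (h * h * h * h)
      shape = solve-∀
      shape′ : ∀ a c e → a * (c * e * (c * e) * (c * e) * (c * e)) ≡ a * (c * c * c * c) * (e * e * e * e)
      shape′ = solve-∀
      shape″ : ∀ ρ → ρ * ((ρ * ρ * ρ) * (ρ * ρ * ρ) * (ρ * ρ * ρ) * (ρ * ρ * ρ)) ≡
               ρ * (ρ * (ρ * (ρ * (ρ * (ρ * (ρ * (ρ * (ρ * (ρ * (ρ * (ρ * (ρ * 1))))))))))))
      shape″ = solve-∀
    h₄≤ : h₄ ≤ ρ ^ 4
    h₄≤ = begin
      h₄                        ≡⟨ trans h₄≡′ (cong (4 *_) h≡) ⟩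
      4 * (3200 * (ρ * ρ * ρ))  ≡⟨ sym (*-assoc 4 3200 (ρ * ρ * ρ)) ⟩
      4 * 3200 * (ρ * ρ * ρ)    ≤⟨ *-monoˡ-≤ (ρ * ρ * ρ) (≤-trans 12800≤C₀ C₀≤ρ) ⟩
      ρ * (ρ * ρ * ρ)           ≡⟨ shape ρ ⟩
      ρ ^ 4                     ∎
      where
      open ≤-Reasoning
      shape : ∀ ρ → ρ * (ρ * ρ * ρ) ≡ ρ * (ρ * (ρ * (ρ * 1)))
      shape = solve-∀
    from-pivot : (∃ λ y → L.P y ≡ true × b * (K.q * K.β y) + b * (L.Λ * L.Λ) ≤ h₂ * L.Λ * K.n y) → Shrunk B ρ k
    from-pivot (y₀ , _ , pivotal) = Z.B′ , Z.B′⊆B , ≤-trans Z.B′-large (*-monoˡ-≤ ∣ Z.B′ ∣ h₄≤) , λ l → begin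
      ∣ Reps.supp Z.B′ l ∣ * L.M             ≤⟨ *-monoˡ-≤ L.M (Z.supp≤ l) ⟩
      (h₁₆ * K.q) ^ l * L.Λ * L.M            ≡⟨ *-assoc ((h₁₆ * K.q) ^ l) L.Λ L.M ⟩
      (h₁₆ * K.q) ^ l * (L.Λ * L.M)          ≤⟨ *-mono-≤ (^-monoˡ-≤ l W≤) (≤-trans L.Λ-size (≤-reflexive (cong (λ c → c * L.Q + c * L.Q + (c * L.Q + c * L.Q)) c≡10))) ⟩
      (ρ ^ 13) ^ l * (10 * L.Q + 10 * L.Q + (10 * L.Q + 10 * L.Q))
                                             ≡⟨ cong ((ρ ^ 13) ^ l *_) (forty L.Q) ⟩
      (ρ ^ 13) ^ l * (40 * L.Q)              ≤⟨ *-monoʳ-≤ ((ρ ^ 13) ^ l) (*-monoˡ-≤ L.Q (≤-trans 40≤C₀ C₀≤ρ)) ⟩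
      (ρ ^ 13) ^ l * (ρ * L.Q)               ≡⟨ sym (*-assoc ((ρ ^ 13) ^ l) ρ L.Q) ⟩
      (ρ ^ 13) ^ l * ρ * L.Q                 ≡⟨ cong (_* L.Q) (cong₂ _*_ (^-*-assoc ρ 13 l) (sym (*-identityʳ ρ))) ⟩
      ρ ^ (13 * l) * ρ ^ 1 * L.Q             ≡⟨ cong (_* L.Q) (sym (^-distribˡ-+-* ρ (13 * l) 1)) ⟩
      ρ ^ (13 * l + 1) * L.Q                 ∎
      where
      open ≤-Reasoning
      module Z = K.Pivoted y₀ pivotal
      forty : ∀ q → 10 * q + 10 * q + (10 * q + 10 * q) ≡ 40 * q
      forty = solve-∀
    result : Shrunk B ρ k
    result = from-pivot K.pivot

  shrink : ∀ B (b>0 : 0 < ∣ B ∣) ρ → C₀ ≤ ρ → ∀ k → Ladder.IsStationary B b>0 ρ k → Shrunk B ρ k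
  shrink B b>0 ρ C₀≤ρ k st = shrink′ B b>0 ρ C₀≤ρ k st 10 refl _ _ _ _ _ refl refl refl refl refl

-- Evenly spread sums

-- The linear bound absorbs the losses of shrink on sumsets of 2 + L summands, the square those of the greedy selection below.
opaque
  factor : ℕ → ℕ
  factor L = 13 * ((6 + L) * (6 + L))

  factor-linear : ∀ L → 13 * (2 + L) + 1 ≤ factor L
  factor-linear L = ≤-trans (m≤m+n _ _) (≤-reflexive (sym (expand L)))
    where
    expand : ∀ L → 13 * ((6 + L) * (6 + L)) ≡ 13 * (2 + L) + 1 + (441 + 143 * L + 13 * (L * L))
    expand = solve-∀

  factor-square : ∀ L → (5 + L) * (5 + L) ≤ factor L
  factor-square L = ≤-trans (*-mono-≤ (n≤1+n (5 + L)) (n≤1+n (5 + L))) (m≤n*m ((6 + L) * (6 + L)) 13)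

factor≥5 : ∀ L → 5 ≤ factor L
factor≥5 L = ≤-trans (m≤m+n 5 L) (≤-trans (m≤m*n (5 + L) (5 + L)) (factor-square L))

mutual
  -- `reach i` is the number of summands at which stage i measures density. Stage suc i climbs suc i
  -- * power (suc i) rungs, each worth a factor ρ, so that missing all of them would cost X ^ suc i.
  -- In `power`, the factor is the exponent by which ρ grows before stage i takes over. The value 2
  -- at stage 0 is where the trivial bound m 2 ≤ b gives a contradiction.
  reach : ℕ → ℕ
  reach zero    = 2
  reach (suc i) = ladder (suc i * power (suc i))

  power : ℕ → ℕ
  power zero    = 1
  power (suc i) = factor (reach i) * power i

Kmax : ℕ → ℕ
Kmax zero    = 0
Kmax (suc i) = Kmax i ⊔ (2 + reach i)

power≢0 : ∀ i → NonZero (power i)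
power≢0 zero    = _
power≢0 (suc i) = m*n≢0 (factor (reach i)) (power i) {{>-nonZero (<-≤-trans (s≤s z≤n) (factor≥5 (reach i)))}} {{power≢0 i}}

module Claims (𝔾 : FinGroup) where
  open GroupSums 𝔾
  open Counts 𝔾
  open BSG 𝔾
  open Descent 𝔾

  -- The 2 + K fold sums of B are, up to X ^ 2, as evenly spread over the sumset as they can be.
  Even : (G → Bool) → ℕ → ℕ → Set
  Even B K X = Reps.m B K * ∣ Reps.supp B (2 + K) ∣ ≤ X * X * ∣ B ∣ ^ K

  -- By stationarity on the ladder B shrinks to a B′ with small sumsets; either B′ is even, or the maximal density of its
  -- reach i fold sums exceeds that of B by a factor X, which can happen at most i times.
  Claim : ℕ → Set
  Claim i = ∀ (B : G → Bool) ρ X → C₀ ≤ ρ → X ≡ ρ ^ power i → X + X ≤ ∣ B ∣ * ρ →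
    ∣ B ∣ ^ reach i ≤ X ^ i * Reps.m B (reach i) →
    ∃ λ B⁺ → B⁺ ⊆ᵇ B × ∣ B ∣ * ρ ≤ ∣ B⁺ ∣ * X × ∃ λ K → 2 + K ≤ Kmax i × Even B⁺ K X × ρ ^ ((5 + K) * (5 + K)) ≤ X

  -- At stage 0 the density hypothesis reads b ^ 2 ≤ m 2, whereas m 2 ≤ b because the first summand
  -- determines the second; X = ρ forces b ≥ 2.
  claim-zero : Claim 0
  claim-zero B ρ X C₀≤ρ X≡ 2X≤ small = contradiction (≤-trans b≥2 b≤1) (<⇒≱ (s≤s (s≤s z≤n)))
    where
    open Reps B
    instance
      ρ≢0 : NonZero ρ
      ρ≢0 = >-nonZero (<-≤-trans C₀>0 C₀≤ρ)
    b≥2 : 2 ≤ b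
    b≥2 = *-cancelʳ-≤ 2 b ρ (≤-trans (≤-reflexive (trans (cong (ρ +_) (+-identityʳ ρ)) (cong (λ t → t + t) (trans (sym (*-identityʳ ρ)) (sym X≡))))) 2X≤)
    b>0 : 0 < b
    b>0 = <-≤-trans (s≤s z≤n) b≥2
    b≤1 : b ≤ 1
    b≤1 = *-cancelˡ-≤ b {{>-nonZero b>0}} (begin
      b * b                ≡⟨ cong (b *_) (sym (*-identityʳ b)) ⟩
      b ^ 2                ≤⟨ small ⟩
      1 * m 2              ≡⟨ *-identityˡ (m 2) ⟩
      m 2                  ≤⟨ m-suc 1 ⟩
      b * m 1              ≤⟨ *-monoʳ-≤ b (Ladder.m1≤1 B b>0 ρ) ⟩
      b * 1                ∎)
      where open ≤-Reasoning

  private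
    module Step (i : ℕ) (IH : Claim i) (B : G → Bool) (ρ X : ℕ) (C₀≤ρ : C₀ ≤ ρ)
                (X≡ : X ≡ ρ ^ power (suc i)) (2X≤ : X + X ≤ ∣ B ∣ * ρ)
                (initial : ∣ B ∣ ^ reach (suc i) ≤ X ^ suc i * Reps.m B (reach (suc i))) where
      open Reps B

      L f ρ′ : ℕ
      L  = reach i
      f  = factor L
      ρ′ = ρ ^ f

      ρ>0 : 0 < ρ
      ρ>0 = <-≤-trans C₀>0 C₀≤ρ

      instance
        ρ≢0 : NonZero ρ
        ρ≢0 = >-nonZero ρ>0

      X>0 : 0 < X
      X>0 = subst (0 <_) (sym X≡) (m^n>0 ρ (power (suc i)))

      instance
        X≢0 : NonZero X
        X≢0 = >-nonZero X>0

      b>0 : 0 < b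
      b>0 = proj₁ (0<*⇒ b ρ (<-≤-trans X>0 (≤-trans (m≤m+n X X) 2X≤)))

      X≡ρ′ : X ≡ ρ′ ^ power i
      X≡ρ′ = trans X≡ (sym (^-*-assoc ρ f (power i)))

      ρ′≤X : ρ′ ≤ X
      ρ′≤X = subst (ρ′ ≤_) (sym X≡) (^-monoʳ-≤ ρ (m≤m*n f (power i) {{power≢0 i}}))

      f≥ : ∀ {n} → n ≤ f → ρ ^ n ≤ ρ′
      f≥ h = ^-monoʳ-≤ ρ h

      ρ≤ρ′ : ρ ≤ ρ′
      ρ≤ρ′ = ≤-trans (≤-reflexive (sym (*-identityʳ ρ))) (f≥ (≤-trans (s≤s z≤n) (factor≥5 L)))

      -- Otherwise the density at the top of the ladder would be below X to the power - (suc i),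
      -- against `initial`.
      stationary : ∃ λ j → j < suc i * power (suc i) × Ladder.IsStationary B b>0 ρ (ladder j)
      stationary with Ladder.search B b>0 ρ ρ>0 (suc i * power (suc i))
      ... | inj₁ s = s
      ... | inj₂ (_ , lt) = contradiction initial (<⇒≱ (subst (λ t → t * m (reach (suc i)) < b ^ reach (suc i)) eq
                              (lt (>-nonZero⁻¹ (suc i * power (suc i)) {{m*n≢0 (suc i) (power (suc i)) {{_}} {{power≢0 (suc i)}}}}))))
        where
        eq : ρ ^ (suc i * power (suc i)) ≡ X ^ suc i
        eq = trans (cong (ρ ^_) (*-comm (suc i) (power (suc i)))) (trans (sym (^-*-assoc ρ (power (suc i)) (suc i))) (cong (_^ suc i) (sym X≡)))

      module At (j : ℕ) (j< : j < suc i * power (suc i)) (B′ : G → Bool) (B′⊆B : B′ ⊆ᵇ B)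
                (large : b ≤ ρ ^ 4 * ∣ B′ ∣)
                (sumsets : ∀ l → ∣ Reps.supp B′ l ∣ * m (ladder (suc j)) ≤ ρ ^ (13 * l + 1) * b ^ ladder (suc j)) where

        b′ M Q : ℕ
        b′ = ∣ B′ ∣
        M = m (ladder (suc j))
        Q = b ^ ladder (suc j)

        M>0 : 0 < M
        M>0 = m-pos b>0 (ladder (suc j))

        -- Densities do not increase with the number of summands, so the lower bound assumed at the
        -- top of the ladder is valid at every lower rung.
        Q≤ : Q ≤ X ^ suc i * M
        Q≤ = *-cancelˡ-≤ (b ^ e) {{m^n≢0 b e {{>-nonZero b>0}}}} (begin
          b ^ e * Q                            ≡⟨ sym (^-distribˡ-+-* b e (ladder (suc j))) ⟩
          b ^ (e + ladder (suc j))                 ≡⟨ cong (b ^_) e≡ ⟩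
          b ^ reach (suc i)                      ≤⟨ initial ⟩
          X ^ suc i * m (reach (suc i))          ≡⟨ cong (λ t → X ^ suc i * m t) (sym e≡) ⟩
          X ^ suc i * m (e + ladder (suc j))       ≤⟨ *-monoʳ-≤ (X ^ suc i) (m-+ e (ladder (suc j))) ⟩
          X ^ suc i * (b ^ e * M)              ≡⟨ *-swap (X ^ suc i) (b ^ e) M ⟩
          b ^ e * (X ^ suc i * M)              ∎)
          where
          open ≤-Reasoning
          e : ℕ
          e = reach (suc i) ∸ ladder (suc j)
          e≡ : e + ladder (suc j) ≡ reach (suc i)
          e≡ = m∸n+n≡m (ladder-mono (≤⇒≤′ j<))

        large′ : b * ρ ≤ b′ * ρ ^ 5
        large′ = begin
          b * ρ                ≤⟨ *-monoˡ-≤ ρ large ⟩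
          ρ ^ 4 * b′ * ρ       ≡⟨ trans (cong (_* ρ) (*-comm (ρ ^ 4) b′)) (trans (*-assoc b′ (ρ ^ 4) ρ) (cong (b′ *_) (*-comm (ρ ^ 4) ρ))) ⟩
          b′ * ρ ^ 5           ∎
          where open ≤-Reasoning

        -- The product of the size and ρ does not decrease on passing to B′ and ρ′. This hands the
        -- hypothesis X + X ≤ ∣ B ∣ * ρ on to the next stage and yields the final size bound, where
        -- ρ has become X.
        large″ : b * ρ ≤ b′ * ρ′
        large″ = ≤-trans large′ (*-monoʳ-≤ b′ (f≥ (factor≥5 L)))

        -- Of the two factors X in `Even`, one pays for the loss in the sumset bound and the other
        -- lowers the exponent from suc i to i.
        ¬even⇒initial : ¬ Even B′ L X → b′ ^ L ≤ X ^ i * Reps.m B′ L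
        ¬even⇒initial ¬even = *-cancelˡ-≤ (X * X) {{m*n≢0 X X}} (*-cancelʳ-≤ _ _ M {{>-nonZero M>0}} (begin
          X * X * b′ ^ L * M                                ≤⟨ *-monoˡ-≤ M (<⇒≤ (≰⇒> ¬even)) ⟩
          m′ * ∣ Reps.supp B′ (2 + L) ∣ * M                 ≡⟨ *-assoc m′ ∣ Reps.supp B′ (2 + L) ∣ M ⟩
          m′ * (∣ Reps.supp B′ (2 + L) ∣ * M)               ≤⟨ *-monoʳ-≤ m′ (sumsets (2 + L)) ⟩
          m′ * (ρ ^ (13 * (2 + L) + 1) * Q)                 ≤⟨ *-monoʳ-≤ m′ (*-mono-≤ (≤-trans (f≥ (factor-linear L)) ρ′≤X) Q≤) ⟩
          m′ * (X * (X * X ^ i * M))                        ≡⟨ shape m′ X (X ^ i) M ⟩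
          X * X * (X ^ i * m′) * M                          ∎))
          where
          open ≤-Reasoning
          m′ : ℕ
          m′ = Reps.m B′ L
          shape : ∀ a X u M → a * (X * (X * u * M)) ≡ X * X * (u * a) * M
          shape = solve-∀

        conclude : ∃ λ B⁺ → B⁺ ⊆ᵇ B × b * ρ ≤ ∣ B⁺ ∣ * X × ∃ λ K → 2 + K ≤ Kmax (suc i) × Even B⁺ K X × ρ ^ ((5 + K) * (5 + K)) ≤ X
        conclude with Reps.m B′ L * ∣ Reps.supp B′ (2 + L) ∣ ≤? X * X * b′ ^ L
        ... | yes even = B′ , B′⊆B , ≤-trans large″ (*-monoʳ-≤ b′ ρ′≤X) , L , m≤n⊔m (Kmax i) (2 + L) , even ,
                ≤-trans (f≥ (factor-square L)) ρ′≤X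
        ... | no ¬even with IH B′ ρ′ X (≤-trans C₀≤ρ ρ≤ρ′) X≡ρ′ (≤-trans 2X≤ large″) (¬even⇒initial ¬even)
        ...   | B⁺ , B⁺⊆B′ , large⁺ , K , K≤ , even , expo = B⁺ , (λ x e → B′⊆B x (B⁺⊆B′ x e)) , ≤-trans large″ large⁺ ,
                  K , ≤-trans K≤ (m≤m⊔n (Kmax i) (2 + L)) , even , ≤-trans (^-monoˡ-≤ ((5 + K) * (5 + K)) ρ≤ρ′) expo

      result : ∃ λ B⁺ → B⁺ ⊆ᵇ B × b * ρ ≤ ∣ B⁺ ∣ * X × ∃ λ K → 2 + K ≤ Kmax (suc i) × Even B⁺ K X × ρ ^ ((5 + K) * (5 + K)) ≤ X
      result = from stationary
        where
        from : (∃ λ j → j < suc i * power (suc i) × Ladder.IsStationary B b>0 ρ (ladder j)) → _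
        from (j , j< , st) = from′ (shrink B b>0 ρ C₀≤ρ (ladder j) st)
          where
          from′ : Shrunk B ρ (ladder j) → _
          from′ (B′ , B′⊆B , large , sumsets) = At.conclude j j< B′ B′⊆B large sumsets

  claim : ∀ i → Claim i
  claim zero    = claim-zero
  claim (suc i) B ρ X C₀≤ρ X≡ 2X≤ start = Step.result i (claim i) B ρ X C₀≤ρ X≡ 2X≤ start

-- Fresh representations and greedy selection

∑-search : ∀ {A Found : Set} (xs : List A) {f g : A → ℕ} → (∀ x → Found ⊎ f x ≤ g x) → Found ⊎ ∑ xs f ≤ ∑ xs g
∑-search []       h = inj₂ z≤n
∑-search (x ∷ xs) h with h x | ∑-search xs h
... | inj₁ found | _          = inj₁ found
... | inj₂ _     | inj₁ found = inj₁ found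
... | inj₂ p     | inj₂ q     = inj₂ (+-mono-≤ p q)

choose₂ : ℕ → ℕ
choose₂ zero    = 0
choose₂ (suc j) = choose₂ j + j

choose₂≤ : ∀ j → choose₂ j ≤ j * j
choose₂≤ zero    = z≤n
choose₂≤ (suc j) = ≤-trans (+-monoˡ-≤ j (choose₂≤ j)) (≤-trans (m≤m+n _ (j + 1)) (≤-reflexive (expand j)))
  where
  expand : ∀ j → j * j + j + (j + 1) ≡ suc j * suc j
  expand = solve-∀

module Selection (𝔾 : FinGroup) where
  open GroupSums 𝔾
  open Counts 𝔾
  open DecMembership _≟G_ using (_∈?_)

  gsum : List G → G
  gsum []       = 𝟘
  gsum (x ∷ xs) = x ⊕ gsum xs

  remove : ∀ {x xs} → x ∈ xs → Unique xs → ∃ λ ys → length xs ≡ suc (length ys) × Unique ys ×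
           (∀ {y} → y ∈ ys → y ∈ xs) × x ∉ ys × gsum xs ≡ x ⊕ gsum ys × (∀ f → ∑ xs f ≡ f x + ∑ ys f)
  remove {xs = x ∷ xs} (here refl) (x∉ ∷ u) = xs , refl , u , there , (λ i → All.lookup x∉ i refl) , refl , λ f → refl
  remove {x} {y ∷ xs} (there i) (y∉ ∷ u) with remove i u
  ... | ys , size , u′ , sub , x∉ys , total , sum = y ∷ ys , cong suc size , All.tabulate (λ j → All.lookup y∉ (sub j)) ∷ u′ ,
    (λ { (here e) → here e ; (there j) → there (sub j) }) , (λ { (here refl) → All.lookup y∉ i refl ; (there j) → x∉ys j }) ,
    trans (cong (y ⊕_) total) (trans (sym (⊕-assoc y x (gsum ys))) (trans (cong (_⊕ gsum ys) (⊕-comm y x)) (⊕-assoc x y (gsum ys)))) ,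
    λ f → trans (cong (f y +_) (sum f)) (+-swap (f y) (f x) (∑ ys f))

  record FreshTuple (B : G → Bool) (F : List G) (j : ℕ) (z : G) : Set where
    constructor freshTuple
    field
      tuple  : List G
      size   : length tuple ≡ j
      unique : Unique tuple
      inside : All (λ x → B x ≡ true) tuple
      avoids : All (_∉ F) tuple
      total  : gsum tuple ≡ z

  module _ (B : G → Bool) where
    open Reps B

    -- The value 0 for a negative number of summands is harmless: in `excess` the coefficients j and
    -- choose₂ j vanish there.
    r₋₁ r₋₂ : ℕ → G → ℕ
    r₋₁ zero    z = 0
    r₋₁ (suc j) z = r j z
    r₋₂ zero    z = 0
    r₋₂ (suc j) z = r₋₁ j z

    -- A union bound: j positions at which an element of F may stand, and choose₂ j pairs of
    -- positions that may share an element a.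
    excess : ℕ → List G → G → ℕ
    excess j F z = j * ∑ F (λ a → r₋₁ j (z ∸G a)) + choose₂ j * S (λ a → # (B a) * r₋₂ j ((z ∸G a) ∸G a))

    private
      r₋₁-conv : ∀ j w → j * S (λ x → # (B x) * r₋₁ j (w ∸G x)) ≡ j * r j w
      r₋₁-conv zero    w = refl
      r₋₁-conv (suc j) w = refl

      r₋₂-conv : ∀ j w → choose₂ j * S (λ x → # (B x) * r₋₂ j (w ∸G x)) ≡ choose₂ j * r₋₁ j w
      r₋₂-conv zero          w = refl
      r₋₂-conv (suc zero)    w = refl
      r₋₂-conv (suc (suc j)) w = refl

      first : ℕ → List G → G → G → ℕ
      first j F z x = ∑ F (λ a → δ x a) * r j (z ∸G x)

      rest : ℕ → List G → G → G → ℕ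
      rest j F z x = # (B x) * (excess j (x ∷ F) (z ∸G x))

      first-total : ∀ j F z → S (first j F z) ≡ ∑ F (λ a → r j (z ∸G a))
      first-total j F z = begin
        S (λ x → ∑ F (λ a → δ x a) * r j (z ∸G x))    ≡⟨ ∑-cong univ (λ x → sym (∑-*ʳ (r j (z ∸G x)) F (λ a → δ x a))) ⟩
        S (λ x → ∑ F (λ a → δ x a * r j (z ∸G x)))    ≡⟨ ∑-swap univ F (λ x a → δ x a * r j (z ∸G x)) ⟩
        ∑ F (λ a → S (λ x → δ x a * r j (z ∸G x)))    ≡⟨ ∑-cong F (λ a → S-δ a (λ x → r j (z ∸G x))) ⟩
        ∑ F (λ a → r j (z ∸G a))                      ∎
        where open ≡-Reasoning

      rest-total : ∀ j F z → S (rest j F z) ≡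
        (j * S (λ x → # (B x) * r₋₁ j ((z ∸G x) ∸G x)) + j * ∑ F (λ a → r j (z ∸G a))) +
        choose₂ j * S (λ a → # (B a) * r₋₁ j ((z ∸G a) ∸G a))
      rest-total j F z = begin
        S (rest j F z)
          ≡⟨ ∑-cong univ (λ x → expand (# (B x)) j (r₋₁ j ((z ∸G x) ∸G x)) (X x) (choose₂ j) (Y x)) ⟩
        S (λ x → (j * (# (B x) * r₋₁ j ((z ∸G x) ∸G x)) + j * (# (B x) * X x)) + choose₂ j * (# (B x) * Y x))
          ≡⟨ trans (∑-+ univ (λ x → j * (# (B x) * r₋₁ j ((z ∸G x) ∸G x)) + j * (# (B x) * X x)) (λ x → choose₂ j * (# (B x) * Y x)))
              (cong₂ _+_ (trans (∑-+ univ (λ x → j * (# (B x) * r₋₁ j ((z ∸G x) ∸G x))) (λ x → j * (# (B x) * X x)))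
                (cong₂ _+_ (∑-*ˡ j univ (λ x → # (B x) * r₋₁ j ((z ∸G x) ∸G x)))
                  (trans (∑-*ˡ j univ (λ x → # (B x) * X x)) eqX)))
                (trans (∑-*ˡ (choose₂ j) univ (λ x → # (B x) * Y x)) eqY)) ⟩
        (j * S (λ x → # (B x) * r₋₁ j ((z ∸G x) ∸G x)) + j * ∑ F (λ a → r j (z ∸G a))) +
        choose₂ j * S (λ a → # (B a) * r₋₁ j ((z ∸G a) ∸G a)) ∎
        where
        open ≡-Reasoning
        X Y : G → ℕ
        X x = ∑ F (λ a → r₋₁ j ((z ∸G x) ∸G a))
        Y x = S (λ a → # (B a) * r₋₂ j (((z ∸G x) ∸G a) ∸G a))
        expand : ∀ b j u v c w → b * (j * (u + v) + c * w) ≡ (j * (b * u) + j * (b * v)) + c * (b * w)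
        expand = solve-∀
        eqX : j * S (λ x → # (B x) * X x) ≡ j * ∑ F (λ a → r j (z ∸G a))
        eqX = begin
          j * S (λ x → # (B x) * X x)
            ≡⟨ cong (j *_) (∑-cong univ (λ x → sym (∑-*ˡ (# (B x)) F (λ a → r₋₁ j ((z ∸G x) ∸G a))))) ⟩
          j * S (λ x → ∑ F (λ a → # (B x) * r₋₁ j ((z ∸G x) ∸G a)))
            ≡⟨ cong (j *_) (∑-swap univ F (λ x a → # (B x) * r₋₁ j ((z ∸G x) ∸G a))) ⟩
          j * ∑ F (λ a → S (λ x → # (B x) * r₋₁ j ((z ∸G x) ∸G a)))
            ≡⟨ sym (∑-*ˡ j F (λ a → S (λ x → # (B x) * r₋₁ j ((z ∸G x) ∸G a)))) ⟩
          ∑ F (λ a → j * S (λ x → # (B x) * r₋₁ j ((z ∸G x) ∸G a)))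
            ≡⟨ ∑-cong F (λ a → trans (cong (j *_) (∑-cong univ (λ x → cong (λ w → # (B x) * r₋₁ j w) (-swap z x a)))) (r₋₁-conv j (z ∸G a))) ⟩
          ∑ F (λ a → j * r j (z ∸G a))
            ≡⟨ ∑-*ˡ j F (λ a → r j (z ∸G a)) ⟩
          j * ∑ F (λ a → r j (z ∸G a)) ∎
        eqY : choose₂ j * S (λ x → # (B x) * Y x) ≡ choose₂ j * S (λ a → # (B a) * r₋₁ j ((z ∸G a) ∸G a))
        eqY = begin
          choose₂ j * S (λ x → # (B x) * Y x)
            ≡⟨ cong (choose₂ j *_) (∑-cong univ (λ x → sym (∑-*ˡ (# (B x)) univ (λ a → # (B a) * r₋₂ j (((z ∸G x) ∸G a) ∸G a))))) ⟩
          choose₂ j * S (λ x → S (λ a → # (B x) * (# (B a) * r₋₂ j (((z ∸G x) ∸G a) ∸G a))))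
            ≡⟨ cong (choose₂ j *_) (∑-swap univ univ (λ x a → # (B x) * (# (B a) * r₋₂ j (((z ∸G x) ∸G a) ∸G a)))) ⟩
          choose₂ j * S (λ a → S (λ x → # (B x) * (# (B a) * r₋₂ j (((z ∸G x) ∸G a) ∸G a))))
            ≡⟨ cong (choose₂ j *_) (∑-cong univ (λ a → trans (∑-cong univ (λ x → trans (*-swap (# (B x)) (# (B a)) (r₋₂ j (((z ∸G x) ∸G a) ∸G a)))
                 (cong (λ w → # (B a) * (# (B x) * r₋₂ j w)) (trans (cong (_∸G a) (-swap z x a)) (-swap (z ∸G a) x a)))))
                 (∑-*ˡ (# (B a)) univ (λ x → # (B x) * r₋₂ j (((z ∸G a) ∸G a) ∸G x))))) ⟩
          choose₂ j * S (λ a → # (B a) * S (λ x → # (B x) * r₋₂ j (((z ∸G a) ∸G a) ∸G x)))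
            ≡⟨ sym (∑-*ˡ (choose₂ j) univ (λ a → # (B a) * S (λ x → # (B x) * r₋₂ j (((z ∸G a) ∸G a) ∸G x)))) ⟩
          S (λ a → choose₂ j * (# (B a) * S (λ x → # (B x) * r₋₂ j (((z ∸G a) ∸G a) ∸G x))))
            ≡⟨ ∑-cong univ (λ a → trans (*-swap (choose₂ j) (# (B a)) (S (λ x → # (B x) * r₋₂ j (((z ∸G a) ∸G a) ∸G x))))
                 (trans (cong (# (B a) *_) (r₋₂-conv j ((z ∸G a) ∸G a))) (*-swap (# (B a)) (choose₂ j) (r₋₁ j ((z ∸G a) ∸G a))))) ⟩
          S (λ a → choose₂ j * (# (B a) * r₋₁ j ((z ∸G a) ∸G a)))
            ≡⟨ ∑-*ˡ (choose₂ j) univ (λ a → # (B a) * r₋₁ j ((z ∸G a) ∸G a)) ⟩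
          choose₂ j * S (λ a → # (B a) * r₋₁ j ((z ∸G a) ∸G a)) ∎

      ∑-δ≥1 : ∀ {F : List G} {x} → x ∈ F → 1 ≤ ∑ F (λ a → δ x a)
      ∑-δ≥1 {F} {x} i = ≤-trans (≤-reflexive (sym (δ-refl x))) (∑-term (λ a → δ x a) i)

    -- The tuples counted by r j z that meet F or repeat an element are counted by the excess.
    fresh : ∀ j z F → FreshTuple B F j z ⊎ r j z ≤ excess j F z
    fresh zero z F with z ≟G 𝟘
    ... | yes refl = inj₁ (freshTuple [] refl [] [] [] refl)
    ... | no _     = inj₂ z≤n
    -- The first element x joins the forbidden list of the remaining ones, so repetitions are
    -- handled together with F. The bounds add up by Pascal's rule for `choose₂`.
    fresh (suc j) z F = finish (∑-search {Found = FreshTuple B F (suc j) z} univ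
                             {λ x → # (B x) * r j (z ∸G x)} {λ x → first j F z x + rest j F z x}
                             (λ x → at x (x ∈? F) (B x) refl (fresh j (z ∸G x) (x ∷ F))))
      where
      extend : ∀ x → B x ≡ true → x ∉ F → FreshTuple B (x ∷ F) j (z ∸G x) → FreshTuple B F (suc j) z
      extend x x∈B x∉F (freshTuple xs size unique inside avoids total) = freshTuple (x ∷ xs) (cong suc size)
        (All.map (λ { y∉ refl → y∉ (here refl) }) avoids ∷ unique) (x∈B ∷ inside) (x∉F ∷ All.map (λ y∉ i → y∉ (there i)) avoids)
        (trans (cong (x ⊕_) total) (trans (⊕-comm x (z ∸G x)) (-⊕ z x)))
      at : ∀ x → Dec (x ∈ F) → ∀ t → B x ≡ t → FreshTuple B (x ∷ F) j (z ∸G x) ⊎ r j (z ∸G x) ≤ excess j (x ∷ F) (z ∸G x) →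
           FreshTuple B F (suc j) z ⊎ # t * r j (z ∸G x) ≤ first j F z x + # t * excess j (x ∷ F) (z ∸G x)
      at x (yes x∈F) t     _   _         = inj₂ (≤-trans (*-monoˡ-≤ (r j (z ∸G x)) (≤-trans (#≤1 t) (∑-δ≥1 x∈F))) (m≤m+n (first j F z x) _))
      at x (no x∉F)  true  x∈B (inj₁ ft) = inj₁ (extend x x∈B x∉F ft)
      at x (no x∉F)  t     _   (inj₂ le) = inj₂ (≤-trans (*-monoʳ-≤ (# t) le) (m≤n+m _ (first j F z x)))
      at x (no x∉F)  false _   (inj₁ _)  = inj₂ z≤n
      regroup : ∀ f j s c → f + ((j * s + j * f) + c * s) ≡ suc j * f + (c + j) * s
      regroup = solve-∀
      finish : FreshTuple B F (suc j) z ⊎ S (λ x → # (B x) * r j (z ∸G x)) ≤ S (λ x → first j F z x + rest j F z x) →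
               FreshTuple B F (suc j) z ⊎ r (suc j) z ≤ excess (suc j) F z
      finish (inj₁ found) = inj₁ found
      finish (inj₂ le)    = inj₂ (≤-trans le (≤-reflexive (trans (∑-+ univ (first j F z) (rest j F z))
                         (trans (cong₂ _+_ (first-total j F z) (rest-total j F z))
                           (regroup (∑ F (λ a → r j (z ∸G a))) j (S (λ x → # (B x) * r₋₁ j ((z ∸G x) ∸G x))) (choose₂ j))))))

    -- Meeting F fixes one of the 2 + K summands and leaves at most m (1 + K) ≤ b * m K choices; a
    -- repetition leaves b choices of the element and m K for the rest. This is why `Even` sets m K
    -- against the sums of 2 + K elements.
    fresh-or-few : ∀ K z F → FreshTuple B F (2 + K) z ⊎ r (2 + K) z ≤ ((2 + K) * length F + (2 + K) * (2 + K)) * (b * m K)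
    fresh-or-few K z F with fresh (2 + K) z F
    ... | inj₁ ft = inj₁ ft
    ... | inj₂ le = inj₂ (begin
      r (2 + K) z
        ≤⟨ le ⟩
      (2 + K) * ∑ F (λ a → r (1 + K) (z ∸G a)) + choose₂ (2 + K) * S (λ a → # (B a) * r K ((z ∸G a) ∸G a))
        ≤⟨ +-mono-≤ (*-monoʳ-≤ (2 + K) (≤-trans (∑-mono F (λ a → ≤-trans (r≤m (1 + K) (z ∸G a)) (m-suc K))) (≤-reflexive (∑-const F (b * m K)))))
             (*-mono-≤ (choose₂≤ (2 + K)) (≤-trans (∑-mono univ (λ a → *-monoʳ-≤ (# (B a)) (r≤m K ((z ∸G a) ∸G a)))) (≤-reflexive (∑-*ʳ (m K) univ (λ a → # (B a)))))) ⟩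
      (2 + K) * (length F * (b * m K)) + (2 + K) * (2 + K) * (b * m K)
        ≡⟨ regroup (2 + K) (length F) (b * m K) ⟩
      ((2 + K) * length F + (2 + K) * (2 + K)) * (b * m K) ∎)
      where
      open ≤-Reasoning
      regroup : ∀ k f t → k * (f * t) + k * k * t ≡ (k * f + k * k) * t
      regroup = solve-∀

    -- Adding elements one at a time, every sum of j chosen elements keeps few completions to a sum in χ.
    module Greedy (χ : G → Bool) (K : ℕ) (H : ℕ) (b>0 : 0 < b) (H>0 : 0 < H) where

      completions : ℕ → G → ℕ
      completions zero    v = # (χ v)
      completions (suc e) v = S (λ x → # (B x) * completions e (v ⊕ x))

      completions≡ : ∀ e v → completions e v ≡ S (λ z → r e z * # (χ (v ⊕ z)))
      completions≡ zero v = trans (cong (λ t → # (χ t)) (sym (⊕-idʳ v))) (sym (S-δ 𝟘 (λ z → # (χ (v ⊕ z)))))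
      completions≡ (suc e) v = begin
        S (λ x → # (B x) * completions e (v ⊕ x))
          ≡⟨ ∑-cong univ (λ x → cong (# (B x) *_) (completions≡ e (v ⊕ x))) ⟩
        S (λ x → # (B x) * S (λ z → r e z * # (χ ((v ⊕ x) ⊕ z))))
          ≡⟨ ∑-cong univ (λ x → trans (sym (∑-*ˡ (# (B x)) univ (λ z → r e z * # (χ ((v ⊕ x) ⊕ z)))))
               (∑-cong univ (λ z → trans (sym (*-assoc (# (B x)) (r e z) (# (χ ((v ⊕ x) ⊕ z))))) (cong (λ t → # (B x) * r e z * # (χ t)) (⊕-assoc v x z))))) ⟩
        S (λ x → S (λ z → # (B x) * r e z * # (χ (v ⊕ (x ⊕ z)))))
          ≡⟨ S-conv (λ x → # (B x)) (r e) (λ w → # (χ (v ⊕ w))) ⟩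
        S (λ z → r (suc e) z * # (χ (v ⊕ z))) ∎
        where open ≡-Reasoning

      sums : ℕ → List G → List G
      sums zero    as       = 𝟘 ∷ []
      sums (suc j) []       = []
      sums (suc j) (a ∷ as) = map (a ⊕_) (sums j as) ++ sums (suc j) as

      length-sums : ∀ j as → length (sums j as) ≤ (1 + length as) ^ j
      length-sums zero    as       = ≤-refl
      length-sums (suc j) []       = z≤n
      length-sums (suc j) (a ∷ as) = begin
        length (map (a ⊕_) (sums j as) ++ sums (suc j) as)
          ≡⟨ trans (length-++ (map (a ⊕_) (sums j as))) (cong (_+ length (sums (suc j) as)) (length-map (a ⊕_) (sums j as))) ⟩
        length (sums j as) + length (sums (suc j) as)
          ≤⟨ +-mono-≤ (length-sums j as) (length-sums (suc j) as) ⟩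
        (1 + length as) ^ j + (1 + length as) * (1 + length as) ^ j
          ≤⟨ *-monoʳ-≤ (2 + length as) (^-monoˡ-≤ j (n≤1+n (1 + length as))) ⟩
        (2 + length as) * (2 + length as) ^ j ∎
        where open ≤-Reasoning

      tag : ℕ → G → ℕ × G
      tag e v = e , v

      -- From `levels K 0` come all constraints on a new element x: v is a sum of chosen elements,
      -- and after v ⊕ x there are e elements left to add.
      levels : ℕ → ℕ → List G → List (ℕ × G)
      levels zero    j as = map (tag 0) (sums j as)
      levels (suc e) j as = map (tag (suc e)) (sums j as) ++ levels e (suc j) as

      length-levels : ∀ e j as → length (levels e j as) ≤ suc e * (1 + length as) ^ (e + j)
      length-levels zero    j as = ≤-trans (≤-reflexive (length-map (tag 0) (sums j as))) (≤-trans (length-sums j as) (≤-reflexive (sym (*-identityˡ _))))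
      length-levels (suc e) j as = begin
        length (map (tag (suc e)) (sums j as) ++ levels e (suc j) as)
          ≡⟨ trans (length-++ (map (tag (suc e)) (sums j as))) (cong (_+ length (levels e (suc j) as)) (length-map (tag (suc e)) (sums j as))) ⟩
        length (sums j as) + length (levels e (suc j) as)
          ≤⟨ +-mono-≤ (≤-trans (length-sums j as) (^-monoʳ-≤ (1 + length as) (m≤n+m j (suc e))))
               (≤-trans (length-levels e (suc j) as) (≤-reflexive (cong (λ t → suc e * (1 + length as) ^ t) (+-suc e j)))) ⟩
        suc (suc e) * (1 + length as) ^ (suc e + j) ∎
        where open ≤-Reasoning

      ∈-levels : ∀ e j as {e′ j′ v} → e′ + j′ ≡ e + j → j ≤ j′ → v ∈ sums j′ as → (e′ , v) ∈ levels e j as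
      ∈-levels zero j as {e′} {j′} eq j≤ i with ≤-antisym j≤ (≤-trans (m≤n+m j′ e′) (≤-reflexive eq))
      ... | refl with +-cancelʳ-≡ j e′ 0 eq
      ...   | refl = ∈-map⁺ (tag 0) i
      ∈-levels (suc e) j as {e′} {j′} eq j≤ i with j ≟ j′
      ... | yes refl with +-cancelʳ-≡ j e′ (suc e) eq
      ...   | refl = ∈-++⁺ˡ (∈-map⁺ (tag (suc e)) i)
      ∈-levels (suc e) j as {e′} {j′} eq j≤ i | no j≢ =
        ∈-++⁺ʳ (map (tag (suc e)) (sums j as)) (∈-levels e (suc j) as (trans eq (sym (+-suc e j))) (≤∧≢⇒< j≤ j≢) i)

      levels⁻ : ∀ e j as {e′ v} → (e′ , v) ∈ levels e j as → ∃ λ j′ → e′ + j′ ≡ e + j × v ∈ sums j′ as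
      levels⁻ zero j as i with ∈-map⁻ (tag 0) i
      ... | v , v∈ , refl = j , refl , v∈
      levels⁻ (suc e) j as i with ∈-++⁻ (map (tag (suc e)) (sums j as)) i
      ... | inj₁ i′ with ∈-map⁻ (tag (suc e)) i′
      ...   | v , v∈ , refl = j , refl , v∈
      levels⁻ (suc e) j as i | inj₂ i′ with levels⁻ e (suc j) as i′
      ... | j′ , eq , v∈ = j′ , trans eq (+-suc e j) , v∈

      -- The proportion of completions of v that end in χ is at most 1 / H ^ suc e. One factor H is
      -- spent for each element that gets fixed, and the last one forces χ v to be false at e = 0.
      Sparse : List G → Set
      Sparse as = ∀ e j → e + j ≡ suc K → ∀ {v} → v ∈ sums j as → H ^ suc e * completions e v ≤ b ^ e

      violates : ℕ × G → G → Bool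
      violates (e , v) x = ⌊ b ^ e <? H ^ suc e * completions e (v ⊕ x) ⌋

      markov : ∀ e v → H ^ suc (suc e) * completions (suc e) v ≤ b ^ suc e → H * S (λ x → # (B x) * # (violates (e , v) x)) ≤ b
      markov e v h = *-cancelʳ-≤ (H * viol) b (b ^ e) {{m^n≢0 b e {{>-nonZero b>0}}}} (begin
        H * viol * b ^ e
          ≡⟨ *-assoc H viol (b ^ e) ⟩
        H * (viol * b ^ e)
          ≡⟨ cong (H *_) (sym (∑-*ʳ (b ^ e) univ (λ x → # (B x) * # (violates (e , v) x)))) ⟩
        H * S (λ x → # (B x) * # (violates (e , v) x) * b ^ e)
          ≤⟨ *-monoʳ-≤ H (∑-mono univ point) ⟩
        H * S (λ x → H ^ suc e * (# (B x) * completions e (v ⊕ x)))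
          ≡⟨ trans (cong (H *_) (∑-*ˡ (H ^ suc e) univ (λ x → # (B x) * completions e (v ⊕ x)))) (sym (*-assoc H (H ^ suc e) (completions (suc e) v))) ⟩
        H ^ suc (suc e) * completions (suc e) v
          ≤⟨ h ⟩
        b * b ^ e ∎)
        where
        open ≤-Reasoning
        viol : ℕ
        viol = S (λ x → # (B x) * # (violates (e , v) x))
        point : ∀ x → # (B x) * # (violates (e , v) x) * b ^ e ≤ H ^ suc e * (# (B x) * completions e (v ⊕ x))
        point x = ≤-trans (≤-reflexive (*-assoc (# (B x)) (# (violates (e , v) x)) (b ^ e)))
          (≤-trans (*-monoʳ-≤ (# (B x)) (when (violates (e , v) x) (λ t → <⇒≤ (⌊⌋-true {d = b ^ e <? H ^ suc e * completions e (v ⊕ x)} t))))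
            (≤-reflexive (*-swap (# (B x)) (H ^ suc e) (completions e (v ⊕ x)))))

      -- By Markov each constraint excludes at most a proportion 1 / H of B, hence all of them
      -- together at most half of it; the elements already chosen make up less than half.
      extend : ∀ as → Sparse as → 2 * (suc K * (1 + length as) ^ suc K) ≤ H → 2 * length as < b →
               ∃ λ x → B x ≡ true × x ∉ as × Sparse (x ∷ as)
      extend as sparse H≥ b> = from (∑-<⇒∃ univ {λ x → # (B x) * bad x} {λ x → # (B x)} key)
        where
        open ≤-Reasoning
        pairs : List (ℕ × G)
        pairs = levels K 0 as
        bad : G → ℕ
        bad x = ∑ pairs (λ ev → # (violates ev x)) + ∑ as (λ a → δ x a)
        pairs≤ : 2 * length pairs ≤ H
        pairs≤ = ≤-trans (*-monoʳ-≤ 2 (≤-trans (length-levels K 0 as) (*-monoʳ-≤ (suc K)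
                   (^-monoʳ-≤ (1 + length as) (≤-trans (≤-reflexive (+-identityʳ K)) (n≤1+n K)))))) H≥
        viol-total : H * S (λ x → # (B x) * ∑ pairs (λ ev → # (violates ev x))) ≤ length pairs * b
        viol-total = begin
          H * S (λ x → # (B x) * ∑ pairs (λ ev → # (violates ev x)))
            ≡⟨ cong (H *_) (trans (∑-cong univ (λ x → sym (∑-*ˡ (# (B x)) pairs (λ ev → # (violates ev x))))) (∑-swap univ pairs (λ x ev → # (B x) * # (violates ev x)))) ⟩
          H * ∑ pairs (λ ev → S (λ x → # (B x) * # (violates ev x)))
            ≡⟨ sym (∑-*ˡ H pairs (λ ev → S (λ x → # (B x) * # (violates ev x)))) ⟩
          ∑ pairs (λ ev → H * S (λ x → # (B x) * # (violates ev x)))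
            ≤⟨ ∑-mono-∈ pairs each ⟩
          ∑ pairs (λ _ → b)
            ≡⟨ ∑-const pairs b ⟩
          length pairs * b ∎
          where
          each : ∀ {ev} → ev ∈ pairs → H * S (λ x → # (B x) * # (violates ev x)) ≤ b
          each {e , v} i with levels⁻ K 0 as i
          ... | j , eq , v∈ = markov e v (sparse (suc e) j (cong suc (trans eq (+-identityʳ K))) v∈)
        repeat-total : S (λ x → # (B x) * ∑ as (λ a → δ x a)) ≤ length as
        repeat-total = begin
          S (λ x → # (B x) * ∑ as (λ a → δ x a))
            ≤⟨ ∑-mono univ (λ x → ≤-trans (*-monoˡ-≤ (∑ as (λ a → δ x a)) (#≤1 (B x))) (≤-reflexive (*-identityˡ (∑ as (λ a → δ x a))))) ⟩
          S (λ x → ∑ as (λ a → δ x a))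
            ≡⟨ ∑-swap univ as (λ x a → δ x a) ⟩
          ∑ as (λ a → S (λ x → δ x a))
            ≡⟨ ∑-cong as (λ a → trans (∑-cong univ (λ x → sym (*-identityʳ (δ x a)))) (S-δ a (λ _ → 1))) ⟩
          ∑ as (λ _ → 1)
            ≡⟨ trans (∑-const as 1) (*-identityʳ (length as)) ⟩
          length as ∎
        key : S (λ x → # (B x) * bad x) < b
        key = *-cancelˡ-< (2 * H) _ _ (begin-strict
          2 * H * S (λ x → # (B x) * bad x)
            ≡⟨ cong (2 * H *_) (trans (∑-cong univ (λ x → *-distribˡ-+ (# (B x)) (∑ pairs (λ ev → # (violates ev x))) (∑ as (λ a → δ x a))))
                 (∑-+ univ (λ x → # (B x) * ∑ pairs (λ ev → # (violates ev x))) (λ x → # (B x) * ∑ as (λ a → δ x a)))) ⟩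
          2 * H * (S (λ x → # (B x) * ∑ pairs (λ ev → # (violates ev x))) + S (λ x → # (B x) * ∑ as (λ a → δ x a)))
            ≡⟨ split H _ _ ⟩
          2 * (H * S (λ x → # (B x) * ∑ pairs (λ ev → # (violates ev x)))) + H * (2 * S (λ x → # (B x) * ∑ as (λ a → δ x a)))
            ≤⟨ +-mono-≤ (*-monoʳ-≤ 2 viol-total) (*-monoʳ-≤ H (*-monoʳ-≤ 2 repeat-total)) ⟩
          2 * (length pairs * b) + H * (2 * length as)
            <⟨ +-mono-≤-< (≤-trans (≤-reflexive (sym (*-assoc 2 (length pairs) b))) (*-monoˡ-≤ b pairs≤)) (*-monoʳ-< H {{>-nonZero H>0}} b>) ⟩
          H * b + H * b
            ≡⟨ join H b ⟩
          2 * H * b ∎)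
          where
          split : ∀ H u v → 2 * H * (u + v) ≡ 2 * (H * u) + H * (2 * v)
          split = solve-∀
          join : ∀ H b → H * b + H * b ≡ 2 * H * b
          join = solve-∀
        from : (∃ λ x → x ∈ univ × # (B x) * bad x < # (B x)) → ∃ λ x → B x ≡ true × x ∉ as × Sparse (x ∷ as)
        from (x , _ , lt) = x , x∈B , x∉as , sparse′
          where
          unwrap : ∀ t {u} → # t * u < # t → t ≡ true × u ≡ 0
          unwrap true  {zero}  _  = refl , refl
          unwrap true  {suc u} (s≤s ())
          unwrap false ()
          x∈B : B x ≡ true
          x∈B = proj₁ (unwrap (B x) lt)
          bad≡0 : bad x ≡ 0
          bad≡0 = proj₂ (unwrap (B x) lt)
          x∉as : x ∉ as
          x∉as i = contradiction (<-≤-trans (≤-trans (∑-δ≥1 i) (m≤n+m _ (∑ pairs (λ ev → # (violates ev x))))) (≤-reflexive bad≡0)) (n≮n 0)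
          fine : ∀ e v → (e , v) ∈ pairs → H ^ suc e * completions e (v ⊕ x) ≤ b ^ e
          fine e v i with b ^ e <? H ^ suc e * completions e (v ⊕ x) | ∑-term (λ ev → # (violates ev x)) i
          ... | no ≮  | _ = ≮⇒≥ ≮
          ... | yes _ | h = contradiction (≤-trans h (≤-trans (m≤m+n _ (∑ as (λ a → δ x a))) (≤-reflexive bad≡0))) (n≮n 0)
          sparse′ : Sparse (x ∷ as)
          sparse′ e zero    eq i = sparse e 0 eq i
          sparse′ e (suc j) eq i with ∈-++⁻ (map (x ⊕_) (sums j as)) i
          ... | inj₂ i′ = sparse e (suc j) eq i′
          ... | inj₁ i′ with ∈-map⁻ (x ⊕_) i′
          ...   | u , u∈ , refl = subst (λ t → H ^ suc e * completions e t ≤ b ^ e) (⊕-comm u x)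
                   (fine e u (∈-levels K 0 as (trans (suc-injective (trans (sym (+-suc e j)) eq)) (sym (+-identityʳ K))) z≤n u∈))

      Built : ℕ → Set
      Built N = ∃ λ as → length as ≡ N × Unique as × All (λ x → B x ≡ true) as × Sparse as

      build : H ^ suc (suc K) * completions (suc K) 𝟘 ≤ b ^ suc K →
              ∀ N → 2 * (suc K * (1 + N) ^ suc K) ≤ H → 2 * N < b → Built N
      build few zero    H≥ b> = [] , refl , [] , [] , base
        where
        base : Sparse []
        base e zero    eq (here refl) = subst (λ e → H ^ suc e * completions e 𝟘 ≤ b ^ e) (trans (sym eq) (+-identityʳ e)) few
        base e (suc j) eq ()
      build few (suc N) H≥ b> = grow (build few N H≥′ b>′)
        where
        H≥′ : 2 * (suc K * (1 + N) ^ suc K) ≤ H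
        H≥′ = ≤-trans (*-monoʳ-≤ 2 (*-monoʳ-≤ (suc K) (^-monoˡ-≤ (suc K) (n≤1+n (1 + N))))) H≥
        b>′ : 2 * N < b
        b>′ = ≤-<-trans (*-monoʳ-≤ 2 (n≤1+n N)) b>
        grow : Built N → Built (suc N)
        grow (as , size , unique , inside , sparse) = add (extend as sparse
            (subst (λ n → 2 * (suc K * (1 + n) ^ suc K) ≤ H) (sym size) H≥′) (subst (λ n → 2 * n < b) (sym size) b>′))
          where
          add : (∃ λ x → B x ≡ true × x ∉ as × Sparse (x ∷ as)) → Built (suc N)
          add (x , x∈B , x∉as , sparse′) = x ∷ as , cong suc size , All.¬Any⇒All¬ as x∉as ∷ unique , x∈B ∷ inside , sparse′

      sums-fine : 2 ≤ H → ∀ {as} → Sparse as → ∀ {v} → v ∈ sums (suc K) as → χ v ≡ false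
      sums-fine H≥2 sparse {v} i = at (χ v) (sparse 0 (suc K) refl i)
        where
        at : ∀ t → H ^ 1 * # t ≤ 1 → t ≡ false
        at false _ = refl
        at true  h = contradiction (≤-trans H≥2 (≤-trans (≤-reflexive (sym (trans (*-identityʳ (H ^ 1)) (*-identityʳ H)))) h)) (<⇒≱ (s≤s (s≤s z≤n)))

      ∈-sums : ∀ as → Unique as → ∀ j xs → length xs ≡ j → Unique xs → All (_∈ as) xs → gsum xs ∈ sums j as
      ∈-sums as _ zero [] _ _ _ = here refl
      ∈-sums [] _ (suc j) (x ∷ xs) _ _ (() ∷ _)
      ∈-sums (a ∷ as) (a∉as ∷ u) (suc j) xs size unique inside = at (a ∈? xs)
        where
        at : Dec (a ∈ xs) → gsum xs ∈ sums (suc j) (a ∷ as)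
        at (no a∉xs) = ∈-++⁺ʳ (map (a ⊕_) (sums j as)) (∈-sums as u (suc j) xs size unique
          (All.tabulate (λ i → tail (λ { refl → a∉xs i }) (All.lookup inside i))))
          where
          tail : ∀ {y} → y ≢ a → y ∈ a ∷ as → y ∈ as
          tail y≢a (here refl) = contradiction refl y≢a
          tail y≢a (there i)   = i
        at (yes a∈xs) with remove a∈xs unique
        ... | ys , size′ , unique′ , sub , a∉ys , total , _ = ∈-++⁺ˡ (subst (_∈ map (a ⊕_) (sums j as)) (sym total)
          (∈-map⁺ (a ⊕_) (∈-sums as u j ys (suc-injective (trans (sym size′) size)) unique′
            (All.tabulate (λ {y} i → tail (λ { refl → a∉ys i }) (All.lookup inside (sub i)))))))
          where
          tail : ∀ {y} → y ≢ a → y ∈ a ∷ as → y ∈ as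
          tail y≢a (here refl) = contradiction refl y≢a
          tail y≢a (there i)   = i

-- Pools whose blocks can be exchanged

module Swaps (𝔾 : FinGroup) where
  open GroupSums 𝔾
  open Counts 𝔾
  open Claims 𝔾
  open Selection 𝔾

  Swappable : (G → Bool) → ℕ → ℕ → List G → Set
  Swappable A f K as = ∀ xs → length xs ≡ K → Unique xs → All (_∈ as) xs → ∀ F → length F ≤ f → FreshTuple A F K (gsum xs)

  Pool : (G → Bool) → ℕ → ℕ → ℕ → Set
  Pool A f k N = ∃ λ K → 2 + K ≤ k × ∃ λ as → length as ≡ N × Unique as × All (λ x → A x ≡ true) as × Swappable A f (2 + K) as

  -- Let χ be the sums with at most τ representations. There are at most ∣ supp (2 + K) ∣ τ tuples
  -- with such a sum, which evenness bounds by c X ^ 2 b ^ (1 + K). Since c and H ^ (3 + K) are at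
  -- most X and X ^ 4 ≤ b, this is the proportion at which the greedy selection may start; sums
  -- outside χ have fresh representations by `fresh-or-few`.
  even⇒pool : ∀ B K X ρ f N → Even B K X → ρ ^ ((5 + K) * (5 + K)) ≤ X → X ^ 4 ≤ ∣ B ∣ →
              1 + N ≤ ρ → 2 * (2 + K) ≤ ρ → (2 + K) * f + (2 + K) * (2 + K) ≤ ρ →
              ∃ λ as → length as ≡ N × Unique as × All (λ x → B x ≡ true) as × Swappable B f (2 + K) as
  even⇒pool B K X ρ f N even expo B≥ N≤ 4≤ c≤ = finish (Gr.build few N H≥ b>)
    where
    open Reps B
    c τ : ℕ
    c = (2 + K) * f + (2 + K) * (2 + K)
    τ = c * (b * m K)
    χ : G → Bool
    χ v = ⌊ r (2 + K) v ≤? τ ⌋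
    ρ≥2 : 2 ≤ ρ
    ρ≥2 = ≤-trans (m≤m*n 2 (2 + K)) 4≤
    instance
      ρ≢0 : NonZero ρ
      ρ≢0 = >-nonZero (<-≤-trans (s≤s z≤n) ρ≥2)
    power≤X : ∀ {e} → e ≤ (5 + K) * (5 + K) → ρ ^ e ≤ X
    power≤X h = ≤-trans (^-monoʳ-≤ ρ h) expo
    ρ≤X : ρ ≤ X
    ρ≤X = ≤-trans (≤-reflexive (sym (*-identityʳ ρ))) (power≤X (s≤s z≤n))
    instance
      X≢0 : NonZero X
      X≢0 = >-nonZero (<-≤-trans (<-≤-trans (s≤s z≤n) ρ≥2) ρ≤X)
    b>0 : 0 < b
    b>0 = <-≤-trans (m^n>0 X 4) B≥
    H : ℕ
    -- One factor ρ pays for 2 * (2 + K) and the others for (1 + N) ^ (2 + K).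
    H = ρ ^ (3 + K)
    H>0 : 0 < H
    H>0 = m^n>0 ρ (3 + K)
    -- `Greedy` deals with sums of one element more than its parameter.
    module Gr = Greedy B χ (suc K) H b>0 H>0
    H^≤X : H ^ (3 + K) ≤ X
    H^≤X = ≤-trans (≤-reflexive (^-*-assoc ρ (3 + K) (3 + K))) (power≤X (*-mono-≤ 3≤5 3≤5))
      where
      3≤5 : 3 + K ≤ 5 + K
      3≤5 = ≤-trans (n≤1+n (3 + K)) (n≤1+n (4 + K))
    H≥ : 2 * ((2 + K) * (1 + N) ^ (2 + K)) ≤ H
    H≥ = ≤-trans (≤-reflexive (sym (*-assoc 2 (2 + K) ((1 + N) ^ (2 + K))))) (*-mono-≤ 4≤ (^-monoˡ-≤ (2 + K) N≤))
    b> : 2 * N < b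
    b> = begin-strict
      2 * N                    ≤⟨ *-mono-≤ ρ≥2 (≤-trans (n≤1+n N) N≤) ⟩
      ρ * ρ                    <⟨ m<m+n (ρ * ρ) (>-nonZero⁻¹ (ρ * ρ) {{m*n≢0 ρ ρ}}) ⟩
      ρ * ρ + ρ * ρ            ≡⟨ cong (ρ * ρ +_) (sym (+-identityʳ (ρ * ρ))) ⟩
      2 * (ρ * ρ)              ≤⟨ *-mono-≤ (≤-trans ρ≥2 ρ≤X) (*-mono-≤ ρ≤X (≤-trans ρ≤X (m≤m*n X (X * 1) {{m*n≢0 X 1}}))) ⟩
      X ^ 4                    ≤⟨ B≥ ⟩
      b                        ∎
      where open ≤-Reasoning
    few : H ^ (3 + K) * Gr.completions (2 + K) 𝟘 ≤ b ^ (2 + K)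
    few = begin
      H ^ (3 + K) * Gr.completions (2 + K) 𝟘
        ≡⟨ cong (H ^ (3 + K) *_) (trans (Gr.completions≡ (2 + K) 𝟘) (∑-cong univ (λ z → cong (λ t → r (2 + K) z * # (χ t)) (⊕-idˡ z)))) ⟩
      H ^ (3 + K) * S (λ z → r (2 + K) z * # (χ z))
        ≤⟨ *-mono-≤ H^≤X (∑-mono univ (λ z → point (r (2 + K) z))) ⟩
      X * S (λ z → # (supp (2 + K) z) * τ)
        ≡⟨ cong (X *_) (∑-*ʳ τ univ (λ z → # (supp (2 + K) z))) ⟩
      X * (∣ supp (2 + K) ∣ * τ)
        ≡⟨ shape X ∣ supp (2 + K) ∣ c b (m K) ⟩
      X * (c * b * (m K * ∣ supp (2 + K) ∣))
        ≤⟨ *-monoʳ-≤ X (*-mono-≤ (*-monoˡ-≤ b (≤-trans c≤ ρ≤X)) even) ⟩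
      X * (X * b * (X * X * b ^ K))
        ≡⟨ shape′ X b (b ^ K) ⟩
      X ^ 4 * (b * b ^ K)
        ≤⟨ *-monoˡ-≤ (b * b ^ K) B≥ ⟩
      b ^ (2 + K) ∎
      where
      open ≤-Reasoning
      point : ∀ x → x * # ⌊ x ≤? τ ⌋ ≤ # (0 <ᵇ x) * τ
      point zero = z≤n
      point (suc x) with suc x ≤? τ
      ... | yes p = ≤-trans (≤-reflexive (*-identityʳ (suc x))) (≤-trans p (≤-reflexive (sym (*-identityˡ τ))))
      ... | no _  = ≤-trans (≤-reflexive (*-zeroʳ (suc x))) z≤n
      shape : ∀ X s c b m → X * (s * (c * (b * m))) ≡ X * (c * b * (m * s))
      shape = solve-∀
      shape′ : ∀ X b u → X * (X * b * (X * X * u)) ≡ X * (X * (X * (X * 1))) * (b * u)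
      shape′ = solve-∀
    H≥2 : 2 ≤ H
    H≥2 = ≤-trans ρ≥2 (m≤m*n ρ (ρ ^ (2 + K)) {{m^n≢0 ρ (2 + K)}})
    finish : Gr.Built N → ∃ λ as → length as ≡ N × Unique as × All (λ x → B x ≡ true) as × Swappable B f (2 + K) as
    finish (as , size , unique , inside , sparse) = as , size , unique , inside , swap
      where
      swap : Swappable B f (2 + K) as
      swap xs size′ unique′ inside′ F F≤ = from (fresh-or-few B K (gsum xs) F)
        where
        popular : ¬ r (2 + K) (gsum xs) ≤ τ
        popular le = true≢false (trans (sym (⌊⌋-yes le)) (Gr.sums-fine H≥2 sparse (Gr.∈-sums as unique (2 + K) xs size′ unique′ inside′)))
          where
          true≢false : true ≢ false
          true≢false ()
          ⌊⌋-yes : r (2 + K) (gsum xs) ≤ τ → χ (gsum xs) ≡ true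
          ⌊⌋-yes h with r (2 + K) (gsum xs) ≤? τ
          ... | yes _ = refl
          ... | no ¬h = contradiction h ¬h
        from : FreshTuple B F (2 + K) (gsum xs) ⊎ r (2 + K) (gsum xs) ≤ ((2 + K) * length F + (2 + K) * (2 + K)) * (b * m K) →
               FreshTuple B F (2 + K) (gsum xs)
        from (inj₁ ft) = ft
        from (inj₂ le) = contradiction (≤-trans le (*-monoˡ-≤ (b * m K) (+-monoˡ-≤ ((2 + K) * (2 + K)) (*-monoʳ-≤ (2 + K) F≤)))) popular

  -- Of the fifth power of X, one factor is lost in passing from A to B⁺ and four are used up by the
  -- selection.
  pool : ∀ I (A : G → Bool) ρ X f N → C₀ ≤ ρ → X ≡ ρ ^ power I → length univ ≤ X ^ I → X ^ 5 ≤ ∣ A ∣ →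
         1 + N ≤ ρ → 2 * Kmax I ≤ ρ → Kmax I * f + Kmax I * Kmax I ≤ ρ → Pool A f (Kmax I) N
  pool I A ρ X f N C₀≤ρ X≡ univ≤ A≥ N≤ 2k≤ kf≤ = from (claim I A ρ X C₀≤ρ X≡ 2X≤ initial)
    where
    ρ≥2 : 2 ≤ ρ
    ρ≥2 = ≤-trans C₀≥2 C₀≤ρ
    instance
      ρ≢0 : NonZero ρ
      ρ≢0 = >-nonZero (<-≤-trans (s≤s z≤n) ρ≥2)
      X≢0 : NonZero X
      X≢0 = subst NonZero (sym X≡) (m^n≢0 ρ (power I))
    2X≤ : X + X ≤ ∣ A ∣ * ρ
    2X≤ = ≤-trans (≤-reflexive (trans (cong (X +_) (sym (+-identityʳ X))) (*-comm 2 X))) (*-mono-≤ (≤-trans (m≤m*n X (X ^ 4) {{m^n≢0 X 4}}) A≥) ρ≥2)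
    initial : ∣ A ∣ ^ reach I ≤ X ^ I * Reps.m A (reach I)
    initial = ≤-trans (Reps.b^≤ A (reach I)) (*-monoˡ-≤ (Reps.m A (reach I)) univ≤)
    from : (∃ λ B⁺ → B⁺ ⊆ᵇ A × ∣ A ∣ * ρ ≤ ∣ B⁺ ∣ * X × ∃ λ K → 2 + K ≤ Kmax I × Even B⁺ K X × ρ ^ ((5 + K) * (5 + K)) ≤ X) → Pool A f (Kmax I) N
    from (B⁺ , B⁺⊆A , large , K , K≤ , even , expo) = widen (even⇒pool B⁺ K X ρ f N even expo B⁺≥ N≤
        (≤-trans (*-monoʳ-≤ 2 K≤) 2k≤) (≤-trans (+-mono-≤ (*-monoˡ-≤ f K≤) (*-mono-≤ K≤ K≤)) kf≤))
      where
      B⁺≥ : X ^ 4 ≤ ∣ B⁺ ∣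
      B⁺≥ = *-cancelʳ-≤ (X ^ 4) ∣ B⁺ ∣ X (≤-trans (≤-reflexive (*-comm (X ^ 4) X)) (≤-trans A≥ (≤-trans (m≤m*n ∣ A ∣ ρ) large)))
      widen : (∃ λ as → length as ≡ N × Unique as × All (λ x → B⁺ x ≡ true) as × Swappable B⁺ f (2 + K) as) → Pool A f (Kmax I) N
      widen (as , size , unique , inside , swap) = K , K≤ , as , size , unique , All.map (λ {x} → B⁺⊆A x) inside , swap′
        where
        swap′ : Swappable A f (2 + K) as
        swap′ xs size′ unique′ inside′ F F≤ = freshTuple tuple size″ unique″ (All.map (λ {x} → B⁺⊆A x) inside″) avoids total
          where open FreshTuple (swap xs size′ unique′ inside′ F F≤) renaming (size to size″; unique to unique″; inside to inside″)

-- Flattening a multiset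

∑-++ : ∀ {A : Set} (xs ys : List A) (f : A → ℕ) → ∑ (xs ++ ys) f ≡ ∑ xs f + ∑ ys f
∑-++ []       ys f = refl
∑-++ (x ∷ xs) ys f = trans (cong (f x +_) (∑-++ xs ys f)) (sym (+-assoc (f x) (∑ xs f) (∑ ys f)))

length≡∑ : ∀ {A : Set} (xs : List A) → length xs ≡ ∑ xs (λ _ → 1)
length≡∑ xs = sym (trans (∑-const xs 1) (*-identityʳ (length xs)))

∑-≤⊎∃ : ∀ {A : Set} (xs : List A) (f : A → ℕ) c → (∀ {x} → x ∈ xs → f x ≤ c) ⊎ ∃ λ x → x ∈ xs × c < f x
∑-≤⊎∃ [] f c = inj₁ (λ ())
∑-≤⊎∃ (x ∷ xs) f c with c <? f x | ∑-≤⊎∃ xs f c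
... | yes lt | _ = inj₂ (x , here refl , lt)
... | no _   | inj₂ (y , i , lt) = inj₂ (y , there i , lt)
... | no ≮   | inj₁ h = inj₁ λ { (here refl) → ≮⇒≥ ≮ ; (there i) → h i }

-- ℓ is subtracted until at most e + T is left. A single step is at most T, so it cannot jump below
-- e. The argument k only serves the recursion.
reduction : ∀ e T ℓ → 1 ≤ ℓ → ℓ ≤ T → ∀ k n → n ≤ k → ∃ λ a → a * ℓ ≤ n × n ∸ a * ℓ ≤ e + T × (e + T < n → e ≤ n ∸ a * ℓ)
reduction e T ℓ 1≤ℓ ℓ≤T k n n≤k with n ≤? e + T
... | yes n≤ = 0 , z≤n , n≤ , λ lt → contradiction n≤ (<⇒≱ lt)
reduction e T ℓ 1≤ℓ ℓ≤T zero    n n≤k | no ¬n≤ = contradiction (≤-trans n≤k z≤n) ¬n≤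
reduction e T ℓ 1≤ℓ ℓ≤T (suc k) n n≤k | no ¬n≤ = step (n ∸ ℓ ≤? e + T) (reduction e T ℓ 1≤ℓ ℓ≤T k (n ∸ ℓ) n∸ℓ≤k)
  where
  Goal : Set
  Goal = ∃ λ a → a * ℓ ≤ n × n ∸ a * ℓ ≤ e + T × (e + T < n → e ≤ n ∸ a * ℓ)
  T<n : e + T < n
  T<n = ≰⇒> ¬n≤
  ℓ≤n : ℓ ≤ n
  ℓ≤n = ≤-trans ℓ≤T (≤-trans (m≤n+m T e) (<⇒≤ T<n))
  e≤ : e ≤ n ∸ ℓ
  e≤ = ≤-trans (≤-reflexive (sym (m+n∸n≡m e T))) (≤-trans (∸-monoˡ-≤ T (<⇒≤ T<n)) (∸-monoʳ-≤ n ℓ≤T))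
  n∸ℓ≤k : n ∸ ℓ ≤ k
  n∸ℓ≤k = ≤-trans (∸-monoʳ-≤ n 1≤ℓ) (∸-monoˡ-≤ 1 n≤k)
  step : Dec (n ∸ ℓ ≤ e + T) → (∃ λ a → a * ℓ ≤ n ∸ ℓ × n ∸ ℓ ∸ a * ℓ ≤ e + T × (e + T < n ∸ ℓ → e ≤ n ∸ ℓ ∸ a * ℓ)) → Goal
  step (yes small) _ = 1 , ≤-trans (≤-reflexive (*-identityˡ ℓ)) ℓ≤n ,
    subst (λ t → n ∸ t ≤ e + T) (sym (*-identityˡ ℓ)) small , λ _ → subst (λ t → e ≤ n ∸ t) (sym (*-identityˡ ℓ)) e≤
  step (no large) (a , a≤ , ≤c , e≤′) = suc a , ≤-trans (+-monoʳ-≤ ℓ a≤) (≤-reflexive (m+[n∸m]≡n ℓ≤n)) ,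
    subst (_≤ e + T) (∸-+-assoc n ℓ (a * ℓ)) ≤c , λ _ → subst (e ≤_) (∸-+-assoc n ℓ (a * ℓ)) (e≤′ (≰⇒> large))

module Congruence (p : ℕ) .{{_ : NonZero p}} where

  infix 4 _≈_
  _≈_ : ℕ → ℕ → Set
  a ≈ b = a % p ≡ b % p

  ≈-+ : ∀ {a b c d} → a ≈ b → c ≈ d → a + c ≈ b + d
  ≈-+ {a} {b} {c} {d} e f = trans (%-distribˡ-+ a c p) (trans (cong₂ (λ u v → (u + v) % p) e f) (sym (%-distribˡ-+ b d p)))

  ≈-* : ∀ k {a b} → a ≈ b → k * a ≈ k * b
  ≈-* k {a} {b} e = trans (%-distribˡ-* k a p) (trans (cong (λ v → ((k % p) * v) % p) e) (sym (%-distribˡ-* k b p)))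

  ≈-∑ : ∀ {A : Set} (xs : List A) {f g : A → ℕ} → (∀ x → f x ≈ g x) → ∑ xs f ≈ ∑ xs g
  ≈-∑ []       h = refl
  ≈-∑ (x ∷ xs) {f} {g} h = ≈-+ {f x} {g x} (h x) (≈-∑ xs h)

module Spreading (𝔾 : FinGroup) (p : ℕ) .{{_ : NonZero p}} (I : Set) (φ : I → FinGroup.G 𝔾 → ℕ) where
  open GroupSums 𝔾
  open Congruence p
  open DecMembership _≟G_ using (_∈?_)

  record Split (T : ℕ) (Ok : G → Set) (x : G) : Set where
    field
      parts    : List G
      nonempty : 1 ≤ length parts
      short    : length parts ≤ T
      ok       : All Ok parts
      balance  : ∀ i → length parts * φ i x ≈ ∑ parts (φ i)

  weaken : ∀ {T Ok Ok′ x} → (∀ {y} → Ok y → Ok′ y) → Split T Ok x → Split T Ok′ x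
  weaken f s = record { parts = parts ; nonempty = nonempty ; short = short ; ok = All.map f ok ; balance = balance }
    where open Split s

  remove₁ : G → List G → List G
  remove₁ y = filter (λ x → ¬? (x ≟G y))

  remove₁-length : ∀ y xs → Unique xs → length xs ≤ 1 + length (remove₁ y xs)
  remove₁-length y []       _ = z≤n
  remove₁-length y (x ∷ xs) (x∉ ∷ u) with x ≟G y
  ... | yes refl = s≤s (≤-reflexive (sym (cong length (filter-all (λ x → ¬? (x ≟G y)) (All.map (λ x≢ e → x≢ (sym e)) x∉)))))
  ... | no _     = s≤s (remove₁-length y xs u)

  removeAll : List G → List G → List G
  removeAll []       xs = xs
  removeAll (y ∷ ys) xs = removeAll ys (remove₁ y xs)

  removeAll-unique : ∀ ys {xs} → Unique xs → Unique (removeAll ys xs)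
  removeAll-unique []       u = u
  removeAll-unique (y ∷ ys) u = removeAll-unique ys (Unique.filter⁺ (λ x → ¬? (x ≟G y)) u)

  removeAll-length : ∀ ys xs → Unique xs → length xs ≤ length ys + length (removeAll ys xs)
  removeAll-length []       xs u = ≤-refl
  removeAll-length (y ∷ ys) xs u = ≤-trans (remove₁-length y xs u)
    (s≤s (removeAll-length ys (remove₁ y xs) (Unique.filter⁺ (λ x → ¬? (x ≟G y)) u)))

  removeAll⁻ : ∀ ys {xs z} → z ∈ removeAll ys xs → z ∈ xs × z ∉ ys
  removeAll⁻ []       i = i , λ ()
  removeAll⁻ (y ∷ ys) i with removeAll⁻ ys i
  ... | i′ , z∉ with ∈-filter⁻ (λ x → ¬? (x ≟G y)) i′
  ...   | i″ , z≢y = i″ , λ { (here e) → z≢y e ; (there j) → z∉ j }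

  exceeds : ∀ ys xs → Unique xs → length ys < length xs → ∃ λ z → z ∈ xs × z ∉ ys
  exceeds ys xs u lt = from (removeAll ys xs) (λ i → removeAll⁻ ys {xs} i) (removeAll-length ys xs u)
    where
    from : ∀ zs → (∀ {z} → z ∈ zs → z ∈ xs × z ∉ ys) → length xs ≤ length ys + length zs → ∃ λ z → z ∈ xs × z ∉ ys
    from []       _ h = contradiction (≤-trans h (≤-reflexive (+-identityʳ (length ys)))) (<⇒≱ lt)
    from (z ∷ zs) f _ = z , f (here refl)

  Relations : ℕ → ℕ → Set
  Relations Γ T = ∀ X → Unique X → Γ < length X → ∃ λ x → x ∈ X × Split T (λ w → w ∈ X × w ≢ x) x

  module _ (Γ T : ℕ) (relations : Relations Γ T) where

    -- The parts avoid all of `chosen`, not just the element that they replace: weight that leaves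
    -- the chosen elements must not return to them.
    record Disjoint (s : ℕ) (X : List G) : Set where
      field
        chosen  : List G
        unique  : Unique chosen
        size    : length chosen ≡ s
        inside  : ∀ {x} → x ∈ chosen → x ∈ X
        splits  : ∀ {x} → x ∈ chosen → Split T (λ w → w ∈ X × w ∉ chosen) x

    -- Each chosen element is removed together with its at most T parts before the next choice. So
    -- later choices avoid earlier parts, and later parts avoid earlier choices; the price is 1 + T
    -- points per choice.
    disjoint : ∀ s X → Unique X → s * (1 + T) + Γ ≤ length X → Disjoint s X
    disjoint zero    X u h = record { chosen = [] ; unique = [] ; size = refl ; inside = λ () ; splits = λ () }
    disjoint (suc s) X u h = from (relations X u (<-≤-trans (s≤s (m≤n+m Γ (T + s * (1 + T)))) h))
      where
      from : (∃ λ x → x ∈ X × Split T (λ w → w ∈ X × w ≢ x) x) → Disjoint (suc s) X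
      from (x , x∈ , sp) = record
        { chosen = x ∷ D.chosen
        ; unique = All.tabulate (λ {y} i e → proj₂ (removeAll⁻ used {X} (D.inside i)) (here (sym e))) ∷ D.unique
        ; size   = cong suc D.size
        ; inside = λ { (here refl) → x∈ ; (there i) → proj₁ (removeAll⁻ used {X} (D.inside i)) }
        ; splits = λ { (here refl) → first
                     ; (there i) → weaken (λ { (w∈ , w∉) → proj₁ (removeAll⁻ used {X} w∈) ,
                          λ { (here e) → proj₂ (removeAll⁻ used {X} w∈) (here e) ; (there j) → w∉ j } }) (D.splits i) } }
        where
        open Split sp
        used : List G
        used = x ∷ parts
        Y : List G
        Y = removeAll used X
        Y-large : s * (1 + T) + Γ ≤ length Y
        Y-large = +-cancelˡ-≤ (1 + T) _ _ (≤-trans (≤-trans (≤-reflexive (sym (+-assoc (1 + T) (s * (1 + T)) Γ))) h)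
          (≤-trans (removeAll-length used X u) (+-monoˡ-≤ (length Y) (s≤s short))))
        module D = Disjoint (disjoint s Y (removeAll-unique used u) Y-large)
        first : Split T (λ w → w ∈ X × w ∉ x ∷ D.chosen) x
        first = record { parts = parts ; nonempty = nonempty ; short = short ; balance = balance
          ; ok = All.tabulate (λ {w} i → proj₁ (All.lookup ok i) ,
              λ { (here e) → proj₂ (All.lookup ok i) e ; (there j) → proj₂ (removeAll⁻ used {X} (D.inside j)) (there i) }) }

    size : ℕ → ℕ → ℕ
    size zero    s = s
    size (suc t) s = size t (s * (1 + T) + Γ)

    size≤ : ∀ t s → size t s ≤ (s + Γ) * (2 + T) ^ t
    size≤ zero    s = ≤-trans (m≤m+n s Γ) (≤-reflexive (sym (*-identityʳ (s + Γ))))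
    size≤ (suc t) s = ≤-trans (size≤ t (s * (1 + T) + Γ)) (≤-trans (*-monoˡ-≤ ((2 + T) ^ t)
        (≤-trans (m≤m+n (s * (1 + T) + Γ + Γ) (s + T * Γ)) (≤-reflexive (shape s T Γ)))) (≤-reflexive (*-assoc (s + Γ) (2 + T) ((2 + T) ^ t))))
      where
      shape : ∀ s T Γ → s * (1 + T) + Γ + Γ + (s + T * Γ) ≡ (s + Γ) * (2 + T)
      shape = solve-∀

    module _ (e : ℕ) (A⋆ : List G) where

      c : ℕ
      c = e + T

      -- The total has to be exact because p elements are wanted, while moments matter only modulo
      -- p. `below` drives the induction: where ν vanishes on the layer X, no weight arrives, so the
      -- weight kept there is not increased.
      record Flat (X : List G) (ν : G → ℕ) : Set where
        field
          μ       : G → ℕ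
          μ≤c     : ∀ x → μ x ≤ c
          total   : S μ ≡ S ν
          moment  : ∀ i → S (λ x → μ x * φ i x) ≈ S (λ x → ν x * φ i x)
          support : ∀ x → 0 < μ x → x ∈ A⋆
          below   : ∀ {x} → x ∈ X → μ x ≤ ν x

      -- As long as some atom is heavier than c, a layer retains at least e, so t layers take care
      -- of a surplus of t * e over c.
      Flattens : ℕ → List G → Set
      Flattens t X = ∀ ν → (∀ x → 0 < ν x → x ∈ X) → S ν ≤ c + t * e → Flat X ν

      unchanged : ∀ {X} → (∀ {x} → x ∈ X → x ∈ A⋆) → ∀ ν → (∀ x → 0 < ν x → x ∈ X) → (∀ x → ν x ≤ c) → Flat X ν
      unchanged sub ν supp h = record { μ = ν ; μ≤c = h ; total = refl ; moment = λ i → refl ; support = λ x h → sub (supp x h) ; below = λ _ → ≤-refl }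

      flattens-zero : ∀ {X} → (∀ {x} → x ∈ X → x ∈ A⋆) → Flattens 0 X
      flattens-zero sub ν supp h = unchanged sub ν supp (λ x → ≤-trans (∑-term ν (univ-all x)) (≤-trans h (≤-reflexive (+-identityʳ c))))

      -- A heavy atom keeps between e and c of its weight and passes the rest on to the next layer, where X′ is avoided.
      flattens-suc : ∀ t {X X′} → (∀ {x} → x ∈ X′ → x ∈ X) → (∀ {x} → x ∈ X → x ∈ A⋆) →
                     (∀ {x} → x ∈ X′ → Split T (λ w → w ∈ X × w ∉ X′) x) → Flattens t X → Flattens (suc t) X′
      flattens-suc t {X} {X′} X′⊆X X⊆A splits IH ν supp h = decide (∑-≤⊎∃ univ ν c)
        where
        record Plan (x : G) : Set where
          field
            a       : ℕ
            parts   : List G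
            used≤   : a * length parts ≤ ν x
            kept≤   : ν x ∸ a * length parts ≤ c
            kept≥   : c < ν x → e ≤ ν x ∸ a * length parts
            ok      : ∀ {w} → w ∈ parts → w ∈ X × w ∉ X′
            balance : ∀ i → a * ∑ parts (φ i) ≈ a * length parts * φ i x
        plan : ∀ x → Plan x
        plan x with x ∈? X′
        ... | no x∉ = record { a = 0 ; parts = [] ; used≤ = z≤n ; kept≤ = ≤-trans (≤-reflexive ν≡0) z≤n
                ; kept≥ = λ lt → contradiction (<-≤-trans (≤-<-trans z≤n lt) (≤-reflexive ν≡0)) (n≮n 0) ; ok = λ () ; balance = λ i → refl }
          where
          ν≡0 : ν x ≡ 0
          ν≡0 = n≤0⇒n≡0 (≮⇒≥ (λ lt → x∉ (supp x lt)))
        ... | yes x∈ = from (reduction e T (length parts) nonempty short (ν x) (ν x) ≤-refl)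
          where
          open Split (splits x∈)
          from : (∃ λ a → a * length parts ≤ ν x × ν x ∸ a * length parts ≤ c × (c < ν x → e ≤ ν x ∸ a * length parts)) → Plan x
          from (a , used≤ , kept≤ , kept≥) = record { a = a ; parts = parts ; used≤ = used≤ ; kept≤ = kept≤ ; kept≥ = kept≥
            ; ok = All.lookup ok ; balance = λ i → trans (sym (≈-* a (balance i))) (cong (_% p) (sym (*-assoc a (length parts) (φ i x)))) }
        module P (x : G) = Plan (plan x)
        used kept ν′ : G → ℕ
        used x = P.a x * length (P.parts x)
        kept x = ν x ∸ used x
        ν′ z = S (λ x → P.a x * ∑ (P.parts x) (λ w → δ z w))
        kept+used : ∀ x → kept x + used x ≡ ν x
        kept+used x = m∸n+n≡m (P.used≤ x)
        ν′-sum : ∀ (f : G → ℕ) → S (λ z → ν′ z * f z) ≡ S (λ x → P.a x * ∑ (P.parts x) f)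
        ν′-sum f = begin
          S (λ z → ν′ z * f z)
            ≡⟨ ∑-cong univ (λ z → sym (∑-*ʳ (f z) univ (λ x → P.a x * ∑ (P.parts x) (λ w → δ z w)))) ⟩
          S (λ z → S (λ x → P.a x * ∑ (P.parts x) (λ w → δ z w) * f z))
            ≡⟨ ∑-swap univ univ (λ z x → P.a x * ∑ (P.parts x) (λ w → δ z w) * f z) ⟩
          S (λ x → S (λ z → P.a x * ∑ (P.parts x) (λ w → δ z w) * f z))
            ≡⟨ ∑-cong univ (λ x → trans (∑-cong univ (λ z → trans (*-assoc (P.a x) (∑ (P.parts x) (λ w → δ z w)) (f z)) (cong (P.a x *_) (sym (∑-*ʳ (f z) (P.parts x) (λ w → δ z w))))))
                 (trans (∑-*ˡ (P.a x) univ (λ z → ∑ (P.parts x) (λ w → δ z w * f z))) (cong (P.a x *_) (trans (∑-swap univ (P.parts x) (λ z w → δ z w * f z)) (∑-cong (P.parts x) (λ w → S-δ w f)))))) ⟩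
          S (λ x → P.a x * ∑ (P.parts x) f) ∎
          where open ≡-Reasoning
        ν′-total : S ν′ ≡ S used
        ν′-total = trans (∑-cong univ (λ z → sym (*-identityʳ (ν′ z)))) (trans (ν′-sum (λ _ → 1)) (∑-cong univ (λ x → cong (P.a x *_) (sym (length≡∑ (P.parts x))))))
        kept+ν′ : S kept + S ν′ ≡ S ν
        kept+ν′ = trans (cong (S kept +_) ν′-total) (trans (sym (∑-+ univ kept used)) (∑-cong univ kept+used))
        ν′-supp : ∀ z → 0 < ν′ z → z ∈ X × z ∉ X′
        ν′-supp z lt with ∑->0⇒∃ univ {λ x → P.a x * ∑ (P.parts x) (λ w → δ z w)} lt
        ... | x , _ , lt′ with ∑->0⇒∃ (P.parts x) {λ w → δ z w} (proj₂ (0<*⇒ (P.a x) (∑ (P.parts x) (λ w → δ z w)) lt′))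
        ...   | w , w∈ , lt″ = at (z ≟G w)
          where
          at : Dec (z ≡ w) → z ∈ X × z ∉ X′
          at (yes refl) = P.ok x w∈
          at (no z≢w)   = contradiction (subst (0 <_) (δ-≢ z≢w) lt″) (n≮n 0)
        decide : (∀ {x} → x ∈ univ → ν x ≤ c) ⊎ (∃ λ x → x ∈ univ × c < ν x) → Flat X′ ν
        decide (inj₁ light) = unchanged (λ i → X⊆A (X′⊆X i)) ν supp (λ x → light (univ-all x))
        decide (inj₂ (y , _ , heavy)) = record
          { μ = λ x → kept x + M.μ x
          ; μ≤c = λ x → at x (x ∈? X′) (λ x∈ → P.kept≤ x) (M.μ≤c x)
          ; total = trans (∑-+ univ kept M.μ) (trans (cong (S kept +_) M.total) kept+ν′)
          ; moment = moment′
          ; support = λ x lt → where-supp x (x ∈? X′) lt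
          ; below = λ {x} x∈ → ≤-trans (≤-reflexive (trans (cong (kept x +_) (μ′≡0 x∈)) (+-identityʳ (kept x)))) (m∸n≤m (ν x) (used x)) }
          where
          S-ν′ : S ν′ ≤ c + t * e
          S-ν′ = +-cancelˡ-≤ e _ _ (begin
            e + S ν′              ≤⟨ +-monoˡ-≤ (S ν′) (≤-trans (P.kept≥ y heavy) (∑-term kept (univ-all y))) ⟩
            S kept + S ν′         ≡⟨ kept+ν′ ⟩
            S ν                   ≤⟨ h ⟩
            c + suc t * e         ≡⟨ shape c e (t * e) ⟩
            e + (c + t * e)       ∎)
            where
            open ≤-Reasoning
            shape : ∀ c e u → c + (e + u) ≡ e + (c + u)
            shape = solve-∀
          module M = Flat (IH ν′ (λ z lt → proj₁ (ν′-supp z lt)) S-ν′)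
          μ′≡0 : ∀ {x} → x ∈ X′ → M.μ x ≡ 0
          μ′≡0 {x} x∈ = n≤0⇒n≡0 (≤-trans (M.below (X′⊆X x∈)) (≮⇒≥ (λ lt → proj₂ (ν′-supp x lt) x∈)))
          kept≡0 : ∀ {x} → x ∉ X′ → kept x ≡ 0
          kept≡0 {x} x∉ = n≤0⇒n≡0 (≤-trans (m∸n≤m (ν x) (used x)) (≮⇒≥ (λ lt → x∉ (supp x lt))))
          at : ∀ x → Dec (x ∈ X′) → (x ∈ X′ → kept x ≤ c) → M.μ x ≤ c → kept x + M.μ x ≤ c
          at x (yes x∈) f _ = ≤-trans (≤-reflexive (trans (cong (kept x +_) (μ′≡0 x∈)) (+-identityʳ (kept x)))) (f x∈)
          at x (no x∉)  _ g = ≤-trans (≤-reflexive (cong (_+ M.μ x) (kept≡0 x∉))) g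
          where-supp : ∀ x → Dec (x ∈ X′) → 0 < kept x + M.μ x → x ∈ A⋆
          where-supp x (yes x∈) _  = X⊆A (X′⊆X x∈)
          where-supp x (no x∉)  lt = M.support x (subst (λ t → 0 < t + M.μ x) (kept≡0 x∉) lt)
          moment′ : ∀ i → S (λ x → (kept x + M.μ x) * φ i x) ≈ S (λ x → ν x * φ i x)
          moment′ i = begin
            S (λ x → (kept x + M.μ x) * φ i x) % p
              ≡⟨ cong (_% p) (trans (∑-cong univ (λ x → *-distribʳ-+ (φ i x) (kept x) (M.μ x))) (∑-+ univ (λ x → kept x * φ i x) (λ x → M.μ x * φ i x))) ⟩
            (S (λ x → kept x * φ i x) + S (λ x → M.μ x * φ i x)) % p
              ≡⟨ ≈-+ {S (λ x → kept x * φ i x)} {_} {S (λ x → M.μ x * φ i x)} refl (M.moment i) ⟩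
            (S (λ x → kept x * φ i x) + S (λ x → ν′ x * φ i x)) % p
              ≡⟨ cong (λ t → (S (λ x → kept x * φ i x) + t) % p) (ν′-sum (φ i)) ⟩
            (S (λ x → kept x * φ i x) + S (λ x → P.a x * ∑ (P.parts x) (φ i))) % p
              ≡⟨ ≈-+ {S (λ x → kept x * φ i x)} {_} {S (λ x → P.a x * ∑ (P.parts x) (φ i))} refl (≈-∑ univ (λ x → P.balance x i)) ⟩
            (S (λ x → kept x * φ i x) + S (λ x → used x * φ i x)) % p
              ≡⟨ cong (_% p) (trans (sym (∑-+ univ (λ x → kept x * φ i x) (λ x → used x * φ i x)))
                   (∑-cong univ (λ x → trans (sym (*-distribʳ-+ (φ i x) (kept x) (used x))) (cong (_* φ i x) (kept+used x))))) ⟩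
            S (λ x → ν x * φ i x) % p ∎
            where open ≡-Reasoning

      record Chain (t s : ℕ) : Set where
        field
          layer    : List G
          unique   : Unique layer
          size≡    : length layer ≡ s
          inside   : ∀ {x} → x ∈ layer → x ∈ A⋆
          flattens : Flattens t layer

      chain : Unique A⋆ → ∀ t s → length A⋆ ≡ size t s → Chain t s
      chain u zero    s eq = record { layer = A⋆ ; unique = u ; size≡ = eq ; inside = λ i → i ; flattens = flattens-zero (λ i → i) }
      chain u (suc t) s eq = record { layer = D.chosen ; unique = D.unique ; size≡ = D.size ; inside = λ i → Ch.inside (D.inside i)
        ; flattens = flattens-suc t D.inside Ch.inside D.splits Ch.flattens }
        where
        module Ch = Chain (chain u t (s * (1 + T) + Γ) eq)
        module D = Disjoint (disjoint s Ch.layer Ch.unique (≤-reflexive (sym Ch.size≡)))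

      record Flat₀ : Set where
        field
          μ       : G → ℕ
          μ≤c     : ∀ x → μ x ≤ c
          total   : S μ ≡ p
          moment  : ∀ i → S (λ x → μ x * φ i x) ≈ 0
          support : ∀ x → 0 < μ x → x ∈ A⋆

      flat : Unique A⋆ → ∀ t → p ≤ c + t * e → length A⋆ ≡ size t 1 → Flat₀
      flat u t p≤ eq = from (Ch.layer) Ch.size≡ Ch.flattens
        where
        module Ch = Chain (chain u t 1 eq)
        from : ∀ X → length X ≡ 1 → Flattens t X → Flat₀
        from (x ∷ []) refl fl = record { μ = F.μ ; μ≤c = F.μ≤c ; total = trans F.total S-ν ; support = F.support
            ; moment = λ i → trans (F.moment i) (trans (cong (_% p) (trans (∑-cong univ (λ z → *-assoc (δ z x) p (φ i z))) (S-δ x (λ z → p * φ i z))))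
                (trans (cong (_% p) (*-comm p (φ i x))) (trans (m*n%n≡0 (φ i x) p) (sym (m*n%n≡0 0 p))))) }
          where
          ν : G → ℕ
          ν z = δ z x * p
          S-ν : S ν ≡ p
          S-ν = S-δ x (λ _ → p)
          supp : ∀ z → 0 < ν z → z ∈ x ∷ []
          supp z lt = at (z ≟G x)
            where
            at : Dec (z ≡ x) → z ∈ x ∷ []
            at (yes e) = here e
            at (no ≢)  = contradiction (subst (λ t → 0 < t * p) (δ-≢ ≢) lt) (n≮n 0)
          module F = Flat (fl ν supp (≤-trans (≤-reflexive S-ν) p≤))

-- Splitting a multiset into blocks

∑-map : ∀ {A B : Set} (g : A → B) (xs : List A) (f : B → ℕ) → ∑ (map g xs) f ≡ ∑ xs (λ x → f (g x))
∑-map g []       f = refl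
∑-map g (x ∷ xs) f = cong (f (g x) +_) (∑-map g xs f)

∑-take-drop : ∀ {A : Set} s (xs : List A) (f : A → ℕ) → ∑ (take s xs) f + ∑ (drop s xs) f ≡ ∑ xs f
∑-take-drop s xs f = trans (sym (∑-++ (take s xs) (drop s xs) f)) (cong (λ ys → ∑ ys f) (take++drop≡id s xs))

split-++ : ∀ {A : Set} s (xs ys : List A) →
  (∃ λ us → ∃ λ vs → xs ≡ us ++ vs × take s (xs ++ ys) ≡ us × drop s (xs ++ ys) ≡ vs ++ ys) ⊎
  (∃ λ us → ∃ λ vs → ys ≡ us ++ vs × take s (xs ++ ys) ≡ xs ++ us × drop s (xs ++ ys) ≡ vs)
split-++ zero    xs       ys = inj₁ ([] , xs , refl , refl , refl)
split-++ (suc s) []       ys = inj₂ (take (suc s) ys , drop (suc s) ys , sym (take++drop≡id (suc s) ys) , refl , refl)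
split-++ (suc s) (x ∷ xs) ys with split-++ s xs ys
... | inj₁ (us , vs , e , t , d) = inj₁ (x ∷ us , vs , cong (x ∷_) e , cong (x ∷_) t , d)
... | inj₂ (us , vs , e , t , d) = inj₂ (us , vs , e , cong (x ∷_) t , d)

quotient-unique : ∀ c L u K r → c * L + u ≡ c * K + r → u < c → r < c → L ≡ K × u ≡ r
quotient-unique c L u K r eq u<c r<c with <-cmp L K
... | tri≈ _ refl _ = refl , +-cancelˡ-≡ (c * L) u r eq
... | tri< L<K _ _ = contradiction eq (<⇒≢ (<-≤-trans (+-monoʳ-< (c * L) u<c)
        (≤-trans (≤-reflexive (trans (+-comm (c * L) c) (sym (*-suc c L)))) (≤-trans (*-monoʳ-≤ c L<K) (m≤m+n (c * K) r)))))
... | tri> _ _ K<L = contradiction (sym eq) (<⇒≢ (<-≤-trans (+-monoʳ-< (c * K) r<c)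
        (≤-trans (≤-reflexive (trans (+-comm (c * K) c) (sym (*-suc c K)))) (≤-trans (*-monoʳ-≤ c K<L) (m≤m+n (c * L) u)))))

module _ {A : Set} where

  Columns : Set
  Columns = List (List A)

  HasSize : ℕ → List A → Set
  HasSize L col = length col ≡ L

  record Balanced (Q : Columns) : Set where
    constructor balanced
    field
      L     : ℕ
      Q₁ Q₂ : Columns
      split : Q ≡ Q₁ ++ Q₂
      size₁ : All (HasSize L) Q₁
      size₂ : All (HasSize (suc L)) Q₂

  deal : A → ℕ → Columns → Columns
  deal x s Q = drop s Q ++ map (x ∷_) (take s Q)

  longer : ∀ x {L} {Q} → All (HasSize L) Q → All (HasSize (suc L)) (map (x ∷_) Q)
  longer x h = All.map⁺ (All.map (cong suc) h)

  deal-balanced : ∀ x s {Q} → Balanced Q → Balanced (deal x s Q)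
  deal-balanced x s (balanced L Q₁ Q₂ refl h₁ h₂) with split-++ s Q₁ Q₂
  ... | inj₁ (us , vs , refl , t , d) rewrite t | d = balanced L vs (Q₂ ++ map (x ∷_) us) (++-assoc vs Q₂ (map (x ∷_) us))
          (All.++⁻ʳ us h₁) (All.++⁺ h₂ (longer x (All.++⁻ˡ us h₁)))
  ... | inj₂ (us , vs , refl , t , d) rewrite t | d = balanced (suc L) (vs ++ map (x ∷_) Q₁) (map (x ∷_) us)
          (trans (cong (vs ++_) (map-++ (x ∷_) Q₁ us)) (sym (++-assoc vs (map (x ∷_) Q₁) (map (x ∷_) us))))
          (All.++⁺ (All.++⁻ʳ us h₂) (longer x h₁)) (longer x (All.++⁻ˡ us h₂))

  module _ (μ : A → ℕ) (c : ℕ) (μ≤c : ∀ x → μ x ≤ c) where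

    record Table (us : List A) : Set where
      field
        Q        : Columns
        count    : length Q ≡ c
        balance  : Balanced Q
        unique   : All Unique Q
        inside   : All (All (λ x → x ∈ us × 0 < μ x)) Q
        sums     : ∀ f → ∑ Q (λ col → ∑ col f) ≡ ∑ us (λ x → μ x * f x)

    -- Dealing the copies of x to the front of the queue and moving these columns to the back keeps the columns balanced
    -- and puts x at most once into each of them.
    table : ∀ us → Unique us → Table us
    table [] _ = record
      { Q = replicate c [] ; count = length-replicate c
      ; balance = balanced 0 (replicate c []) [] (sym (++-identityʳ (replicate c []))) (All.replicate⁺ c refl) []
      ; unique = All.replicate⁺ c [] ; inside = All.replicate⁺ c [] ; sums = λ f → empty c f }
      where
      empty : ∀ c f → ∑ (replicate c []) (λ col → ∑ {A} col f) ≡ 0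
      empty zero    f = refl
      empty (suc c) f = empty c f
    table (x ∷ us) (x∉ ∷ u) = record
      { Q = deal x s T.Q
      ; count = count′
      ; balance = deal-balanced x s T.balance
      ; unique = All.++⁺ (All.drop⁺ s T.unique) (All.map⁺ (All.zipWith fresh (All.take⁺ s T.unique , All.take⁺ s T.inside)))
      ; inside = All.++⁺ (All.drop⁺ s (All.map (All.map old) T.inside)) inside′
      ; sums = sums′ }
      where
      s : ℕ
      s = μ x
      module T = Table (table us u)
      old : ∀ {y} → y ∈ us × 0 < μ y → y ∈ x ∷ us × 0 < μ y
      old (i , h) = there i , h
      fresh : ∀ {col} → Unique col × All (λ x → x ∈ us × 0 < μ x) col → Unique (x ∷ col)
      fresh (uc , ins) = All.map (λ { (i , _) refl → All.lookup x∉ i refl }) ins ∷ uc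
      s≤ : s ≤ length T.Q
      s≤ = ≤-trans (μ≤c x) (≤-reflexive (sym T.count))
      length-take-s : length (take s T.Q) ≡ s
      length-take-s = trans (length-take s T.Q) (m≤n⇒m⊓n≡m s≤)
      inside′ : All (All (λ y → y ∈ x ∷ us × 0 < μ y)) (map (x ∷_) (take s T.Q))
      -- If no copy of x is dealt, no column contains x; otherwise 0 < μ x is available.
      inside′ with s ≟ 0
      ... | yes z rewrite z = []
      ... | no s≢0 = All.map⁺ (All.take⁺ s (All.map (λ ins → (here refl , n≢0⇒n>0 s≢0) ∷ All.map old ins) T.inside))
      count′ : length (deal x s T.Q) ≡ c
      count′ = trans (length-++ (drop s T.Q)) (trans (cong (length (drop s T.Q) +_) (length-map (x ∷_) (take s T.Q)))
        (trans (+-comm (length (drop s T.Q)) (length (take s T.Q))) (trans (sym (length-++ (take s T.Q))) (trans (cong length (take++drop≡id s T.Q)) T.count))))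
      sums′ : ∀ f → ∑ (deal x s T.Q) (λ col → ∑ col f) ≡ s * f x + ∑ us (λ x → μ x * f x)
      sums′ f = begin
        ∑ (drop s T.Q ++ map (x ∷_) (take s T.Q)) F
          ≡⟨ ∑-++ (drop s T.Q) (map (x ∷_) (take s T.Q)) F ⟩
        ∑ (drop s T.Q) F + ∑ (map (x ∷_) (take s T.Q)) F
          ≡⟨ cong (∑ (drop s T.Q) F +_) (trans (∑-map (x ∷_) (take s T.Q) F) (trans (∑-+ (take s T.Q) (λ _ → f x) F)
               (cong (_+ ∑ (take s T.Q) F) (trans (∑-const (take s T.Q) (f x)) (cong (_* f x) length-take-s))))) ⟩
        ∑ (drop s T.Q) F + (s * f x + ∑ (take s T.Q) F)
          ≡⟨ shuffle (∑ (drop s T.Q) F) (s * f x) (∑ (take s T.Q) F) ⟩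
        s * f x + (∑ (take s T.Q) F + ∑ (drop s T.Q) F)
          ≡⟨ cong (s * f x +_) (trans (∑-take-drop s T.Q F) (T.sums f)) ⟩
        s * f x + ∑ us (λ x → μ x * f x) ∎
        where
        open ≡-Reasoning
        F : List A → ℕ
        F col = ∑ col f
        shuffle : ∀ a b c → a + (b + c) ≡ b + (c + a)
        shuffle = solve-∀

    record Grid (K r : ℕ) (us : List A) : Set where
      field
        Qₐ Q_b  : Columns
        sizeₐ   : All (HasSize K) Qₐ
        size_b  : All (HasSize (suc K)) Q_b
        number  : length Q_b ≡ r
        uniqueₐ : All Unique Qₐ
        unique_b : All Unique Q_b
        insideₐ : All (All (λ x → x ∈ us × 0 < μ x)) Qₐ
        inside_b : All (All (λ x → x ∈ us × 0 < μ x)) Q_b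
        sums    : ∀ f → ∑ Qₐ (λ col → ∑ col f) + ∑ Q_b (λ col → ∑ col f) ≡ ∑ us (λ x → μ x * f x)

    -- The columns have two consecutive lengths and the total is c * K + r with r < c, so uniqueness
    -- of division identifies the lengths as K and suc K and the number of long columns as r.
    grid : ∀ us → Unique us → ∀ K r → r < c → ∑ us μ ≡ c * K + r → Grid K r us
    grid us u K r r<c total = from (T.balance)
      where
      module T = Table (table us u)
      sizes : ∀ {L} (Q : Columns) → All (HasSize L) Q → ∑ Q (λ col → ∑ col (λ _ → 1)) ≡ length Q * L
      sizes []        []       = refl
      sizes (col ∷ Q) (h ∷ hs) = cong₂ _+_ (trans (sym (length≡∑ col)) h) (sizes Q hs)
      from : Balanced T.Q → Grid K r us
      from (balanced L Q₁ Q₂ split h₁ h₂) = decide (length Q₂ <? c)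
        where
        F : (A → ℕ) → List A → ℕ
        F f col = ∑ col f
        sums′ : ∀ f → ∑ Q₁ (F f) + ∑ Q₂ (F f) ≡ ∑ us (λ x → μ x * f x)
        sums′ f = trans (sym (∑-++ Q₁ Q₂ (F f))) (trans (cong (λ Q → ∑ Q (F f)) (sym split)) (T.sums f))
        count′ : length Q₁ + length Q₂ ≡ c
        count′ = trans (sym (length-++ Q₁)) (trans (cong length (sym split)) T.count)
        unique′ : All Unique (Q₁ ++ Q₂)
        unique′ = subst (All Unique) split T.unique
        inside′ : All (All (λ x → x ∈ us × 0 < μ x)) (Q₁ ++ Q₂)
        inside′ = subst (All (All (λ x → x ∈ us × 0 < μ x))) split T.inside
        eq : c * L + length Q₂ ≡ c * K + r
        eq = begin
          c * L + length Q₂                              ≡⟨ cong (λ t → t * L + length Q₂) (sym count′) ⟩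
          (length Q₁ + length Q₂) * L + length Q₂        ≡⟨ shape (length Q₁) (length Q₂) L ⟩
          length Q₁ * L + length Q₂ * suc L              ≡⟨ sym (cong₂ _+_ (sizes Q₁ h₁) (sizes Q₂ h₂)) ⟩
          ∑ Q₁ (F (λ _ → 1)) + ∑ Q₂ (F (λ _ → 1))        ≡⟨ sums′ (λ _ → 1) ⟩
          ∑ us (λ x → μ x * 1)                           ≡⟨ trans (∑-cong us (λ x → *-identityʳ (μ x))) total ⟩
          c * K + r                                      ∎
          where
          open ≡-Reasoning
          shape : ∀ a b L → (a + b) * L + b ≡ a * L + b * suc L
          shape = solve-∀
        decide : Dec (length Q₂ < c) → Grid K r us
        decide (yes lt) with quotient-unique c L (length Q₂) K r eq lt r<c
        ... | refl , n = record { Qₐ = Q₁ ; Q_b = Q₂ ; sizeₐ = h₁ ; size_b = h₂ ; number = n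
              ; uniqueₐ = All.++⁻ˡ Q₁ unique′ ; unique_b = All.++⁻ʳ Q₁ unique′ ; insideₐ = All.++⁻ˡ Q₁ inside′ ; inside_b = All.++⁻ʳ Q₁ inside′ ; sums = sums′ }
        -- When every column is long, division yields suc L with remainder 0, and the long columns
        -- take the role of those of length K.
        decide (no ¬lt) = at (quotient-unique c (suc L) 0 K r eq′ (≤-<-trans z≤n r<c) r<c)
          where
          Q₂≡c : length Q₂ ≡ c
          Q₂≡c = ≤-antisym (≤-trans (m≤n+m (length Q₂) (length Q₁)) (≤-reflexive count′)) (≮⇒≥ ¬lt)
          Q₁≡[] : ∀ (Q : Columns) → length Q + c ≡ c → Q ≡ []
          Q₁≡[] []      _ = refl
          Q₁≡[] (q ∷ Q) e = contradiction (sym e) (<⇒≢ (s≤s (m≤n+m c (length Q))))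
          eq′ : c * suc L + 0 ≡ c * K + r
          eq′ = trans (+-identityʳ (c * suc L)) (trans (*-suc c L) (trans (+-comm c (c * L)) (trans (cong (c * L +_) (sym Q₂≡c)) eq)))
          at : suc L ≡ K × 0 ≡ r → Grid K r us
          at (refl , refl) = record { Qₐ = Q₂ ; Q_b = [] ; sizeₐ = h₂ ; size_b = [] ; number = refl
            ; uniqueₐ = All.++⁻ʳ Q₁ unique′ ; unique_b = [] ; insideₐ = All.++⁻ʳ Q₁ inside′ ; inside_b = []
            ; sums = λ f → trans (+-comm (∑ Q₂ (F f)) 0) (trans (cong (λ Q → ∑ Q (F f) + ∑ Q₂ (F f)) (sym (Q₁≡[] Q₁ (trans (cong (length Q₁ +_) (sym Q₂≡c)) count′)))) (sums′ f)) }

-- Assembling a zero-sum family of distinct elements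

module Assembly (𝔾 : FinGroup) (p : ℕ) .{{_ : NonZero p}} (I : Set) (φ : I → FinGroup.G 𝔾 → ℕ) where
  open GroupSums 𝔾
  open Congruence p
  open Selection 𝔾
  open Swaps 𝔾
  open Spreading 𝔾 p I φ using (exceeds)

  module _ (φ-⊕ : ∀ i x y → φ i (x ⊕ y) ≈ φ i x + φ i y) (φ-𝟘 : ∀ i → φ i 𝟘 ≈ 0) where

    φ-gsum : ∀ i xs → φ i (gsum xs) ≈ ∑ xs (φ i)
    φ-gsum i []       = φ-𝟘 i
    φ-gsum i (x ∷ xs) = trans (φ-⊕ i x (gsum xs)) (≈-+ {φ i x} refl (φ-gsum i xs))

    record Picked (K : ℕ) (Ok : G → Set) (U : List G) (Q : List (List G)) : Set where
      field
        reps    : List G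
        blocks  : List (List G)
        reps-unique : Unique reps
        reps-ok : All Ok reps
        sizes   : All (HasSize K) blocks
        uniques : All Unique blocks
        oks     : All (All Ok) blocks
        sums    : ∀ f → ∑ reps f + ∑ blocks (λ col → ∑ col f) ≡ ∑ U f + ∑ Q (λ col → ∑ col f)

    -- A column holds suc K distinct elements and at most K have been picked before, so it can
    -- always supply a new one.
    pick : ∀ {K Ok} U Q → Unique U → All Ok U → All (HasSize (suc K)) Q → All Unique Q → All (All Ok) Q →
           length U + length Q ≤ suc K → Picked K Ok U Q
    pick U [] u ok _ _ _ _ = record { reps = U ; blocks = [] ; reps-unique = u ; reps-ok = ok ; sizes = [] ; uniques = [] ; oks = [] ; sums = λ f → refl }
    pick {K} {Ok} U (col ∷ Q) u ok (h ∷ hs) (uc ∷ us) (o ∷ os) small = from (exceeds U col uc lt)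
      where
      lt : length U < length col
      lt = <-≤-trans (≤-trans (≤-trans (s≤s (m≤m+n (length U) (length Q))) (≤-reflexive (sym (+-suc (length U) (length Q))))) small) (≤-reflexive (sym h))
      from : (∃ λ z → z ∈ col × z ∉ U) → Picked K Ok U (col ∷ Q)
      from (z , z∈ , z∉) with remove z∈ uc
      ... | ys , size , uy , sub , _ , _ , sum = record
        { reps = P.reps ; blocks = ys ∷ P.blocks ; reps-unique = P.reps-unique ; reps-ok = P.reps-ok
        ; sizes = suc-injective (trans (sym size) h) ∷ P.sizes ; uniques = uy ∷ P.uniques
        ; oks = All.tabulate (λ i → All.lookup o (sub i)) ∷ P.oks
        ; sums = λ f → trans (+-swap (∑ P.reps f) (∑ ys f) (∑ P.blocks (λ col → ∑ col f)))
                   (trans (cong (∑ ys f +_) (P.sums f)) (trans (regroup (∑ ys f) (f z) (∑ U f) (∑ Q (λ col → ∑ col f)))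
                     (cong (λ t → ∑ U f + (t + ∑ Q (λ col → ∑ col f))) (sym (sum f))))) }
        where
        module P = Picked (pick (z ∷ U) Q (All.tabulate (λ i e → z∉ (subst (_∈ U) (sym e) i)) ∷ u) (All.lookup o z∈ ∷ ok) hs us os
          (≤-trans (≤-reflexive (sym (+-suc (length U) (length Q)))) small))
        regroup : ∀ y z u q → y + (z + u + q) ≡ u + (z + y + q)
        regroup = solve-∀

    record Assembled (A : G → Bool) (n : ℕ) (U : List G) (Q : List (List G)) : Set where
      field
        family : List G
        size   : length family ≡ n
        unique : Unique family
        inside : All (λ x → A x ≡ true) family
        moment : ∀ i → ∑ family (φ i) ≈ ∑ U (φ i) + ∑ Q (λ col → ∑ col (φ i))

    -- U is everything used so far and acts as the forbidden set for the next block. An exchange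
    -- preserves the group sum, hence the moments modulo p.
    assemble : ∀ {A f K as} → Swappable A f K as → ∀ U Q → Unique U → All (λ x → A x ≡ true) U →
               All (HasSize K) Q → All Unique Q → All (All (_∈ as)) Q → length U + length Q * K ≤ f →
               Assembled A (length U + length Q * K) U Q
    assemble swap U [] u ok _ _ _ _ = record { family = U ; size = sym (+-identityʳ (length U)) ; unique = u ; inside = ok
      ; moment = λ i → cong (_% p) (sym (+-identityʳ (∑ U (φ i)))) }
    assemble {A} {f} {K} swap U (col ∷ Q) u ok (h ∷ hs) (uc ∷ us) (o ∷ os) small = record
      { family = R.family ; size = trans R.size n≡ ; unique = R.unique ; inside = R.inside ; moment = moment′ }
      where
      module F = FreshTuple (swap col h uc o U (≤-trans (m≤m+n (length U) _) small))
      U′ : List G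
      U′ = F.tuple ++ U
      n≡ : length U′ + length Q * K ≡ length U + length (col ∷ Q) * K
      n≡ = trans (cong (_+ length Q * K) (trans (length-++ F.tuple) (trans (cong (_+ length U) F.size) (+-comm K (length U))))) (+-assoc (length U) K (length Q * K))
      module R = Assembled (assemble swap U′ Q
        (Unique.++⁺ F.unique u (λ ij → All.lookup F.avoids (proj₁ ij) (proj₂ ij))) (All.++⁺ F.inside ok) hs us os (≤-trans (≤-reflexive n≡) small))
      moment′ : ∀ i → ∑ R.family (φ i) ≈ ∑ U (φ i) + (∑ col (φ i) + ∑ Q (λ col → ∑ col (φ i)))
      moment′ i = trans (R.moment i) (trans (cong (λ t → (t + q) % p) (∑-++ F.tuple U (φ i)))
        (trans (≈-+ {∑ F.tuple (φ i) + ∑ U (φ i)} {∑ col (φ i) + ∑ U (φ i)} {q} {q} (≈-+ {∑ F.tuple (φ i)} {∑ col (φ i)} {∑ U (φ i)} {∑ U (φ i)} same refl) refl)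
          (cong (_% p) (regroup (∑ col (φ i)) (∑ U (φ i)) q))))
        where
        q : ℕ
        q = ∑ Q (λ col → ∑ col (φ i))
        same : ∑ F.tuple (φ i) ≈ ∑ col (φ i)
        same = trans (sym (φ-gsum i F.tuple)) (trans (cong (λ g → φ i g % p) F.total) (φ-gsum i col))
        regroup : ∀ c u q → c + u + q ≡ u + (c + q)
        regroup = solve-∀

    record ZeroSum (A : G → Bool) : Set where
      field
        family : List G
        size   : length family ≡ p
        unique : Unique family
        inside : All (λ x → A x ≡ true) family
        moment : ∀ i → ∑ family (φ i) ≈ 0

    -- The multiset μ is dealt into c columns; distinct spare elements are removed from the r columns that are too long, and the
    -- remaining columns are exchanged for fresh tuples.
    zero-sum : ∀ {A : G → Bool} {K as} (μ : G → ℕ) c r → (∀ x → μ x ≤ c) → S μ ≡ p → (∀ i → S (λ x → μ x * φ i x) ≈ 0) →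
               (∀ x → 0 < μ x → x ∈ as) → p ≡ c * K + r → r < c → r ≤ K → All (λ x → A x ≡ true) as → Swappable A p K as → ZeroSum A
    zero-sum {A} {K} {as} μ c r μ≤c total moment supp p≡ r<c r≤K as⊆A swap = record
      { family = R.family ; size = trans R.size n≡p ; unique = R.unique ; inside = R.inside
      ; moment = λ i → trans (R.moment i) (trans (cong (_% p) (sums-all (φ i))) (moment i)) }
      where
      module Gd = Grid (grid μ c μ≤c univ univ-unq K r r<c (trans total p≡))
      ok : ∀ {x} → x ∈ univ × 0 < μ x → x ∈ as
      ok (_ , h) = supp _ h
      module P = Picked (pick {K} {_∈ as} [] Gd.Q_b [] [] Gd.size_b Gd.unique_b (All.map (All.map ok) Gd.inside_b)
        (≤-trans (≤-reflexive Gd.number) (≤-trans r≤K (n≤1+n K))))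
      Q : List (List G)
      Q = P.blocks ++ Gd.Qₐ
      sums-all : ∀ f → ∑ P.reps f + ∑ Q (λ col → ∑ col f) ≡ S (λ x → μ x * f x)
      sums-all f = trans (cong (∑ P.reps f +_) (∑-++ P.blocks Gd.Qₐ (λ col → ∑ col f))) (trans (sym (+-assoc (∑ P.reps f) _ _))
        (trans (cong (_+ ∑ Gd.Qₐ (λ col → ∑ col f)) (P.sums f)) (trans (+-comm (∑ Gd.Q_b (λ col → ∑ col f)) _) (Gd.sums f))))
      sizesQ : All (HasSize K) Q
      sizesQ = All.++⁺ P.sizes Gd.sizeₐ
      sizes : ∀ (Q : List (List G)) → All (HasSize K) Q → ∑ Q (λ col → ∑ col (λ _ → 1)) ≡ length Q * K
      sizes []        []       = refl
      sizes (col ∷ Q) (h ∷ hs) = cong₂ _+_ (trans (sym (length≡∑ col)) h) (sizes Q hs)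
      n≡p : length P.reps + length Q * K ≡ p
      n≡p = trans (cong₂ _+_ (length≡∑ P.reps) (sym (sizes Q sizesQ))) (trans (sums-all (λ _ → 1)) (trans (∑-cong univ (λ x → *-identityʳ (μ x))) total))
      module R = Assembled (assemble swap P.reps Q P.reps-unique (All.map (All.lookup as⊆A) P.reps-ok) sizesQ
        (All.++⁺ P.uniques Gd.uniqueₐ) (All.++⁺ P.oks (All.map (All.map ok) Gd.insideₐ)) (≤-reflexive n≡p))

-- The polynomial method

∏ : {A : Set} → List A → (A → ℕ) → ℕ
∏ []       f = 1
∏ (x ∷ xs) f = f x * ∏ xs f

mono : ∀ {n} → Vec ℕ n → (Fin n → ℕ) → ℕ
mono []      y = 1
mono (a ∷ e) y = y fzero ^ a * mono e (λ i → y (fsuc i))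

degree : ∀ {n} → Vec ℕ n → ℕ
degree []      = 0
degree (a ∷ e) = a + degree e

mono-bump : ∀ {n} (i : Fin n) e y → mono (updateAt e i suc) y ≡ y i * mono e y
mono-bump fzero    (a ∷ e) y = *-assoc (y fzero) (y fzero ^ a) (mono e (λ i → y (fsuc i)))
mono-bump (fsuc i) (a ∷ e) y = trans (cong (y fzero ^ a *_) (mono-bump i e (λ i → y (fsuc i)))) (*-swap (y fzero ^ a) (y (fsuc i)) (mono e (λ i → y (fsuc i))))

degree-bump : ∀ {n} (i : Fin n) e → degree (updateAt e i suc) ≡ suc (degree e)
degree-bump fzero    (a ∷ e) = refl
degree-bump (fsuc i) (a ∷ e) = trans (cong (a +_) (degree-bump i e)) (+-suc a (degree e))

degree-0 : ∀ n → degree (Vec.replicate n 0) ≡ 0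
degree-0 zero    = refl
degree-0 (suc n) = degree-0 n

mono-0 : ∀ n y → mono (Vec.replicate n 0) y ≡ 1
mono-0 zero    y = refl
mono-0 (suc n) y = trans (+-identityʳ (mono (Vec.replicate n 0) (λ i → y (fsuc i)))) (mono-0 n (λ i → y (fsuc i)))

bump₀ : ∀ {n} → Vec ℕ (suc n) → Vec ℕ (suc n)
bump₀ (a ∷ e) = suc a ∷ e

-- The first exponent is zero, or it is positive and can be lowered by one: Pascal's recursion,
-- under which the count at most doubles when n + d grows by one.
exponents : ∀ n → ℕ → List (Vec ℕ n)
exponents zero    d       = [] ∷ []
exponents (suc n) zero    = map (0 ∷_) (exponents n 0)
exponents (suc n) (suc d) = map (0 ∷_) (exponents n (suc d)) ++ map bump₀ (exponents (suc n) d)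

length-exponents : ∀ n d → length (exponents n d) ≤ 2 ^ (n + d)
length-exponents zero    d       = m^n>0 2 d
length-exponents (suc n) zero    = ≤-trans (≤-reflexive (length-map (0 ∷_) (exponents n 0))) (≤-trans (length-exponents n 0) (^-monoʳ-≤ 2 (n≤1+n (n + 0))))
length-exponents (suc n) (suc d) = begin
  length (map (0 ∷_) (exponents n (suc d)) ++ map bump₀ (exponents (suc n) d))
    ≡⟨ trans (length-++ (map (0 ∷_) (exponents n (suc d)))) (cong₂ _+_ (length-map (0 ∷_) (exponents n (suc d))) (length-map bump₀ (exponents (suc n) d))) ⟩
  length (exponents n (suc d)) + length (exponents (suc n) d)
    ≤⟨ +-mono-≤ (length-exponents n (suc d)) (length-exponents (suc n) d) ⟩
  2 ^ (n + suc d) + 2 ^ (suc n + d)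
    ≡⟨ cong (λ t → 2 ^ (n + suc d) + t) (trans (cong (2 ^_) (sym (+-suc n d))) (sym (+-identityʳ (2 ^ (n + suc d))))) ⟩
  2 ^ (suc n + suc d) ∎
  where open ≤-Reasoning

∈-exponents : ∀ {n} (e : Vec ℕ n) d → degree e ≤ d → e ∈ exponents n d
∈-exponents []            d       h = here refl
∈-exponents (zero ∷ e)    zero    h = ∈-map⁺ (0 ∷_) (∈-exponents e 0 h)
∈-exponents (zero ∷ e)    (suc d) h = ∈-++⁺ˡ (∈-map⁺ (0 ∷_) (∈-exponents e (suc d) h))
∈-exponents {suc n} (suc a ∷ e) (suc d) h = ∈-++⁺ʳ (map (0 ∷_) (exponents n (suc d))) (∈-map⁺ bump₀ (∈-exponents (a ∷ e) d (s≤s⁻¹ h)))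

funToFin-cong : ∀ {m k} {f g : Fin m → Fin k} → (∀ j → f j ≡ g j) → funToFin f ≡ funToFin g
funToFin-cong {zero}  h = refl
funToFin-cong {suc m} h = cong₂ combine (h fzero) (funToFin-cong (λ j → h (fsuc j)))

module Kernel (p : ℕ) (pp : Prime p) {m : ℕ} where

  instance
    p≢0 : NonZero p
    p≢0 = prime⇒nonZero pp

  open Congruence p

  -- Pigeonhole on the p ^ m functions Fin m → Fin p; the difference of two with the same moments is u + (p − 1) v.
  kernel : ∀ {E : Set} (es : List E) (F : E → Fin m → ℕ) → length es < m →
           ∃ λ (h : Fin m → ℕ) → (∃ λ j → ¬ p ∣ h j) × (∀ {e} → e ∈ es → p ∣ ∑ (allFin m) (λ j → h j * F e j))
  kernel es F lt = from (Fin.pigeonhole (^-monoʳ-< p (Prime>1) lt) (λ a → funToFin (moments (finToFun a))))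
    where
    Prime>1 : 1 < p
    Prime>1 = nonTrivial⇒n>1 p {{prime⇒nonTrivial pp}}
    moment : (Fin m → Fin p) → Fin (length es) → ℕ
    moment g l = ∑ (allFin m) (λ j → toℕ (g j) * F (List.lookup es l) j)
    moments : (Fin m → Fin p) → Fin (length es) → Fin p
    moments g l = moment g l mod p
    Goal : Set
    Goal = ∃ λ (h : Fin m → ℕ) → (∃ λ j → ¬ p ∣ h j) × (∀ {e} → e ∈ es → p ∣ ∑ (allFin m) (λ j → h j * F e j))
    from : (∃₂ λ (a b : Fin (p ^ m)) → toℕ a < toℕ b × funToFin (moments (finToFun a)) ≡ funToFin (moments (finToFun b))) → Goal
    from (a , b , a<b , eq) = h , nonzero (Fin.all? (λ j → u j Fin.≟ v j)) , λ i → subst (λ e → p ∣ ∑ (allFin m) (λ j → h j * F e j)) (sym (lookup-index i)) (vanish (index i))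
      where
      u v : Fin m → Fin p
      u = finToFun a
      v = finToFun b
      h : Fin m → ℕ
      h j = toℕ (u j) + (p ∸ 1) * toℕ (v j)
      p≡ : 1 + (p ∸ 1) ≡ p
      p≡ = m+[n∸m]≡n (<⇒≤ Prime>1)
      same : ∀ l → moment u l ≈ moment v l
      same l = trans (sym (Fin.toℕ-fromℕ< (m%n<n (moment u l) p))) (trans (cong toℕ (trans (sym (Fin.finToFun-funToFin (moments u) l))
        (trans (cong (λ t → finToFun t l) eq) (Fin.finToFun-funToFin (moments v) l)))) (Fin.toℕ-fromℕ< (m%n<n (moment v l) p)))
      vanish : ∀ l → p ∣ ∑ (allFin m) (λ j → h j * F (List.lookup es l) j)
      vanish l = m%n≡0⇒n∣m _ p (begin
        ∑ (allFin m) (λ j → h j * f j) % p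
          ≡⟨ cong (_% p) (trans (∑-cong (allFin m) (λ j → shape (toℕ (u j)) (p ∸ 1) (toℕ (v j)) (f j)))
               (trans (∑-+ (allFin m) (λ j → toℕ (u j) * f j) (λ j → (p ∸ 1) * (toℕ (v j) * f j))) (cong (moment u l +_) (∑-*ˡ (p ∸ 1) (allFin m) (λ j → toℕ (v j) * f j))))) ⟩
        (moment u l + (p ∸ 1) * moment v l) % p
          ≡⟨ ≈-+ {moment u l} {moment v l} {(p ∸ 1) * moment v l} (same l) refl ⟩
        (moment v l + (p ∸ 1) * moment v l) % p
          ≡⟨ cong (λ t → t * moment v l % p) p≡ ⟩
        (p * moment v l) % p
          ≡⟨ trans (cong (_% p) (*-comm p (moment v l))) (m*n%n≡0 (moment v l) p) ⟩
        0 ∎)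
        where
        open ≡-Reasoning
        f : Fin m → ℕ
        f = F (List.lookup es l)
        shape : ∀ u c v f → (u + c * v) * f ≡ u * f + c * (v * f)
        shape = solve-∀
      nonzero : Dec (∀ j → u j ≡ v j) → ∃ λ j → ¬ p ∣ h j
      nonzero (yes all) = contradiction (trans (sym (Fin.funToFin-finToFin {m} {p} a)) (trans (funToFin-cong all) (Fin.funToFin-finToFin {m} {p} b))) (λ e → Fin.<⇒≢ a<b e)
      nonzero (no ¬all) with Fin.¬∀⟶∃¬ m (λ j → u j ≡ v j) (λ j → u j Fin.≟ v j) ¬all
      ... | j , u≢v = j , λ p∣h → u≢v (Fin.toℕ-injective (trans (sym (m<n⇒m%n≡m (Fin.toℕ<n (u j)))) (trans (residue p∣h) (m<n⇒m%n≡m (Fin.toℕ<n (v j))))))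
        where
        residue : p ∣ h j → toℕ (u j) ≈ toℕ (v j)
        residue p∣h = begin
          toℕ (u j) % p                                       ≡⟨ sym ([m+kn]%n≡m%n (toℕ (u j)) (toℕ (v j)) p) ⟩
          (toℕ (u j) + toℕ (v j) * p) % p                     ≡⟨ cong (_% p) (trans (cong (λ t → toℕ (u j) + toℕ (v j) * t) (sym p≡)) (shape (toℕ (u j)) (toℕ (v j)) (p ∸ 1))) ⟩
          (h j + toℕ (v j)) % p                               ≡⟨ ≈-+ {h j} {0} {toℕ (v j)} (trans (n∣m⇒m%n≡0 (h j) p p∣h) (sym (m*n%n≡0 0 p))) refl ⟩
          toℕ (v j) % p                                       ∎
          where
          open ≡-Reasoning
          shape : ∀ u v c → u + v * (1 + c) ≡ u + c * v + v
          shape = solve-∀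

module _ {m : ℕ} where

  vecs : ∀ T → List (Vec (Fin m) T)
  vecs zero    = [] ∷ []
  vecs (suc T) = cartesianProductWith _∷_ (allFin m) (vecs T)

  ∑-vecs : ∀ {T} (f : Vec (Fin m) (suc T) → ℕ) → ∑ (vecs (suc T)) f ≡ ∑ (allFin m) (λ j → ∑ (vecs T) (λ v → f (j ∷ v)))
  ∑-vecs {T} f = go (allFin m)
    where
    go : ∀ js → ∑ (cartesianProductWith _∷_ js (vecs T)) f ≡ ∑ js (λ j → ∑ (vecs T) (λ v → f (j ∷ v)))
    go []       = refl
    go (j ∷ js) = trans (∑-++ (map (j ∷_) (vecs T)) (cartesianProductWith _∷_ js (vecs T)) f) (cong₂ _+_ (∑-map (j ∷_) (vecs T) f) (go js))

  vecs-unique : ∀ T → Unique (vecs T)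
  vecs-unique zero    = [] ∷ []
  vecs-unique (suc T) = Unique.cartesianProductWith⁺ _∷_ (λ { refl → refl , refl }) (Unique.allFin⁺ m) (vecs-unique T)

  ∈-vecs : ∀ {T} (v : Vec (Fin m) T) → v ∈ vecs T
  ∈-vecs []      = here refl
  ∈-vecs (j ∷ v) = ∈-cartesianProductWith⁺ _∷_ (∈-allFin j) (∈-vecs v)

module Tuples (p : ℕ) (pp : Prime p) {m n : ℕ} (x : Fin m → Fin n → ℕ) where

  open Kernel p pp {m} using (p≢0; kernel)
  open Congruence p

  coords : ∀ {T} → Vec (Fin m) T → Fin n → ℕ
  coords []      i = 0
  coords (j ∷ v) i = x j i + coords v i

  module _ (h : Fin m → ℕ) where

    -- h(w₁) ⋯ h(w_T) times a monomial in the coordinates of all T points, with one exponent vector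
    -- for each point.
    base : ∀ {T} → Vec (Vec ℕ n) T → Vec (Fin m) T → ℕ
    base []       []      = 1
    base (e ∷ es) (j ∷ v) = h j * mono e (x j) * base es v

    degrees : ∀ {T} → Vec (Vec ℕ n) T → ℕ
    degrees []       = 0
    degrees (e ∷ es) = degree e + degrees es

    module _ (d : ℕ) (vanish : ∀ {e} → e ∈ exponents n d → p ∣ ∑ (allFin m) (λ j → h j * mono e (x j))) where

      -- The sum is a product over the T places. A total degree below T * suc d leaves some place
      -- with degree at most d, and there h annihilates the factor.
      base-vanishes : ∀ {T} (es : Vec (Vec ℕ n) T) → degrees es < T * suc d → p ∣ ∑ (vecs T) (base es)
      base-vanishes {suc T} (e ∷ es) lt = subst (p ∣_) (sym product) (decide (degree e ≤? d))
        where
        product : ∑ (vecs (suc T)) (base (e ∷ es)) ≡ ∑ (allFin m) (λ j → h j * mono e (x j)) * ∑ (vecs T) (base es)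
        product = trans (∑-vecs (base (e ∷ es))) (trans (∑-cong (allFin m) (λ j → ∑-*ˡ (h j * mono e (x j)) (vecs T) (base es)))
                    (∑-*ʳ (∑ (vecs T) (base es)) (allFin m) (λ j → h j * mono e (x j))))
        decide : Dec (degree e ≤ d) → p ∣ ∑ (allFin m) (λ j → h j * mono e (x j)) * ∑ (vecs T) (base es)
        decide (yes small) = ∣m⇒∣m*n _ (vanish (∈-exponents e d small))
        decide (no large)  = ∣n⇒∣m*n (∑ (allFin m) (λ j → h j * mono e (x j))) (base-vanishes es
          (+-cancelˡ-< (suc d) (degrees es) (T * suc d) (≤-<-trans (+-monoˡ-≤ (degrees es) (≰⇒> large)) lt)))

      -- Multiplying by the i-th coordinate of w₁ + ... + w_T yields T monomials, each with one
      -- degree more at one place.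
      bumps : ∀ {T} → Fin n → Vec (Vec ℕ n) T → List (Vec (Vec ℕ n) T)
      bumps i []       = []
      bumps i (e ∷ es) = (updateAt e i suc ∷ es) ∷ map (e ∷_) (bumps i es)

      bumps-degree : ∀ {T} i (es : Vec (Vec ℕ n) T) → All (λ es′ → degrees es′ ≡ suc (degrees es)) (bumps i es)
      bumps-degree i []       = []
      bumps-degree i (e ∷ es) = cong (_+ degrees es) (degree-bump i e) ∷
        All.map⁺ (All.map (λ eq → trans (cong (degree e +_) eq) (+-suc (degree e) (degrees es))) (bumps-degree i es))

      bumps-base : ∀ {T} i (es : Vec (Vec ℕ n) T) v → coords v i * base es v ≡ ∑ (bumps i es) (λ es′ → base es′ v)
      bumps-base i []       []      = refl
      bumps-base i (e ∷ es) (j ∷ v) = begin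
        (x j i + coords v i) * (h j * mono e (x j) * base es v)
          ≡⟨ shape (x j i) (coords v i) (h j) (mono e (x j)) (base es v) ⟩
        h j * (x j i * mono e (x j)) * base es v + h j * mono e (x j) * (coords v i * base es v)
          ≡⟨ cong₂ _+_ (cong (λ t → h j * t * base es v) (sym (mono-bump i e (x j)))) (cong (h j * mono e (x j) *_) (bumps-base i es v)) ⟩
        h j * mono (updateAt e i suc) (x j) * base es v + h j * mono e (x j) * ∑ (bumps i es) (λ es′ → base es′ v)
          ≡⟨ cong (h j * mono (updateAt e i suc) (x j) * base es v +_) (trans (sym (∑-*ˡ (h j * mono e (x j)) (bumps i es) (λ es′ → base es′ v))) (sym (∑-map (e ∷_) (bumps i es) (λ es′ → base es′ (j ∷ v))))) ⟩
        h j * mono (updateAt e i suc) (x j) * base es v + ∑ (map (e ∷_) (bumps i es)) (λ es′ → base es′ (j ∷ v)) ∎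
        where
        open ≡-Reasoning
        shape : ∀ a c h m b → (a + c) * (h * m * b) ≡ h * (a * m) * b + h * m * (c * b)
        shape = solve-∀

      form : ∀ {T} → Vec (Fin m) T → Fin n × ℕ → ℕ
      form v (i , κ) = κ + coords v i

      ∣∑ : ∀ {A : Set} {xs : List A} {f : A → ℕ} → All (λ x → p ∣ f x) xs → p ∣ ∑ xs f
      ∣∑ []       = p ∣0
      ∣∑ (h ∷ hs) = ∣m∣n⇒∣m+n h (∣∑ hs)

      -- The linear forms are expanded one at a time. The constant term leaves the degrees alone and
      -- the linear part raises them by one, so the number of forms plus the degrees never grows.
      forms-vanish : ∀ {T} (fs : List (Fin n × ℕ)) (es : Vec (Vec ℕ n) T) → length fs + degrees es < T * suc d →
                     p ∣ ∑ (vecs T) (λ v → base es v * ∏ fs (form v))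
      forms-vanish [] es lt = subst (p ∣_) (∑-cong (vecs _) (λ v → sym (*-identityʳ (base es v)))) (base-vanishes es lt)
      forms-vanish {T} ((i , κ) ∷ fs) es lt = subst (p ∣_) (sym expand) (∣m∣n⇒∣m+n
          (∣n⇒∣m*n κ (forms-vanish fs es (≤-<-trans (n≤1+n _) lt)))
          (∣∑ (All.map (λ {es′} eq → forms-vanish fs es′ (≤-<-trans (≤-reflexive (trans (cong (length fs +_) eq) (+-suc (length fs) (degrees es)))) lt)) (bumps-degree i es))))
        where
        open ≡-Reasoning
        R : Vec (Fin m) T → ℕ
        R v = ∏ fs (form v)
        shape : ∀ b κ c r → b * ((κ + c) * r) ≡ κ * (b * r) + c * b * r
        shape = solve-∀
        expand : ∑ (vecs T) (λ v → base es v * ((κ + coords v i) * R v)) ≡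
                 κ * ∑ (vecs T) (λ v → base es v * R v) + ∑ (bumps i es) (λ es′ → ∑ (vecs T) (λ v → base es′ v * R v))
        expand = begin
          ∑ (vecs T) (λ v → base es v * ((κ + coords v i) * R v))
            ≡⟨ ∑-cong (vecs T) (λ v → trans (shape (base es v) κ (coords v i) (R v)) (cong (λ t → κ * (base es v * R v) + t * R v) (bumps-base i es v))) ⟩
          ∑ (vecs T) (λ v → κ * (base es v * R v) + ∑ (bumps i es) (λ es′ → base es′ v) * R v)
            ≡⟨ trans (∑-+ (vecs T) (λ v → κ * (base es v * R v)) (λ v → ∑ (bumps i es) (λ es′ → base es′ v) * R v))
                 (cong₂ _+_ (∑-*ˡ κ (vecs T) (λ v → base es v * R v))
                   (trans (∑-cong (vecs T) (λ v → sym (∑-*ʳ (R v) (bumps i es) (λ es′ → base es′ v)))) (∑-swap (vecs T) (bumps i es) (λ v es′ → base es′ v * R v)))) ⟩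
          κ * ∑ (vecs T) (λ v → base es v * R v) + ∑ (bumps i es) (λ es′ → ∑ (vecs T) (λ v → base es′ v * R v)) ∎

  ∣∑-isolated : ∀ {A : Set} {xs : List A} {f : A → ℕ} {a} → Unique xs → a ∈ xs → (∀ {x} → x ∈ xs → x ≢ a → p ∣ f x) → p ∣ ∑ xs f → p ∣ f a
  ∣∑-isolated {xs = x ∷ xs} {f} {a} (x∉ ∷ u) (here refl) hs total = ∣m+n∣m⇒∣n (subst (p ∣_) (+-comm (f x) (∑ xs f)) total) (others xs (λ i → hs (there i) (λ e → All.lookup x∉ i (sym e))))
    where
    others : ∀ xs → (∀ {x} → x ∈ xs → p ∣ f x) → p ∣ ∑ xs f
    others []       h = p ∣0
    others (y ∷ ys) h = ∣m∣n⇒∣m+n (h (here refl)) (others ys (λ i → h (there i)))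
  ∣∑-isolated {xs = x ∷ xs} (x∉ ∷ u) (there i) hs total = ∣∑-isolated u i (λ j → hs (there j)) (∣m+n∣m⇒∣n total (hs (here refl) (All.lookup x∉ i)))

  Solution : ℕ → Set
  Solution T = ∃ λ (j₀ : Fin m) → ∃ λ (v : Vec (Fin m) T) → v ≢ Vec.replicate T j₀ × (∀ i → coords v i ≈ T * x j₀ i)

  -- If x j₀ has no such solution, then multiplying the forms coords v i − T x j₀ i + a, 1 ≤ a < p, isolates the constant tuple.
  solution : ∀ d T → length (exponents n d) < m → (p ∸ 1) * n < T * suc d → Solution T
  solution d T few lt with kernel (exponents n d) (λ e j → mono e (x j)) few
  ... | h , (j₀ , p∤h) , vanish = decide (any? test (vecs T))
    where
    Good : Vec (Fin m) T → Set
    Good v = v ≢ Vec.replicate T j₀ × (∀ i → coords v i ≈ T * x j₀ i)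
    test : ∀ v → Dec (Good v)
    test v = ¬? (≡-dec Fin._≟_ v (Vec.replicate T j₀)) ×-dec Fin.all? (λ i → coords v i % p ≟ T * x j₀ i % p)
    -- p ∸ 1 stands for -1 modulo p.
    κ : Fin n → ℕ
    κ i = (p ∸ 1) * (T * x j₀ i)
    shifts : List ℕ
    shifts = map (1 +_) (upTo (p ∸ 1))
    fs : List (Fin n × ℕ)
    fs = cartesianProductWith (λ i a → i , κ i + a) (allFin n) shifts
    es : Vec (Vec ℕ n) T
    es = Vec.replicate T (Vec.replicate n 0)
    p≡ : 1 + (p ∸ 1) ≡ p
    p≡ = m+[n∸m]≡n (>-nonZero⁻¹ p)
    value : Vec (Fin m) T → ℕ
    value v = base h es v * ∏ fs (form h d vanish v)
    degrees-es : ∀ T → degrees h (Vec.replicate T (Vec.replicate n 0)) ≡ 0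
    degrees-es zero    = refl
    degrees-es (suc T) = cong₂ _+_ (degree-0 n) (degrees-es T)
    length-cartesian : ∀ (is : List (Fin n)) → length (cartesianProductWith (λ i a → i , κ i + a) is shifts) ≡ length is * length shifts
    length-cartesian []       = refl
    length-cartesian (i ∷ is) = trans (length-++ (map (λ a → i , κ i + a) shifts)) (cong₂ _+_ (length-map (λ a → i , κ i + a) shifts) (length-cartesian is))
    length-fs : length fs ≡ (p ∸ 1) * n
    length-fs = trans (length-cartesian (allFin n)) (trans (cong₂ _*_ (length-tabulate (λ (i : Fin n) → i)) (trans (length-map (1 +_) (upTo (p ∸ 1))) (length-upTo (p ∸ 1)))) (*-comm n (p ∸ 1)))
    total : p ∣ ∑ (vecs T) value
    total = forms-vanish h d vanish fs es (≤-<-trans (≤-reflexive (trans (cong₂ _+_ length-fs (degrees-es T)) (+-identityʳ ((p ∸ 1) * n)))) lt)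
    ∣∏ : ∀ {A : Set} {xs : List A} (f : A → ℕ) {x} → x ∈ xs → p ∣ f x → p ∣ ∏ xs f
    ∣∏ f (here refl) h = ∣m⇒∣m*n _ h
    ∣∏ {xs = y ∷ xs} f (there i) h = ∣n⇒∣m*n (f y) (∣∏ f i h)
    ∤∏ : ∀ {A : Set} (xs : List A) (f : A → ℕ) → (∀ {x} → x ∈ xs → ¬ p ∣ f x) → ¬ p ∣ ∏ xs f
    ∤∏ []       f h p∣1 = contradiction (∣1⇒≡1 p∣1) (λ { refl → contradiction (nonTrivial⇒n>1 1 {{prime⇒nonTrivial pp}}) (n≮n 1) })
    ∤∏ (x ∷ xs) f h p∣ with euclidsLemma (f x) (∏ xs f) pp p∣
    ... | inj₁ q = h (here refl) q
    ... | inj₂ q = ∤∏ xs f (λ i → h (there i)) q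
    base-const : ∀ T → base h (Vec.replicate T (Vec.replicate n 0)) (Vec.replicate T j₀) ≡ h j₀ ^ T
    base-const zero    = refl
    base-const (suc T) = cong₂ _*_ (trans (cong (h j₀ *_) (mono-0 n (x j₀))) (*-identityʳ (h j₀))) (base-const T)
    coords-const : ∀ T i → coords (Vec.replicate T j₀) i ≡ T * x j₀ i
    coords-const zero    i = refl
    coords-const (suc T) i = cong (x j₀ i +_) (coords-const T i)
    ∤^ : ∀ T → ¬ p ∣ h j₀ ^ T
    ∤^ zero    p∣1 = ∤∏ {A = Fin n} [] (λ _ → 0) (λ ()) p∣1
    ∤^ (suc T) p∣  with euclidsLemma (h j₀) (h j₀ ^ T) pp p∣
    ... | inj₁ q = p∤h q
    ... | inj₂ q = ∤^ T q
    -- At the constant tuple each form reduces to its shift a with 0 < a < p, and the remaining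
    -- factor is a power of h j₀; p divides none of them.
    const-∤ : ¬ p ∣ value (Vec.replicate T j₀)
    const-∤ p∣ with euclidsLemma (base h es (Vec.replicate T j₀)) (∏ fs (form h d vanish (Vec.replicate T j₀))) pp p∣
    ... | inj₁ q = ∤^ T (subst (p ∣_) (base-const T) q)
    ... | inj₂ q = ∤∏ fs (form h d vanish (Vec.replicate T j₀)) fine q
      where
      fine : ∀ {f} → f ∈ fs → ¬ p ∣ form h d vanish (Vec.replicate T j₀) f
      fine {f} f∈ p∣f with ∈-cartesianProductWith⁻ (λ i a → i , κ i + a) (allFin n) shifts f∈
      ... | i , a , _ , a∈ , refl with ∈-map⁻ (1 +_) a∈
      ...   | a′ , a′∈ , refl = contradiction (∣⇒≤ (∣m+n∣m⇒∣n (subst (p ∣_) eq p∣f) (n∣m*n (T * x j₀ i)))) (<⇒≱ (<-≤-trans (s≤s (∈-upTo⁻ a′∈)) (≤-reflexive p≡)))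
        where
        regroup : ∀ c t a → c * t + a + t ≡ t * (1 + c) + a
        regroup = solve-∀
        eq : κ i + suc a′ + coords (Vec.replicate T j₀) i ≡ T * x j₀ i * p + suc a′
        eq = trans (cong (κ i + suc a′ +_) (coords-const T i)) (trans (regroup (p ∸ 1) (T * x j₀ i) (suc a′)) (cong (λ t → T * x j₀ i * t + suc a′) p≡))
    others : (∀ {v} → v ∈ vecs T → ¬ Good v) → ∀ {v} → v ∈ vecs T → v ≢ Vec.replicate T j₀ → p ∣ value v
    others none {v} v∈ v≢ with Fin.all? (λ i → coords v i % p ≟ T * x j₀ i % p)
    ... | yes all = contradiction (v≢ , all) (none v∈)
    ... | no ¬all with Fin.¬∀⟶∃¬ n (λ i → coords v i ≈ T * x j₀ i) (λ i → coords v i % p ≟ T * x j₀ i % p) ¬all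
    ...   | i , ≉ = ∣n⇒∣m*n (base h es v) (∣∏ {xs = fs} (form h d vanish v) (∈-cartesianProductWith⁺ (λ i a → i , κ i + a) (∈-allFin i) a∈) p∣form)
      where
      u s : ℕ
      u = κ i + coords v i
      s = u % p
      s≢0 : s ≢ 0
      s≢0 s≡0 = ≉ (begin
        coords v i % p                               ≡⟨ sym ([m+kn]%n≡m%n (coords v i) (T * x j₀ i) p) ⟩
        (coords v i + T * x j₀ i * p) % p            ≡⟨ cong (_% p) (trans (cong (λ t → coords v i + T * x j₀ i * t) (sym p≡)) (regroup (coords v i) (T * x j₀ i) (p ∸ 1))) ⟩
        (u + T * x j₀ i) % p                         ≡⟨ ≈-+ {u} {0} {T * x j₀ i} (trans s≡0 (sym (m*n%n≡0 0 p))) refl ⟩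
        T * x j₀ i % p                               ∎)
        where
        open ≡-Reasoning
        regroup : ∀ c t q → c + t * (1 + q) ≡ q * t + c + t
        regroup = solve-∀
      a : ℕ
      -- The shift that cancels the residue s of the i-th form. It is one of the shifts 1, ..., p -
      -- 1 exactly because s is not 0.
      a = p ∸ s
      a>0 : 0 < a
      a>0 = m<n⇒0<n∸m (m%n<n u p)
      a≡ : suc (pred a) ≡ a
      a≡ = suc-pred a {{>-nonZero a>0}}
      a∈ : a ∈ shifts
      a∈ = subst (_∈ shifts) a≡ (∈-map⁺ (1 +_) (∈-upTo⁺ (s≤s⁻¹ (≤-trans (s≤s (≤-reflexive a≡)) (≤-trans (s≤s (∸-monoʳ-≤ p (n≢0⇒n>0 s≢0))) (≤-refl))))))
      p∣form : p ∣ κ i + a + coords v i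
      p∣form = m%n≡0⇒n∣m (κ i + a + coords v i) p (begin
        (κ i + a + coords v i) % p      ≡⟨ cong (_% p) (regroup (κ i) a (coords v i)) ⟩
        (u + a) % p                     ≡⟨ ≈-+ {u} {s} {a} (sym (m%n%n≡m%n u p)) refl ⟩
        (s + a) % p                     ≡⟨ cong (_% p) (m+[n∸m]≡n (<⇒≤ (m%n<n u p))) ⟩
        p % p                           ≡⟨ n%n≡0 p ⟩
        0                               ∎)
        where
        open ≡-Reasoning
        regroup : ∀ k a c → k + a + c ≡ k + c + a
        regroup = solve-∀
    decide : Dec (Any Good (vecs T)) → Solution T
    decide (yes some) = j₀ , satisfied some
    decide (no none)  = contradiction (∣∑-isolated {f = value} (vecs-unique T) (∈-vecs (Vec.replicate T j₀)) (others (λ i g → none (lose i g))) total) const-∤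

-- Vectors of residues

lookup-injective : ∀ {A : Set} {xs : List A} → Unique xs → ∀ i j → List.lookup xs i ≡ List.lookup xs j → i ≡ j
lookup-injective (x∉ ∷ u) fzero    fzero    e = refl
lookup-injective (x∉ ∷ u) fzero    (fsuc j) e = contradiction e (All.lookup x∉ (∈-lookup j))
lookup-injective (x∉ ∷ u) (fsuc i) fzero    e = contradiction (sym e) (All.lookup x∉ (∈-lookup i))
lookup-injective (x∉ ∷ u) (fsuc i) (fsuc j) e = cong fsuc (lookup-injective u i j e)

length-vecs : ∀ m T → length (vecs {m} T) ≡ m ^ T
length-vecs m zero    = refl
length-vecs m (suc T) = trans (length≡∑ (vecs {m} (suc T))) (trans (∑-vecs {m} {T} (λ _ → 1))
  (trans (∑-const (allFin m) (∑ (vecs {m} T) (λ _ → 1))) (cong₂ _*_ (length-tabulate (λ (i : Fin m) → i)) (trans (sym (length≡∑ (vecs {m} T))) (length-vecs m T)))))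

module Residues (p : ℕ) .{{_ : NonZero p}} where
  open Congruence p

  toℕ-mod : ∀ k → toℕ (k mod p) ≡ k % p
  toℕ-mod k = Fin.toℕ-fromℕ< (m%n<n k p)

  _+ₚ_ : Fin p → Fin p → Fin p
  a +ₚ b = (toℕ a + toℕ b) mod p

  0ₚ : Fin p
  0ₚ = 0 mod p

  -ₚ_ : Fin p → Fin p
  -ₚ a = (p ∸ toℕ a) mod p

  toℕ-% : ∀ (a : Fin p) → toℕ a % p ≡ toℕ a
  toℕ-% a = m<n⇒m%n≡m (Fin.toℕ<n a)

  toℕ-+ₚ : ∀ a b → toℕ (a +ₚ b) ≈ toℕ a + toℕ b
  toℕ-+ₚ a b = trans (cong (_% p) (toℕ-mod (toℕ a + toℕ b))) (m%n%n≡m%n (toℕ a + toℕ b) p)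

  toℕ-0ₚ : toℕ 0ₚ ≈ 0
  toℕ-0ₚ = trans (cong (_% p) (toℕ-mod 0)) (m%n%n≡m%n 0 p)

  ≈⇒≡ : ∀ {a b : Fin p} → toℕ a ≈ toℕ b → a ≡ b
  ≈⇒≡ {a} {b} e = Fin.toℕ-injective (trans (sym (toℕ-% a)) (trans e (toℕ-% b)))

  +ₚ-assoc : ∀ a b c → (a +ₚ b) +ₚ c ≡ a +ₚ (b +ₚ c)
  +ₚ-assoc a b c = ≈⇒≡ (begin
    toℕ ((a +ₚ b) +ₚ c) % p            ≡⟨ toℕ-+ₚ (a +ₚ b) c ⟩
    (toℕ (a +ₚ b) + toℕ c) % p         ≡⟨ ≈-+ {toℕ (a +ₚ b)} {toℕ a + toℕ b} {toℕ c} (toℕ-+ₚ a b) refl ⟩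
    (toℕ a + toℕ b + toℕ c) % p        ≡⟨ cong (_% p) (+-assoc (toℕ a) (toℕ b) (toℕ c)) ⟩
    (toℕ a + (toℕ b + toℕ c)) % p      ≡⟨ ≈-+ {toℕ a} {_} {toℕ b + toℕ c} {toℕ (b +ₚ c)} refl (sym (toℕ-+ₚ b c)) ⟩
    (toℕ a + toℕ (b +ₚ c)) % p         ≡⟨ sym (toℕ-+ₚ a (b +ₚ c)) ⟩
    toℕ (a +ₚ (b +ₚ c)) % p            ∎)
    where open ≡-Reasoning

  +ₚ-comm : ∀ a b → a +ₚ b ≡ b +ₚ a
  +ₚ-comm a b = cong (_mod p) (+-comm (toℕ a) (toℕ b))

  +ₚ-idˡ : ∀ a → 0ₚ +ₚ a ≡ a
  +ₚ-idˡ a = ≈⇒≡ (trans (toℕ-+ₚ 0ₚ a) (≈-+ {toℕ 0ₚ} {0} {toℕ a} toℕ-0ₚ refl))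

  +ₚ-invˡ : ∀ a → (-ₚ a) +ₚ a ≡ 0ₚ
  +ₚ-invˡ a = ≈⇒≡ (begin
    toℕ ((-ₚ a) +ₚ a) % p              ≡⟨ toℕ-+ₚ (-ₚ a) a ⟩
    (toℕ (-ₚ a) + toℕ a) % p           ≡⟨ ≈-+ {toℕ (-ₚ a)} {p ∸ toℕ a} {toℕ a} (trans (cong (_% p) (toℕ-mod (p ∸ toℕ a))) (m%n%n≡m%n (p ∸ toℕ a) p)) refl ⟩
    (p ∸ toℕ a + toℕ a) % p            ≡⟨ cong (_% p) (m∸n+n≡m (<⇒≤ (Fin.toℕ<n a))) ⟩
    p % p                              ≡⟨ trans (n%n≡0 p) (sym (trans toℕ-0ₚ (m*n%n≡0 0 p))) ⟩
    toℕ 0ₚ % p                         ∎)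
    where open ≡-Reasoning

  𝔽 : ℕ → FinGroup
  𝔽 n = record
    { G = Vec (Fin p) n
    ; _≟G_ = ≡-dec Fin._≟_
    ; _⊕_ = zipWith _+ₚ_
    ; 𝟘 = Vec.replicate n 0ₚ
    ; ⊖_ = Vec.map -ₚ_
    ; ⊕-assoc = zipWith-assoc +ₚ-assoc
    ; ⊕-comm = zipWith-comm +ₚ-comm
    ; ⊕-idˡ = zipWith-identityˡ +ₚ-idˡ
    ; ⊕-invˡ = zipWith-inverseˡ +ₚ-invˡ
    ; univ = vecs n
    ; univ-all = ∈-vecs
    ; univ-unq = vecs-unique n
    }

  coordinate : ∀ {n} → Fin n → Vec (Fin p) n → ℕ
  coordinate i x = toℕ (Vec.lookup x i)

  coordinate-⊕ : ∀ {n} i (x y : Vec (Fin p) n) → coordinate i (zipWith _+ₚ_ x y) ≈ coordinate i x + coordinate i y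
  coordinate-⊕ i x y = trans (cong (λ t → toℕ t % p) (lookup-zipWith _+ₚ_ i x y)) (toℕ-+ₚ (Vec.lookup x i) (Vec.lookup y i))

  coordinate-𝟘 : ∀ {n} (i : Fin n) → coordinate i (Vec.replicate n 0ₚ) ≈ 0
  coordinate-𝟘 {n} i = trans (cong (λ t → toℕ t % p) (lookup-replicate i 0ₚ)) toℕ-0ₚ

  ≈-cancelˡ : ∀ {a b c d} → a ≈ b → a + c ≡ b + d → c ≈ d
  ≈-cancelˡ {a} {b} {c} {d} a≈b e = trans (sym (pad c)) (trans (≈-+ {(p ∸ 1) * b} {_} {b + c} refl b+c≈b+d) (pad d))
    where
    b+c≈b+d : b + c ≈ b + d
    b+c≈b+d = trans (≈-+ {b} {a} {c} (sym a≈b) refl) (cong (_% p) e)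
    shape : ∀ q b c → q * b + (b + c) ≡ c + b * (1 + q)
    shape = solve-∀
    pad : ∀ c → (p ∸ 1) * b + (b + c) ≈ c
    pad c = trans (cong (_% p) (trans (shape (p ∸ 1) b c) (cong (λ t → c + b * t) (m+[n∸m]≡n (>-nonZero⁻¹ p))))) ([m+kn]%n≡m%n c b p)

module PolynomialRelations (p : ℕ) (pp : Prime p) (n d T : ℕ) where
  instance
    p≢0 : NonZero p
    p≢0 = prime⇒nonZero pp
  open Residues p
  open Congruence p
  open Spreading (𝔽 n) p (Fin n) coordinate using (Relations; Split)

  -- Each occurrence of j₀ in the solution cancels one x on the other side, which is why `Split`
  -- allows fewer than T parts. As the solution is not constant, at least one part remains.
  relations : (p ∸ 1) * n < T * suc d → Relations (length (exponents n d)) T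
  relations lt X u few = from (solution d T few lt)
    where
    V : Set
    V = Vec (Fin p) n
    at : Fin (length X) → V
    at = List.lookup X
    open Tuples p pp (λ j i → coordinate i (at j))
    from : Solution T → ∃ λ x → x ∈ X × Split T (λ w → w ∈ X × w ≢ x) x
    from (j₀ , v , v≢ , eqs) = at j₀ , ∈-lookup j₀ , record
        { parts = parts v ; nonempty = nonempty v v≢ ; short = short v ; ok = ok v ; balance = λ i → ≈-cancelˡ (eqs i) (balance i v) }
      where
      parts : ∀ {T} → Vec (Fin (length X)) T → List V
      parts [] = []
      parts (j ∷ v) with j Fin.≟ j₀
      ... | yes _ = parts v
      ... | no _  = at j ∷ parts v
      nonempty : ∀ {T} (v : Vec (Fin (length X)) T) → v ≢ Vec.replicate T j₀ → 1 ≤ length (parts v)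
      nonempty [] v≢ = contradiction refl v≢
      nonempty (j ∷ v) v≢ with j Fin.≟ j₀
      ... | yes refl = nonempty v (λ e → v≢ (cong (j₀ ∷_) e))
      ... | no _     = s≤s z≤n
      short : ∀ {T} (v : Vec (Fin (length X)) T) → length (parts v) ≤ T
      short [] = z≤n
      short (j ∷ v) with j Fin.≟ j₀
      ... | yes _ = m≤n⇒m≤1+n (short v)
      ... | no _  = s≤s (short v)
      ok : ∀ {T} (v : Vec (Fin (length X)) T) → All (λ w → w ∈ X × w ≢ at j₀) (parts v)
      ok [] = []
      ok (j ∷ v) with j Fin.≟ j₀
      ... | yes _ = ok v
      ... | no j≢ = (∈-lookup j , λ e → j≢ (lookup-injective u j j₀ e)) ∷ ok v
      balance : ∀ {T} i (v : Vec (Fin (length X)) T) →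
        coords v i + length (parts v) * coordinate i (at j₀) ≡ T * coordinate i (at j₀) + ∑ (parts v) (coordinate i)
      balance i [] = refl
      balance {suc T} i (j ∷ v) with j Fin.≟ j₀
      ... | yes refl = trans (+-assoc y (coords v i) (length (parts v) * y)) (trans (cong (y +_) (balance i v)) (sym (+-assoc y (T * y) (∑ (parts v) (coordinate i)))))
        where
        y : ℕ
        y = coordinate i (at j₀)
      ... | no _ = trans (shape (coordinate i (at j)) (coords v i) y (length (parts v) * y)) (trans (cong (coordinate i (at j) + y +_) (balance i v)) (shape′ (coordinate i (at j)) y (T * y) (∑ (parts v) (coordinate i))))
        where
        y : ℕ
        y = coordinate i (at j₀)
        shape : ∀ a c y l → a + c + (y + l) ≡ a + y + (c + l)
        shape = solve-∀
        shape′ : ∀ a y t s → a + y + (t + s) ≡ y + t + (a + s)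
        shape′ = solve-∀

-- Choice of the parameters

*-^ : ∀ e a b → (a * b) ^ e ≡ a ^ e * b ^ e
*-^ zero    a b = refl
*-^ (suc e) a b = trans (cong (a * b *_) (*-^ e a b)) (*-interchange a b (a ^ e) (b ^ e))

-- Induction on p: ρ is doubled whenever p overtakes ρ ^ e, so ρ ^ e stays within the factor 2 ^ e
-- of p.
approximate-root : ∀ e p → 0 < e → 0 < p → ∃ λ ρ → 0 < ρ × p ≤ ρ ^ e × ρ ^ e ≤ 2 ^ e * p
approximate-root e 1 e>0 _ = 1 , s≤s z≤n , ≤-reflexive (sym (^-zeroˡ e)) ,
  ≤-trans (≤-reflexive (^-zeroˡ e)) (≤-trans (m^n>0 2 e) (≤-reflexive (sym (*-identityʳ (2 ^ e)))))
approximate-root e (suc (suc p)) e>0 _ = from (approximate-root e (suc p) e>0 (s≤s z≤n))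
  where
  from : (∃ λ ρ → 0 < ρ × suc p ≤ ρ ^ e × ρ ^ e ≤ 2 ^ e * suc p) → ∃ λ ρ → 0 < ρ × suc (suc p) ≤ ρ ^ e × ρ ^ e ≤ 2 ^ e * suc (suc p)
  from (ρ , ρ>0 , lo , hi) = decide (suc (suc p) ≤? ρ ^ e)
    where
    double : (2 * ρ) ^ e ≡ 2 ^ e * ρ ^ e
    double = *-^ e 2 ρ
    decide : Dec (suc (suc p) ≤ ρ ^ e) → ∃ λ ρ → 0 < ρ × suc (suc p) ≤ ρ ^ e × ρ ^ e ≤ 2 ^ e * suc (suc p)
    decide (yes h) = ρ , ρ>0 , h , ≤-trans hi (*-monoʳ-≤ (2 ^ e) (n≤1+n (suc p)))
    decide (no ¬h) = 2 * ρ , *-mono-< {0} {2} (s≤s z≤n) ρ>0 ,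
      ≤-trans (≤-trans (s≤s (m≤m+n (suc p) p)) (≤-trans (≤-reflexive (shape p)) (*-mono-≤ (≤-trans (≤-reflexive (sym (*-identityʳ 2))) (^-monoʳ-≤ 2 e>0)) lo))) (≤-reflexive (sym double)) ,
      ≤-trans (≤-reflexive double) (*-monoʳ-≤ (2 ^ e) (<⇒≤ (≰⇒> ¬h)))
      where
      shape : ∀ p → suc (suc p + p) ≡ 2 * suc p
      shape = solve-∀

module _ (p n : ℕ) (pp : Prime p) where
  instance
    p≢0 : NonZero p
    p≢0 = prime⇒nonZero pp
  open Residues p
  open Congruence p
  open GroupSums (𝔽 n)
  open Swaps (𝔽 n) using (pool; Pool)
  open Spreading (𝔽 n) p (Fin n) coordinate using (Relations; size; size≤; flat; module Flat₀)
  open Assembly (𝔽 n) p (Fin n) coordinate using (ZeroSum; zero-sum)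
  open PolynomialRelations p pp n using (relations)

  private
    V : Set
    V = Vec (Fin p) n

  zero-sum⇒tuple : ∀ {A : List V} k (ys : List V) → length ys ≡ k → Unique ys → All (_∈ A) ys → (∀ i → ∑ ys (coordinate i) ≈ 0) →
    Σ (Fin k → V) λ x → Injective _≡_ _≡_ x × ((j : Fin k) → x j ∈ A) × SumsToZero p n k x
  zero-sum⇒tuple k ys refl unique inside moment = List.lookup ys , lookup-injective unique _ _ , (λ j → All.lookup inside (∈-lookup j)) ,
    λ i → m%n≡0⇒n∣m _ p (trans (cong (_% p) (sums ys (coordinate i))) (trans (moment i) (m*n%n≡0 0 p)))
    where
    sums : ∀ (ys : List V) f → Σ< (length ys) (λ j → f (List.lookup ys j)) ≡ ∑ ys f
    sums []       f = refl
    sums (y ∷ ys) f = cong (f y +_) (sums ys f)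

  module Large (k : ℕ) (k≥1 : 1 ≤ k) (p≥ : 4 * k * k ≤ p) (I : ℕ) (k≡ : k ≡ Kmax I) where

    instance
      k≢0 : NonZero k
      k≢0 = >-nonZero k≥1
      2k≢0 : NonZero (2 * k)
      2k≢0 = m*n≢0 2 k

    -- A block length K ≤ k gives c = p / K columns, and T is at most half of c; so e = c ∸ T is
    -- still at least T. From p ≤ 4 k T it follows both that t = 4 k layers suffice and that the
    -- degree d = 4 k n is high enough for relations of length T.
    T t d Γ N : ℕ
    T = p / (2 * k)
    t = 4 * k
    d = t * n
    Γ = length (exponents n d)

    T*2k≤p : T * (2 * k) ≤ p
    T*2k≤p = m/n*n≤m p (2 * k)

    T≥1 : 1 ≤ T
    T≥1 = m≥n⇒m/n>0 (≤-trans (≤-trans (*-monoˡ-≤ k {2} {4} (s≤s (s≤s z≤n))) (m≤m*n (4 * k) k)) p≥)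

    p≤4kT : p ≤ t * T
    p≤4kT = begin
      p                                       ≡⟨ m≡m%n+[m/n]*n p (2 * k) ⟩
      p % (2 * k) + T * (2 * k)               ≤⟨ +-monoˡ-≤ (T * (2 * k)) (≤-trans (<⇒≤ (m%n<n p (2 * k))) (m≤n*m (2 * k) T {{>-nonZero T≥1}})) ⟩
      T * (2 * k) + T * (2 * k)               ≡⟨ shape T k ⟩
      4 * k * T                               ∎
      where
      open ≤-Reasoning
      shape : ∀ T k → T * (2 * k) + T * (2 * k) ≡ 4 * k * T
      shape = solve-∀

    rel : Relations Γ T
    rel = relations d T (begin-strict
      (p ∸ 1) * n           ≤⟨ *-monoˡ-≤ n (≤-trans (m∸n≤m p 1) p≤4kT) ⟩
      t * T * n             ≡⟨ trans (cong (_* n) (*-comm t T)) (*-assoc T t n) ⟩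
      T * d                 <⟨ m<m+n (T * d) T≥1 ⟩
      T * d + T             ≡⟨ trans (+-comm (T * d) T) (sym (*-suc T d)) ⟩
      T * suc d             ∎)
      where open ≤-Reasoning

    N = size Γ T rel t 1

    -- The number of monomials is all that is exponential in n, with a base depending on k only. The
    -- number of layers does not depend on n, so p enters through a factor that can go into D.
    N≤ : 1 + N ≤ 4 * (2 + p) ^ t * (2 ^ suc t) ^ n
    N≤ = begin
      1 + N                                          ≤⟨ +-mono-≤ one (size≤ Γ T rel t 1) ⟩
      (1 + Γ) * (2 + T) ^ t + (1 + Γ) * (2 + T) ^ t  ≡⟨ shape (1 + Γ) ((2 + T) ^ t) ⟩
      2 * (2 + T) ^ t * (1 + Γ)                      ≤⟨ *-mono-≤ (*-monoʳ-≤ 2 (^-monoˡ-≤ t (+-monoʳ-≤ 2 (m/n≤m p (2 * k))))) Γ≤ ⟩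
      2 * (2 + p) ^ t * (2 * (2 ^ suc t) ^ n)        ≡⟨ shape′ ((2 + p) ^ t) ((2 ^ suc t) ^ n) ⟩
      4 * (2 + p) ^ t * (2 ^ suc t) ^ n              ∎
      where
      open ≤-Reasoning
      one : 1 ≤ (1 + Γ) * (2 + T) ^ t
      one = *-mono-≤ {1} {1 + Γ} (s≤s z≤n) (m^n>0 (2 + T) t)
      shape : ∀ g u → g * u + g * u ≡ 2 * u * g
      shape = solve-∀
      shape′ : ∀ u v → 2 * u * (2 * v) ≡ 4 * u * v
      shape′ = solve-∀
      pow : 2 ^ (n + d) ≡ (2 ^ suc t) ^ n
      pow = sym (^-*-assoc 2 (suc t) n)
      Γ≤ : 1 + Γ ≤ 2 * (2 ^ suc t) ^ n
      Γ≤ = ≤-trans (+-mono-≤ (m^n>0 (2 ^ suc t) {{m^n≢0 2 (suc t)}} n) (≤-trans (length-exponents n d) (≤-reflexive pow)))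
             (≤-reflexive (cong ((2 ^ suc t) ^ n +_) (sym (+-identityʳ ((2 ^ suc t) ^ n)))))

    conclude : ∀ (A : G → Bool) → Pool A p k N → ZeroSum coordinate-⊕ coordinate-𝟘 A
    conclude A (K₀ , K≤k , as , size-as , unique , inside , swap) =
      zero-sum coordinate-⊕ coordinate-𝟘 Fl.μ c r μ≤c Fl.total Fl.moment Fl.support p≡ r<c (<⇒≤ r<K) inside swap
      where
      K c r e : ℕ
      K = 2 + K₀
      c = p / K
      r = p % K
      e = c ∸ T
      r<K : r < K
      r<K = m%n<n p K
      p≡ : p ≡ c * K + r
      p≡ = trans (m≡m%n+[m/n]*n p K) (+-comm r (c * K))
      kk≤p : k * k ≤ p
      kk≤p = ≤-trans (*-monoˡ-≤ k (m≤n*m k 4)) p≥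
      k≤c : k ≤ c
      k≤c = ≤-trans (≤-reflexive (sym (m*n/n≡m k K))) (/-monoˡ-≤ K (≤-trans (*-monoʳ-≤ k K≤k) kk≤p))
      r<c : r < c
      r<c = <-≤-trans r<K (≤-trans K≤k k≤c)
      2T≤c : 2 * T ≤ c
      2T≤c = ≤-trans (≤-reflexive (sym (m*n/n≡m (2 * T) K))) (/-monoˡ-≤ K (≤-trans (*-monoʳ-≤ (2 * T) K≤k) (≤-trans (≤-reflexive (shape T k)) T*2k≤p)))
        where
        shape : ∀ T k → 2 * T * k ≡ T * (2 * k)
        shape = solve-∀
      T≤c : T ≤ c
      T≤c = ≤-trans (m≤m+n T (T + 0)) 2T≤c
      c≡ : e + T ≡ c
      c≡ = m∸n+n≡m T≤c
      T≤e : T ≤ e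
      T≤e = +-cancelʳ-≤ T T e (≤-trans (≤-trans (≤-reflexive (cong (T +_) (sym (+-identityʳ T)))) 2T≤c) (≤-reflexive (sym c≡)))
      p≤ : p ≤ e + T + t * e
      p≤ = ≤-trans p≤4kT (≤-trans (*-monoʳ-≤ t T≤e) (m≤n+m (t * e) (e + T)))
      module Fl = Flat₀ (flat Γ T rel e as unique t p≤ size-as)
      μ≤c : ∀ x → Fl.μ x ≤ c
      μ≤c x = ≤-trans (Fl.μ≤c x) (≤-reflexive c≡)

    bound : ∀ ρ X (A : List V) → C₀ ≤ ρ → X ≡ ρ ^ power I → p ^ n ≤ X ^ I → 4 * (2 + p) ^ t * (2 ^ suc t) ^ n ≤ ρ → 2 * k ≤ ρ → k * p + k * k ≤ ρ →
            Unique A → ¬ HasZeroSumPTuple p n A → length A < X ^ 5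
    bound ρ X A C₀≤ρ X≡ univ≤ N≤ρ 2k≤ kp≤ unique none = ≰⇒> λ X≤ → none (from (conclude P (subst (λ k → Pool P p k N) (sym k≡)
        (pool I P ρ X p N C₀≤ρ X≡ (≤-trans (≤-reflexive (length-vecs p n)) univ≤) (≤-trans X≤ A≤P) (≤-trans N≤ N≤ρ)
          (subst (λ k → 2 * k ≤ ρ) k≡ 2k≤) (subst (λ k → k * p + k * k ≤ ρ) k≡ kp≤)))))
      where
      open DecMembership _≟G_ using (_∈?_)
      P : V → Bool
      P x = ⌊ x ∈? A ⌋
      A≤P : length A ≤ ∣ P ∣
      A≤P = begin
        length A                                 ≡⟨ length≡∑ A ⟩
        ∑ A (λ _ → 1)                            ≡⟨ ∑-cong A (λ a → sym (trans (∑-cong univ (λ x → sym (*-identityʳ (δ x a)))) (S-δ a (λ _ → 1)))) ⟩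
        ∑ A (λ a → S (λ x → δ x a))              ≡⟨ ∑-swap A univ (λ a x → δ x a) ⟩
        S (λ x → ∑ A (λ a → δ x a))              ≤⟨ ∑-mono univ (λ x → at x (x ∈? A)) ⟩
        ∣ P ∣                                    ∎
        where
        open ≤-Reasoning
        flip : ∀ x a → δ x a ≡ δ a x * 1
        flip x a = trans (δ-⇔ sym sym) (sym (*-identityʳ (δ a x)))
        at : ∀ x (dec : Dec (x ∈ A)) → ∑ A (λ a → δ x a) ≤ # ⌊ dec ⌋
        at x (yes i) = ≤-reflexive (trans (∑-cong A (flip x)) (∑-δ (λ _ → 1) unique i))
        at x (no ∉)  = ≤-reflexive (trans (∑-cong A (flip x)) (∑-δ∉ (λ _ → 1) ∉))
      from : ZeroSum coordinate-⊕ coordinate-𝟘 P → HasZeroSumPTuple p n A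
      from zs = zero-sum⇒tuple p family size′ unique′ (All.map (λ {x} e → ⌊⌋-true {d = x ∈? A} e) inside) moment
        where open ZeroSum zs renaming (size to size′; unique to unique′)

  length≤ : ∀ (A : List V) → Unique A → length A ≤ p ^ n
  length≤ A unique = ≤-trans (≤-trans (removeAll-length univ A unique) (≤-reflexive (trans (cong (length (vecs {p} n) +_) (empty (removeAll univ A) (λ i → proj₂ (removeAll⁻ univ {A} i)))) (+-identityʳ _)))) (≤-reflexive (length-vecs p n))
    where
    open Spreading (𝔽 n) p (Fin n) coordinate using (removeAll; removeAll-length; removeAll⁻)
    empty : ∀ xs → (∀ {x} → x ∈ xs → x ∉ univ) → length xs ≡ 0
    empty []       _ = refl
    empty (x ∷ xs) h = contradiction (univ-all x) (h (here refl))

Kmax>0 : ∀ {i} → 0 < i → 1 ≤ Kmax i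
Kmax>0 {suc i} _ = ≤-trans (s≤s z≤n) (m≤n⊔m (Kmax i) (2 + reach i))

private
  module Constants (b I k : ℕ) (b>0 : 0 < b) (I≡ : I ≡ 5 * b) (k≡ : k ≡ Kmax I) where

    I>0 : 0 < I
    I>0 = subst (0 <_) (sym I≡) (<-≤-trans b>0 (m≤n*m b 5))

    k≥1 : 1 ≤ k
    k≥1 = subst (1 ≤_) (sym k≡) (Kmax>0 I>0)

    -- X ^ I = ρ ^ e, so ρ has to be about p ^ (n / e). In C, the term 4 * k * k serves the small
    -- primes, for which the trivial bound p ^ n is used; the other term collects C₁ ^ e and the
    -- rounding loss 2 ^ e of the approximate root.
    t C₁ e C : ℕ
    t  = 4 * k
    C₁ = 2 ^ suc t
    e  = power I * I
    C  = 4 * k * k + (2 * C₁) ^ e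

    e>0 : 0 < e
    e>0 = >-nonZero⁻¹ e {{m*n≢0 (power I) I {{power≢0 I}} {{>-nonZero I>0}}}}

    C₁>0 : 0 < C₁
    C₁>0 = m^n>0 2 (suc t)

    C>0 : 0 < C
    C>0 = <-≤-trans (m^n>0 (2 * C₁) {{m*n≢0 2 C₁ {{_}} {{>-nonZero C₁>0}}}} e) (m≤n+m ((2 * C₁) ^ e) (4 * k * k))

    opaque
      -- Adds up all that is demanded of ρ apart from the factor exponential in n.
      D₀ : ℕ → ℕ
      D₀ p = C₀ + (4 * (2 + p) ^ t + (2 * k + (k * p + k * k)))

      C₀≤D₀ : ∀ p → C₀ ≤ D₀ p
      C₀≤D₀ p = m≤m+n C₀ (4 * (2 + p) ^ t + (2 * k + (k * p + k * k)))

      layers≤D₀ : ∀ p → 4 * (2 + p) ^ t ≤ D₀ p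
      layers≤D₀ p = m≤n⇒m≤o+n C₀ (m≤m+n (4 * (2 + p) ^ t) (2 * k + (k * p + k * k)))

      2k≤D₀ : ∀ p → 2 * k ≤ D₀ p
      2k≤D₀ p = m≤n⇒m≤o+n C₀ (m≤n⇒m≤o+n (4 * (2 + p) ^ t) (m≤m+n (2 * k) (k * p + k * k)))

      kp≤D₀ : ∀ p → k * p + k * k ≤ D₀ p
      kp≤D₀ p = m≤n⇒m≤o+n C₀ (m≤n⇒m≤o+n (4 * (2 + p) ^ t) (m≤n+m (k * p + k * k) (2 * k)))

    D : ℕ → ℕ
    D p = D₀ p ^ e

    D₀>0 : ∀ p → 0 < D₀ p
    D₀>0 p = <-≤-trans C₀>0 (C₀≤D₀ p)

    m≤m^n : ∀ m n → 0 < m → 0 < n → m ≤ m ^ n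
    m≤m^n m n m>0 n>0 = ≤-trans (≤-reflexive (sym (*-identityʳ m))) (^-monoʳ-≤ m {{>-nonZero m>0}} n>0)

    module _ (a : ℕ) (a>0 : 0 < a) (p : ℕ) (pp : Prime p) (n : ℕ) (A : List (Vec (Fin p) n)) (unique : Unique A) (none : ¬ HasZeroSumPTuple p n A) where

      p>0 : 0 < p
      p>0 = >-nonZero⁻¹ p {{prime⇒nonZero pp}}

      D>0 : 0 < D p
      D>0 = m^n>0 (D₀ p) {{>-nonZero (D₀>0 p)}} e

      C^n≤ : C ^ n ≤ C ^ (b * n)
      C^n≤ = ^-monoʳ-≤ C {{>-nonZero C>0}} (m≤n*m n b {{>-nonZero b>0}})

      small : p ≤ 4 * k * k → length A ^ b ≤ D p ^ b * C ^ (b * n) * p ^ (a * n)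
      small p≤ = begin
        length A ^ b                            ≤⟨ ^-monoˡ-≤ b (length≤ p n pp A unique) ⟩
        (p ^ n) ^ b                             ≡⟨ trans (^-*-assoc p n b) (cong (p ^_) (*-comm n b)) ⟩
        p ^ (b * n)                             ≤⟨ ^-monoˡ-≤ (b * n) (≤-trans p≤ (m≤m+n (4 * k * k) ((2 * C₁) ^ e))) ⟩
        C ^ (b * n)                             ≡⟨ trans (sym (*-identityˡ (C ^ (b * n)))) (sym (*-identityʳ (1 * C ^ (b * n)))) ⟩
        1 * C ^ (b * n) * 1                     ≤⟨ *-mono-≤ (*-monoˡ-≤ (C ^ (b * n)) (m^n>0 (D p) {{>-nonZero D>0}} b)) (m^n>0 p {{>-nonZero p>0}} (a * n)) ⟩
        D p ^ b * C ^ (b * n) * p ^ (a * n)     ∎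
        where open ≤-Reasoning

      large : 4 * k * k ≤ p → length A ^ b ≤ D p ^ b * C ^ (b * n) * p ^ (a * n)
      large p≥ = from (approximate-root e p e>0 p>0)
        where
        from : (∃ λ ρ₀ → 0 < ρ₀ × p ≤ ρ₀ ^ e × ρ₀ ^ e ≤ 2 ^ e * p) → length A ^ b ≤ D p ^ b * C ^ (b * n) * p ^ (a * n)
        from (ρ₀ , ρ₀>0 , lo , hi) = begin
          length A ^ b                              ≤⟨ ^-monoˡ-≤ b (<⇒≤ A<) ⟩
          (X ^ 5) ^ b                               ≡⟨ trans (^-*-assoc X 5 b) (cong (X ^_) (sym I≡)) ⟩
          X ^ I                                     ≡⟨ X^I ⟩
          ρ ^ e                                     ≡⟨ *-^ e (D₀ p) (Y ^ n) ⟩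
          D p * (Y ^ n) ^ e                         ≡⟨ cong (D p *_) (swap^ Y n e) ⟩
          D p * (Y ^ e) ^ n                         ≤⟨ *-monoʳ-≤ (D p) (^-monoˡ-≤ n Y^e≤) ⟩
          D p * (C * p) ^ n                         ≡⟨ trans (cong (D p *_) (*-^ n C p)) (sym (*-assoc (D p) (C ^ n) (p ^ n))) ⟩
          -- The bound reached here is the one for ε = 1 / b, which implies the one for a / b.
          D p * C ^ n * p ^ n                       ≤⟨ *-mono-≤ (*-mono-≤ (m≤m^n (D p) b D>0 b>0) C^n≤) (^-monoʳ-≤ p {{>-nonZero p>0}} (m≤n*m n a {{>-nonZero a>0}})) ⟩
          D p ^ b * C ^ (b * n) * p ^ (a * n)       ∎
          where
          open ≤-Reasoning
          Y ρ X : ℕ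
          -- Y ^ e lies between p and C * p, so ρ ^ e is at least p ^ n and at most D p * (C * p) ^
          -- n.
          Y = C₁ * ρ₀
          ρ = D₀ p * Y ^ n
          X = ρ ^ power I
          swap^ : ∀ x m n → (x ^ m) ^ n ≡ (x ^ n) ^ m
          swap^ x m n = trans (^-*-assoc x m n) (trans (cong (x ^_) (*-comm m n)) (sym (^-*-assoc x n m)))
          X^I : X ^ I ≡ ρ ^ e
          X^I = ^-*-assoc ρ (power I) I
          Y^e≤ : Y ^ e ≤ C * p
          Y^e≤ = ≤-trans (≤-reflexive (*-^ e C₁ ρ₀)) (≤-trans (*-monoʳ-≤ (C₁ ^ e) hi) (≤-trans (≤-reflexive (trans (sym (*-assoc (C₁ ^ e) (2 ^ e) p))
                   (cong (_* p) (trans (*-comm (C₁ ^ e) (2 ^ e)) (sym (*-^ e 2 C₁)))))) (*-monoˡ-≤ p (m≤n+m ((2 * C₁) ^ e) (4 * k * k)))))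
          instance
            Y^n≢0 : NonZero (Y ^ n)
            Y^n≢0 = m^n≢0 Y n {{m*n≢0 C₁ ρ₀ {{>-nonZero C₁>0}} {{>-nonZero ρ₀>0}}}}
          D₀≤ρ : D₀ p ≤ ρ
          D₀≤ρ = m≤m*n (D₀ p) (Y ^ n)
          univ≤ : p ^ n ≤ X ^ I
          univ≤ = begin
            p ^ n               ≤⟨ ^-monoˡ-≤ n lo ⟩
            (ρ₀ ^ e) ^ n        ≡⟨ swap^ ρ₀ e n ⟩
            (ρ₀ ^ n) ^ e        ≤⟨ ^-monoˡ-≤ e (≤-trans (^-monoˡ-≤ n (m≤n*m ρ₀ C₁ {{>-nonZero C₁>0}})) (m≤n*m (Y ^ n) (D₀ p) {{>-nonZero (D₀>0 p)}})) ⟩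
            ρ ^ e               ≡⟨ sym X^I ⟩
            X ^ I               ∎
          A< : length A < X ^ 5
          A< = Large.bound p n pp k k≥1 p≥ I k≡ ρ X A (≤-trans (C₀≤D₀ p) D₀≤ρ) refl univ≤
                 (*-mono-≤ (layers≤D₀ p) (^-monoˡ-≤ n (m≤m*n C₁ ρ₀ {{>-nonZero ρ₀>0}}))) (≤-trans (2k≤D₀ p) D₀≤ρ) (≤-trans (kp≤D₀ p) D₀≤ρ) unique none

-- ε is the rational number a / b, and the inequality is raised to the power b to stay within ℕ. A
-- real ε is covered by any positive rational below it.
theorem1p2 : (a b : ℕ) → 0 < a → 0 < b →
    Σ ℕ λ C →
    (p : ℕ) → Prime p →
    Σ ℕ λ D →
    (n : ℕ) → 0 < n →
    (A : List (Vec (Fin p) n)) → Unique A →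
    ¬ HasZeroSumPTuple p n A →
    length A ^ b ≤ D ^ b * C ^ (b * n) * p ^ (a * n)
theorem1p2 a b a>0 b>0 = C , λ p pp → D p , λ n _ A unique none →
  [ small a a>0 p pp n A unique none , large a a>0 p pp n A unique none ]′ (≤-total p (4 * Kmax (5 * b) * Kmax (5 * b)))
  where
  open Constants b (5 * b) (Kmax (5 * b)) b>0 refl refl
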